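{- For every $\varepsilon>0$ and every integer $r\ge2$ there exists a constant $K'=K'(r,\varepsilon)$ such that the following holds for every positive integer $n$ with $p:=K'n^{ -1/r}\le 1$. If the edges of the random graph $G(n,p)$ are colored independently and uniformly at random with $q\ge rn$ colors, then with probability at least $1-\varepsilon$ the resulting graph contains a rainbow $r$-th power of a Hamilton cycle.
   Context: $G(n,p)$ is the binomial random graph on $n$ vertices. The $r$-th power of a graph $G$ is obtained from $G$ by adding edges between all pairs of vertices at distance at most $r$ in $G$. The $r$-th power of a Hamilton cycle in an $n$-vertex graph is a subgraph that is the $r$-th power of a cycle through all $n$ vertices. A subgraph is rainbow if its edges have pairwise distinct colors. -}

module Defs where

open import Data.Bool.Base using (Bool; true; false; if_then_else_)
open import Data.Empty using (⊥-elim)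
open import Data.Fin.Base using (Fin; toℕ)
import Data.Fin.Properties as Fin
open import Data.Integer.Base using (+_)
import Data.Integer.Base as ℤ
import Data.Integer.Properties as ℤ
import Data.Integer.Solver as IntSolver
open import Data.List.Base using (List; []; _∷_; map; concatMap; filter; allFin; cartesianProduct)
import Data.List.Membership.DecPropositional as DecMembership
open import Data.List.Membership.Propositional using (_∈_)
open import Data.Nat.Base using (ℕ; zero; suc; z≤n; s≤s; NonZero)
import Data.Nat.Base as ℕ
import Data.Nat.Properties as ℕ
open import Data.Product.Base using (Σ; ∃; ∃-syntax; _×_; _,_; proj₁; proj₂)
open import Data.Product.Properties using (≡-dec)
open import Data.Rational.Base
  using (ℚ; mkℚ; 0ℚ; 1ℚ; ½; _+_; _*_; -_; _-_; _/_; ∣_∣; _≤_; _<_; 1/_;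
         Positive; positive; nonNegative; toℚᵘ)
import Data.Rational.Properties as ℚ
import Data.Rational.Unnormalised.Base as ℚᵘ
import Data.Rational.Unnormalised.Properties as ℚᵘ
open import Data.Rational.Solver using (module +-*-Solver)
open import Data.Sum.Base using (_⊎_; inj₁; inj₂)
open import Data.Vec.Base using (Vec; []; _∷_; lookup)
import Data.Vec.Relation.Unary.AllPairs as AllPairs
open import Data.Vec.Relation.Unary.Unique.Propositional using (Unique)
open import Data.Vec.Relation.Unary.Unique.Propositional.Properties using (lookup-injective)
open import Relation.Binary.PropositionalEquality
  using (_≡_; _≢_; refl; sym; trans; cong; cong₂; subst; subst₂)
open import Relation.Nullary using (¬_; Dec; yes; no; does)
open import Relation.Nullary.Decidable using (map′; ¬?; _×-dec_; _⊎-dec_; _→-dec_)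
open import Relation.Unary using (Decidable)

record ℝ : Set where
  field
    seq    : ℕ → ℚ
    cauchy : ∀ δ → 0ℚ < δ →
             ∃[ N ] ∀ m n → N ℕ.≤ m → N ℕ.≤ n → ∣ seq m - seq n ∣ ≤ δ

open ℝ

infix 4 _<ᴿ_ _≤ᴿ_ _≃ᴿ_

_<ᴿ_ : ℝ → ℝ → Set
x <ᴿ y = ∃[ δ ] 0ℚ < δ × ∃[ N ] ∀ n → N ℕ.≤ n → seq x n + δ ≤ seq y n

_≤ᴿ_ : ℝ → ℝ → Set
x ≤ᴿ y = ∀ δ → 0ℚ < δ → ∃[ N ] ∀ n → N ℕ.≤ n → seq x n ≤ seq y n + δ

_≃ᴿ_ : ℝ → ℝ → Set
x ≃ᴿ y = x ≤ᴿ y × y ≤ᴿ x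

fromℚ : ℚ → ℝ
fromℚ q = record
  { seq    = λ _ → q
  ; cauchy = λ δ 0<δ → 0 , λ _ _ _ _ →
      subst (_≤ δ) (sym (cong ∣_∣ (ℚ.+-inverseʳ q))) (ℚ.<⇒≤ 0<δ)
  }

0ᴿ 1ᴿ : ℝ
0ᴿ = fromℚ 0ℚ
1ᴿ = fromℚ 1ℚ

private
  open ℚ.≤-Reasoning

  0<½* : ∀ {δ} → 0ℚ < δ → 0ℚ < ½ * δ
  0<½* {δ} 0<δ = ℚ.positive⁻¹ (½ * δ) {{ℚ.pos*pos⇒pos ½ δ {{positive 0<δ}}}}

  halves : ∀ δ → ½ * δ + ½ * δ ≡ δ
  halves δ = trans (sym (ℚ.*-distribʳ-+ δ ½ ½)) (ℚ.*-identityˡ δ)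

  *-mono-≤-nonNeg : ∀ {a b c d} → 0ℚ ≤ a → 0ℚ ≤ d → a ≤ b → c ≤ d → a * c ≤ b * d
  *-mono-≤-nonNeg {a} {b} {c} {d} 0≤a 0≤d a≤b c≤d = begin
    a * c ≤⟨ ℚ.*-monoˡ-≤-nonNeg a {{nonNegative 0≤a}} c≤d ⟩
    a * d ≤⟨ ℚ.*-monoʳ-≤-nonNeg d {{nonNegative 0≤d}} a≤b ⟩
    b * d ∎

infixl 6 _+ᴿ_ _-ᴿ_
infixl 7 _*ᴿ_

_+ᴿ_ : ℝ → ℝ → ℝ
x +ᴿ y = record { seq = λ n → seq x n + seq y n ; cauchy = cauchy′ }
  where
  rearrange : ∀ a b c d → (a + b) - (c + d) ≡ (a - c) + (b - d)
  rearrange = solve 4 (λ a b c d → (a :+ b) :- (c :+ d) := (a :- c) :+ (b :- d)) refl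
    where open +-*-Solver

  cauchy′ : ∀ δ → 0ℚ < δ → ∃[ N ] ∀ m n → N ℕ.≤ m → N ℕ.≤ n →
            ∣ (seq x m + seq y m) - (seq x n + seq y n) ∣ ≤ δ
  cauchy′ δ 0<δ with cauchy x (½ * δ) (0<½* 0<δ) | cauchy y (½ * δ) (0<½* 0<δ)
  ... | M , hx | N , hy = M ℕ.⊔ N , λ m n h k → begin
    ∣ (seq x m + seq y m) - (seq x n + seq y n) ∣
      ≡⟨ cong ∣_∣ (rearrange (seq x m) (seq y m) (seq x n) (seq y n)) ⟩
    ∣ (seq x m - seq x n) + (seq y m - seq y n) ∣
      ≤⟨ ℚ.∣p+q∣≤∣p∣+∣q∣ (seq x m - seq x n) (seq y m - seq y n) ⟩
    ∣ seq x m - seq x n ∣ + ∣ seq y m - seq y n ∣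
      ≤⟨ ℚ.+-mono-≤ (hx m n (ℕ.m⊔n≤o⇒m≤o M N h) (ℕ.m⊔n≤o⇒m≤o M N k))
                    (hy m n (ℕ.m⊔n≤o⇒n≤o M N h) (ℕ.m⊔n≤o⇒n≤o M N k)) ⟩
    ½ * δ + ½ * δ
      ≡⟨ halves δ ⟩
    δ ∎

-ᴿ_ : ℝ → ℝ
-ᴿ x = record { seq = λ n → - seq x n ; cauchy = cauchy′ }
  where
  rearrange : ∀ a b → - a - - b ≡ - (a - b)
  rearrange = solve 2 (λ a b → :- a :- :- b := :- (a :- b)) refl
    where open +-*-Solver

  cauchy′ : ∀ δ → 0ℚ < δ → ∃[ N ] ∀ m n → N ℕ.≤ m → N ℕ.≤ n →
            ∣ - seq x m - - seq x n ∣ ≤ δ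
  cauchy′ δ 0<δ with cauchy x δ 0<δ
  ... | N , hx = N , λ m n h k → begin
    ∣ - seq x m - - seq x n ∣   ≡⟨ cong ∣_∣ (rearrange (seq x m) (seq x n)) ⟩
    ∣ - (seq x m - seq x n) ∣   ≡⟨ ℚ.∣-p∣≡∣p∣ (seq x m - seq x n) ⟩
    ∣ seq x m - seq x n ∣       ≤⟨ hx m n h k ⟩
    δ                           ∎

_-ᴿ_ : ℝ → ℝ → ℝ
x -ᴿ y = x +ᴿ (-ᴿ y)

private
  bounded : ∀ x → ∃[ B ] 0ℚ < B × ∃[ N ] ∀ n → N ℕ.≤ n → ∣ seq x n ∣ ≤ B
  bounded x with cauchy x 1ℚ (ℚ.positive⁻¹ 1ℚ)
  ... | N , hx = 1ℚ + ∣ seq x N ∣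
               , ℚ.+-mono-<-≤ (ℚ.positive⁻¹ 1ℚ) (ℚ.0≤∣p∣ (seq x N))
               , N , λ n h → begin
    ∣ seq x n ∣
      ≡⟨ cong ∣_∣ (rearrange (seq x n) (seq x N)) ⟩
    ∣ (seq x n - seq x N) + seq x N ∣
      ≤⟨ ℚ.∣p+q∣≤∣p∣+∣q∣ (seq x n - seq x N) (seq x N) ⟩
    ∣ seq x n - seq x N ∣ + ∣ seq x N ∣
      ≤⟨ ℚ.+-monoˡ-≤ ∣ seq x N ∣ (hx n N h ℕ.≤-refl) ⟩
    1ℚ + ∣ seq x N ∣ ∎
    where
    rearrange : ∀ a b → a ≡ (a - b) + b
    rearrange = solve 2 (λ a b → a := (a :- b) :+ b) refl
      where open +-*-Solver

private
  divide : ∀ B δ → 0ℚ < B → 0ℚ < δ → ∃[ η ] 0ℚ < η × B * η ≡ δ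
  divide B δ 0<B 0<δ = 1/ B * δ , 0<η , (begin-equality
    B * (1/ B * δ)  ≡⟨ ℚ.*-assoc B (1/ B) δ ⟨
    B * 1/ B * δ    ≡⟨ cong (_* δ) (ℚ.*-inverseʳ B) ⟩
    1ℚ * δ          ≡⟨ ℚ.*-identityˡ δ ⟩
    δ               ∎)
    where
    instance
      posB : Positive B
      posB = positive 0<B
      nzB = ℚ.pos⇒nonZero B
    0<η : 0ℚ < 1/ B * δ
    0<η = ℚ.positive⁻¹ (1/ B * δ) {{ℚ.pos*pos⇒pos (1/ B) {{ℚ.1/pos⇒pos B}} δ {{positive 0<δ}}}}

  *-close : ∀ {B C η δ} a b c d → 0ℚ ≤ η → (B + C) * η ≡ δ →
            ∣ a ∣ ≤ B → ∣ d ∣ ≤ C → ∣ a - c ∣ ≤ η → ∣ b - d ∣ ≤ η →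
            ∣ a * b - c * d ∣ ≤ δ
  *-close {B} {C} {η} {δ} a b c d 0≤η eq a≤B d≤C ac bd = begin
    ∣ a * b - c * d ∣
      ≡⟨ cong ∣_∣ (rearrange a b c d) ⟩
    ∣ a * (b - d) + d * (a - c) ∣
      ≤⟨ ℚ.∣p+q∣≤∣p∣+∣q∣ (a * (b - d)) (d * (a - c)) ⟩
    ∣ a * (b - d) ∣ + ∣ d * (a - c) ∣
      ≡⟨ cong₂ _+_ (ℚ.∣p*q∣≡∣p∣*∣q∣ a (b - d)) (ℚ.∣p*q∣≡∣p∣*∣q∣ d (a - c)) ⟩
    ∣ a ∣ * ∣ b - d ∣ + ∣ d ∣ * ∣ a - c ∣
      ≤⟨ ℚ.+-mono-≤ (*-mono-≤-nonNeg (ℚ.0≤∣p∣ a) 0≤η a≤B bd)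
                    (*-mono-≤-nonNeg (ℚ.0≤∣p∣ d) 0≤η d≤C ac) ⟩
    B * η + C * η
      ≡⟨ ℚ.*-distribʳ-+ η B C ⟨
    (B + C) * η
      ≡⟨ eq ⟩
    δ ∎
    where
    rearrange : ∀ a b c d → a * b - c * d ≡ a * (b - d) + d * (a - c)
    rearrange = solve 4 (λ a b c d → a :* b :- c :* d := a :* (b :- d) :+ d :* (a :- c)) refl
      where open +-*-Solver

  CauchyAt : (ℕ → ℚ) → ℚ → Set
  CauchyAt f δ = ∃[ N ] ∀ m n → N ℕ.≤ m → N ℕ.≤ n → ∣ f m - f n ∣ ≤ δ

  BoundedBy : (ℕ → ℚ) → ℚ → Set
  BoundedBy f B = ∃[ N ] ∀ n → N ℕ.≤ n → ∣ f n ∣ ≤ B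

  *-cauchyAt : ∀ f g {B C η δ} → 0ℚ ≤ η → (B + C) * η ≡ δ →
               BoundedBy f B → BoundedBy g C → CauchyAt f η → CauchyAt g η →
               CauchyAt (λ n → f n * g n) δ
  *-cauchyAt f g 0≤η eq (N₁ , bf) (N₂ , bg) (N₃ , cf) (N₄ , cg) =
    (N₁ ℕ.⊔ N₂) ℕ.⊔ (N₃ ℕ.⊔ N₄) , λ m n h k →
    let h₁₂ = ℕ.m⊔n≤o⇒m≤o (N₁ ℕ.⊔ N₂) (N₃ ℕ.⊔ N₄) h
        h₃₄ = ℕ.m⊔n≤o⇒n≤o (N₁ ℕ.⊔ N₂) (N₃ ℕ.⊔ N₄) h
        k₁₂ = ℕ.m⊔n≤o⇒m≤o (N₁ ℕ.⊔ N₂) (N₃ ℕ.⊔ N₄) k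
        k₃₄ = ℕ.m⊔n≤o⇒n≤o (N₁ ℕ.⊔ N₂) (N₃ ℕ.⊔ N₄) k
    in *-close (f m) (g m) (f n) (g n) 0≤η eq
         (bf m (ℕ.m⊔n≤o⇒m≤o N₁ N₂ h₁₂)) (bg n (ℕ.m⊔n≤o⇒n≤o N₁ N₂ k₁₂))
         (cf m n (ℕ.m⊔n≤o⇒m≤o N₃ N₄ h₃₄) (ℕ.m⊔n≤o⇒m≤o N₃ N₄ k₃₄))
         (cg m n (ℕ.m⊔n≤o⇒n≤o N₃ N₄ h₃₄) (ℕ.m⊔n≤o⇒n≤o N₃ N₄ k₃₄))

_*ᴿ_ : ℝ → ℝ → ℝ
x *ᴿ y = record { seq = λ n → seq x n * seq y n ; cauchy = cauchy′ (bounded x) (bounded y) }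
  where
  finish : ∀ {B C} δ → BoundedBy (seq x) B → BoundedBy (seq y) C →
           ∃[ η ] 0ℚ < η × (B + C) * η ≡ δ →
           CauchyAt (λ n → seq x n * seq y n) δ
  finish δ bx by (η , 0<η , eq) =
    *-cauchyAt (seq x) (seq y) (ℚ.<⇒≤ 0<η) eq bx by (cauchy x η 0<η) (cauchy y η 0<η)

  cauchy′ : ∃[ B ] 0ℚ < B × BoundedBy (seq x) B →
            ∃[ C ] 0ℚ < C × BoundedBy (seq y) C →
            ∀ δ → 0ℚ < δ → CauchyAt (λ n → seq x n * seq y n) δ
  cauchy′ (B , 0<B , bx) (C , 0<C , by) δ 0<δ =
    finish δ bx by (divide (B + C) δ (ℚ.+-mono-< 0<B 0<C) 0<δ)

greatest : {P : ℕ → Set} → Decidable P → ℕ → ℕ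
greatest P? zero    = 0
greatest P? (suc b) = if does (P? (suc b)) then suc b else greatest P? b

-- For n, r ≥ 1, rootNum n r s / s is the largest multiple of 1/s that is at
-- most n^{-1/r}.
rootNum : ℕ → ℕ → ℕ → ℕ
rootNum n r s = greatest (λ j → j ℕ.^ r ℕ.* n ℕ.≤? s ℕ.^ r) s

rootSeq : ℕ → ℕ → ℕ → ℚ
rootSeq n r k = + rootNum n r (suc k) / suc k

private
  greatest-≤ : {P : ℕ → Set} (P? : Decidable P) → ∀ b → greatest P? b ℕ.≤ b
  greatest-≤ P? zero = z≤n
  greatest-≤ P? (suc b) with P? (suc b)
  ... | yes _ = ℕ.≤-refl
  ... | no  _ = ℕ.m≤n⇒m≤1+n (greatest-≤ P? b)

  greatest-holds : {P : ℕ → Set} (P? : Decidable P) → ∀ b →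
                   greatest P? b ≡ 0 ⊎ P (greatest P? b)
  greatest-holds P? zero = inj₁ refl
  greatest-holds P? (suc b) with P? (suc b)
  ... | yes p = inj₂ p
  ... | no  _ = greatest-holds P? b

  greatest-max : {P : ℕ → Set} (P? : Decidable P) → ∀ b {j} →
                 j ℕ.≤ b → greatest P? b ℕ.< j → ¬ P j
  greatest-max P? zero    z≤n ()
  greatest-max P? (suc b) {j} j≤ <j with P? (suc b) | j ℕ.≟ suc b
  ... | yes _ | _        = ⊥-elim (ℕ.<⇒≱ <j j≤)
  ... | no ¬p | yes refl = ¬p
  ... | no _  | no j≢    = greatest-max P? b (ℕ.s≤s⁻¹ (ℕ.≤∧≢⇒< j≤ j≢)) <j

  frac-≤ : ∀ a b c d .{{_ : NonZero b}} .{{_ : NonZero d}} →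
           a ℕ.* d ℕ.≤ c ℕ.* b → + a / b ≤ + c / d
  frac-≤ a (suc b) c (suc d) h = ℚ.toℚᵘ-cancel-≤
    (ℚᵘ.≤-respˡ-≃ (ℚᵘ.≃-sym (ℚ.toℚᵘ-fromℚᵘ (ℚᵘ.mkℚᵘ (+ a) b)))
    (ℚᵘ.≤-respʳ-≃ (ℚᵘ.≃-sym (ℚ.toℚᵘ-fromℚᵘ (ℚᵘ.mkℚᵘ (+ c) d)))
    (ℚᵘ.*≤* (subst₂ ℤ._≤_ (ℤ.pos-* a (suc d)) (ℤ.pos-* c (suc b)) (ℤ.+≤+ h)))))

  frac-suc : ∀ a b → + suc a / suc b ≡ + a / suc b + + 1 / suc b
  frac-suc a b = ℚ.toℚᵘ-injective
    (ℚᵘ.≃-trans (ℚ.toℚᵘ-fromℚᵘ (ℚᵘ.mkℚᵘ (+ suc a) b))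
    (ℚᵘ.≃-trans (ℚᵘ.*≡* eq)
    (ℚᵘ.≃-trans (ℚᵘ.+-cong (ℚᵘ.≃-sym (ℚ.toℚᵘ-fromℚᵘ (ℚᵘ.mkℚᵘ (+ a) b)))
                           (ℚᵘ.≃-sym (ℚ.toℚᵘ-fromℚᵘ (ℚᵘ.mkℚᵘ (+ 1) b))))
                (ℚᵘ.≃-sym (ℚ.toℚᵘ-homo-+ (+ a / suc b) (+ 1 / suc b))))))
    where
    eq : (+ suc a) ℤ.* (+ suc b ℤ.* + suc b)
       ≡ (+ a ℤ.* + suc b ℤ.+ + 1 ℤ.* + suc b) ℤ.* + suc b
    eq = trans (cong (ℤ._* (+ suc b ℤ.* + suc b)) (ℤ.pos-+ 1 a))
               (solve 2 (λ x y → (con (+ 1) :+ x) :* (y :* y)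
                               := (x :* y :+ con (+ 1) :* y) :* y) refl (+ a) (+ suc b))
      where open IntSolver.+-*-Solver

  rootNum-≤ : ∀ n r s → rootNum n r s ℕ.≤ s
  rootNum-≤ n r s = greatest-≤ (λ j → j ℕ.^ r ℕ.* n ℕ.≤? s ℕ.^ r) s

  rootNum-holds : ∀ n r s → rootNum n r s ≡ 0 ⊎ rootNum n r s ℕ.^ r ℕ.* n ℕ.≤ s ℕ.^ r
  rootNum-holds n r s = greatest-holds (λ j → j ℕ.^ r ℕ.* n ℕ.≤? s ℕ.^ r) s

  rootNum-max : ∀ n r s → suc (rootNum n r s) ℕ.≤ s →
                s ℕ.^ r ℕ.< suc (rootNum n r s) ℕ.^ r ℕ.* n
  rootNum-max n r s h =
    ℕ.≰⇒> (greatest-max (λ j → j ℕ.^ r ℕ.* n ℕ.≤? s ℕ.^ r) s h ℕ.≤-refl)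

  ^-distribʳ-* : ∀ r a b → (a ℕ.* b) ℕ.^ r ≡ a ℕ.^ r ℕ.* b ℕ.^ r
  ^-distribʳ-* zero    a b = refl
  ^-distribʳ-* (suc r) a b =
    trans (cong (a ℕ.* b ℕ.*_) (^-distribʳ-* r a b))
          (ℕ.[m*n]*[o*p]≡[m*o]*[n*p] a b (a ℕ.^ r) (b ℕ.^ r))

  rootNum-step : ∀ n r k m →
    rootNum n r (suc k) ℕ.* suc m ℕ.≤ suc (rootNum n r (suc m)) ℕ.* suc k
  rootNum-step n r k m with suc (rootNum n r (suc m)) ℕ.≤? suc m
  ... | no ¬h = ℕ.≤-trans
          (ℕ.*-mono-≤ (rootNum-≤ n r (suc k)) (ℕ.<⇒≤ (ℕ.≰⇒> ¬h)))
          (ℕ.≤-reflexive (ℕ.*-comm (suc k) _))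
  ... | yes h with rootNum-holds n r (suc k)
  ...   | inj₁ a≡0 = subst (λ a → a ℕ.* suc m ℕ.≤ suc (rootNum n r (suc m)) ℕ.* suc k) (sym a≡0) z≤n
  ...   | inj₂ p   = ℕ.≮⇒≥ absurd
    where
    a = rootNum n r (suc k)
    b = suc (rootNum n r (suc m))
    s = suc k
    t = suc m
    swap : ∀ x y z → x ℕ.* y ℕ.* z ≡ x ℕ.* z ℕ.* y
    swap x y z = trans (ℕ.*-assoc x y z) (trans (cong (x ℕ.*_) (ℕ.*-comm y z)) (sym (ℕ.*-assoc x z y)))
    step₁ : b ℕ.* s ℕ.< a ℕ.* t → b ℕ.^ r ℕ.* n ℕ.* s ℕ.^ r ℕ.≤ s ℕ.^ r ℕ.* t ℕ.^ r
    step₁ lt = ℕ.≤-trans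
      (ℕ.≤-reflexive (trans (swap (b ℕ.^ r) n (s ℕ.^ r)) (cong (ℕ._* n) (sym (^-distribʳ-* r b s)))))
      (ℕ.≤-trans (ℕ.*-monoˡ-≤ n (ℕ.^-monoˡ-≤ r (ℕ.<⇒≤ lt)))
      (ℕ.≤-trans
        (ℕ.≤-reflexive (trans (cong (ℕ._* n) (^-distribʳ-* r a t)) (swap (a ℕ.^ r) (t ℕ.^ r) n)))
        (ℕ.*-monoˡ-≤ (t ℕ.^ r) p)))
    absurd : ¬ (b ℕ.* s ℕ.< a ℕ.* t)
    absurd lt = ℕ.<⇒≱ (rootNum-max n r t h)
      (ℕ.*-cancelʳ-≤ _ _ (s ℕ.^ r) {{ℕ.m^n≢0 s r}}
        (ℕ.≤-trans (step₁ lt) (ℕ.≤-reflexive (ℕ.*-comm (s ℕ.^ r) (t ℕ.^ r)))))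

  rootSeq-step : ∀ n r k m → rootSeq n r k ≤ rootSeq n r m + + 1 / suc m
  rootSeq-step n r k m = subst (rootSeq n r k ≤_) (frac-suc (rootNum n r (suc m)) m)
    (frac-≤ (rootNum n r (suc k)) (suc k) (suc (rootNum n r (suc m))) (suc m)
      (rootNum-step n r k m))

  archimedean : ∀ δ → 0ℚ < δ → ∃[ N ] ∀ n → N ℕ.≤ n → + 1 / suc n ≤ δ
  archimedean δ 0<δ = helper δ {{positive 0<δ}}
    where
    helper : ∀ δ → .{{Positive δ}} → ∃[ N ] ∀ n → N ℕ.≤ n → + 1 / suc n ≤ δ
    helper δ@(mkℚ (+ suc a) d _) = d , λ n h → ℚ.≤-trans
      (frac-≤ 1 (suc n) 1 (suc d)
        (subst₂ ℕ._≤_ (sym (ℕ.*-identityˡ _)) (sym (ℕ.*-identityˡ _)) (s≤s h)))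
      (subst (+ 1 / suc d ≤_) (ℚ.↥p/↧p≡p δ)
        (frac-≤ 1 (suc d) (suc a) (suc d) (ℕ.*-monoˡ-≤ (suc d) {1} {suc a} (s≤s z≤n))))

  ∣-∣-≤ : ∀ {a b δ} → a ≤ b + δ → b ≤ a + δ → ∣ a - b ∣ ≤ δ
  ∣-∣-≤ {a} {b} {δ} h k with ℚ.∣p∣≡p∨∣p∣≡-p (a - b)
  ... | inj₁ eq = begin
    ∣ a - b ∣    ≡⟨ eq ⟩
    a - b        ≤⟨ ℚ.+-monoˡ-≤ (- b) h ⟩
    b + δ - b    ≡⟨ solve 2 (λ b δ → b :+ δ :- b := δ) refl b δ ⟩
    δ            ∎
    where open +-*-Solver
  ... | inj₂ eq = begin
    ∣ a - b ∣    ≡⟨ eq ⟩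
    - (a - b)    ≡⟨ solve 2 (λ a b → :- (a :- b) := b :- a) refl a b ⟩
    b - a        ≤⟨ ℚ.+-monoˡ-≤ (- a) k ⟩
    a + δ - a    ≡⟨ solve 2 (λ a δ → a :+ δ :- a := δ) refl a δ ⟩
    δ            ∎
    where open +-*-Solver

infix 8 _^-1/_

_^-1/_ : ℕ → ℕ → ℝ
n ^-1/ r = record { seq = rootSeq n r ; cauchy = cauchy′ }
  where
  cauchy′ : ∀ δ → 0ℚ < δ → ∃[ N ] ∀ k m → N ℕ.≤ k → N ℕ.≤ m →
            ∣ rootSeq n r k - rootSeq n r m ∣ ≤ δ
  cauchy′ δ 0<δ with archimedean δ 0<δ
  ... | N , small = N , λ k m N≤k N≤m → ∣-∣-≤
    (ℚ.≤-trans (rootSeq-step n r k m) (ℚ.+-monoʳ-≤ (rootSeq n r m) (small m N≤m)))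
    (ℚ.≤-trans (rootSeq-step n r m k) (ℚ.+-monoʳ-≤ (rootSeq n r k) (small k N≤k)))

infixr 8 _^ᴿ_

_^ᴿ_ : ℝ → ℕ → ℝ
x ^ᴿ zero  = 1ᴿ
x ^ᴿ suc r = x *ᴿ x ^ᴿ r

fromℕ : ℕ → ℝ
fromℕ n = fromℚ (+ n / 1)

^-1/-nonNeg : ∀ n r → 0ᴿ ≤ᴿ n ^-1/ r
^-1/-nonNeg n r δ 0<δ = 0 , λ k _ → begin
  0ℚ                ≡⟨ ℚ.+-identityʳ 0ℚ ⟨
  0ℚ + 0ℚ           ≤⟨ ℚ.+-mono-≤ (frac-≤ 0 1 (rootNum n r (suc k)) (suc k) z≤n) (ℚ.<⇒≤ 0<δ) ⟩
  rootSeq n r k + δ ∎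

private
  pow : ℚ → ℕ → ℚ
  pow x zero    = 1ℚ
  pow x (suc r) = x * pow x r

  seq-^ : ∀ x r k → seq (x ^ᴿ r) k ≡ pow (seq x k) r
  seq-^ x zero    k = refl
  seq-^ x (suc r) k = cong (seq x k *_) (seq-^ x r k)

  frac-* : ∀ a b c d .{{_ : NonZero b}} .{{_ : NonZero d}} .{{_ : NonZero (b ℕ.* d)}} →
           (+ a / b) * (+ c / d) ≡ + (a ℕ.* c) / (b ℕ.* d)
  frac-* a (suc b) c (suc d) = ℚ.toℚᵘ-injective
    (ℚᵘ.≃-trans (ℚ.toℚᵘ-homo-* (+ a / suc b) (+ c / suc d))
    (ℚᵘ.≃-trans (ℚᵘ.*-cong (ℚ.toℚᵘ-fromℚᵘ (ℚᵘ.mkℚᵘ (+ a) b)) (ℚ.toℚᵘ-fromℚᵘ (ℚᵘ.mkℚᵘ (+ c) d)))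
    (ℚᵘ.≃-trans (ℚᵘ.*≡* (cong (ℤ._* + (suc b ℕ.* suc d)) (sym (ℤ.pos-* a c))))
                (ℚᵘ.≃-sym (ℚ.toℚᵘ-fromℚᵘ (ℚᵘ.mkℚᵘ (+ (a ℕ.* c)) (d ℕ.+ b ℕ.* suc d)))))))

  pow-frac : ∀ a s r .{{_ : NonZero s}} →
             pow (+ a / s) r ≡ (+ (a ℕ.^ r) / s ℕ.^ r) {{ℕ.m^n≢0 s r}}
  pow-frac a s zero    = refl
  pow-frac a s (suc r) {{s≢0}} = trans (cong (+ a / s *_) (pow-frac a s r))
    (frac-* a s (a ℕ.^ r) (s ℕ.^ r) {{s≢0}} {{ℕ.m^n≢0 s r}} {{ℕ.m^n≢0 s (suc r)}})

  0≤frac : ∀ a b .{{_ : NonZero b}} → 0ℚ ≤ + a / b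
  0≤frac a b = frac-≤ 0 1 a b z≤n

  0≤pow : ∀ {x} r → 0ℚ ≤ x → 0ℚ ≤ pow x r
  0≤pow     zero    0≤x = ℚ.<⇒≤ (ℚ.positive⁻¹ 1ℚ)
  0≤pow {x} (suc r) 0≤x = ℚ.nonNegative⁻¹ (x * pow x r)
    {{ℚ.nonNeg*nonNeg⇒nonNeg x {{nonNegative 0≤x}} (pow x r) {{nonNegative (0≤pow r 0≤x)}}}}

  pow≤1 : ∀ {x} r → 0ℚ ≤ x → x ≤ 1ℚ → pow x r ≤ 1ℚ
  pow≤1     zero    0≤x x≤1 = ℚ.≤-refl
  pow≤1 {x} (suc r) 0≤x x≤1 =
    *-mono-≤-nonNeg 0≤x (ℚ.<⇒≤ (ℚ.positive⁻¹ 1ℚ)) x≤1 (pow≤1 r 0≤x x≤1)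

  slope : ℕ → ℚ
  slope zero    = 0ℚ
  slope (suc r) = 1ℚ + (slope r + slope r)

  0≤slope : ∀ r → 0ℚ ≤ slope r
  0≤slope zero    = ℚ.≤-refl
  0≤slope (suc r) = ℚ.+-mono-≤ (ℚ.<⇒≤ (ℚ.positive⁻¹ 1ℚ)) (ℚ.+-mono-≤ (0≤slope r) (0≤slope r))

  pow-+ : ∀ {x d} r → 0ℚ ≤ x → x ≤ 1ℚ → 0ℚ ≤ d → d ≤ 1ℚ →
          pow (x + d) r ≤ pow x r + d * slope r
  pow-+ {x} {d} zero 0≤x x≤1 0≤d d≤1 =
    ℚ.≤-reflexive (sym (trans (cong (λ z → 1ℚ + z) (ℚ.*-zeroʳ d)) (ℚ.+-identityʳ 1ℚ)))
  pow-+ {x} {d} (suc r) 0≤x x≤1 0≤d d≤1 = begin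
    (x + d) * pow (x + d) r
      ≤⟨ ℚ.*-monoˡ-≤-nonNeg (x + d) {{nonNegative (ℚ.+-mono-≤ 0≤x 0≤d)}}
           (pow-+ r 0≤x x≤1 0≤d d≤1) ⟩
    (x + d) * (pow x r + d * slope r)
      ≡⟨ solve 4 (λ x d y c → (x :+ d) :* (y :+ d :* c)
                := x :* y :+ d :* (y :+ (x :* c :+ d :* c))) refl x d (pow x r) (slope r) ⟩
    x * pow x r + d * (pow x r + (x * slope r + d * slope r))
      ≤⟨ ℚ.+-monoʳ-≤ (x * pow x r) (ℚ.*-monoˡ-≤-nonNeg d {{nonNegative 0≤d}}
           (ℚ.+-mono-≤ (pow≤1 r 0≤x x≤1) (ℚ.+-mono-≤ (shrink x≤1) (shrink d≤1)))) ⟩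
    x * pow x r + d * (1ℚ + (slope r + slope r)) ∎
    where
    open +-*-Solver
    shrink : ∀ {z} → z ≤ 1ℚ → z * slope r ≤ slope r
    shrink {z} z≤1 = begin
      z * slope r  ≤⟨ ℚ.*-monoʳ-≤-nonNeg (slope r) {{nonNegative (0≤slope r)}} z≤1 ⟩
      1ℚ * slope r ≡⟨ ℚ.*-identityˡ (slope r) ⟩
      slope r      ∎

  pow-frac-* : ∀ a s r n .{{_ : NonZero s}} →
               pow (+ a / s) r * (+ n / 1)
             ≡ (+ (a ℕ.^ r ℕ.* n) / s ℕ.^ r) {{ℕ.m^n≢0 s r}}
  pow-frac-* a s r n = trans (cong (_* (+ n / 1)) (pow-frac a s r))
    (trans (frac-* (a ℕ.^ r) (s ℕ.^ r) n 1 {{s^r≢0}} {{_}} {{s^r*1≢0}})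
           (ℚ./-cong {+ (a ℕ.^ r ℕ.* n)} {s ℕ.^ r ℕ.* 1} {{s^r*1≢0}} {{s^r≢0}}
             refl (ℕ.*-identityʳ (s ℕ.^ r))))
    where
    s^r≢0 : NonZero (s ℕ.^ r)
    s^r≢0 = ℕ.m^n≢0 s r
    s^r*1≢0 : NonZero (s ℕ.^ r ℕ.* 1)
    s^r*1≢0 = ℕ.m*n≢0 (s ℕ.^ r) 1 {{s^r≢0}}

  frac≤1 : ∀ a b .{{_ : NonZero b}} → a ℕ.≤ b → + a / b ≤ 1ℚ
  frac≤1 a b h = frac-≤ a b 1 1
    (subst₂ ℕ._≤_ (sym (ℕ.*-identityʳ a)) (sym (ℕ.*-identityˡ b)) h)

  1≤frac : ∀ a b .{{_ : NonZero b}} → b ℕ.≤ a → 1ℚ ≤ + a / b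
  1≤frac a b h = frac-≤ 1 1 a b
    (subst₂ ℕ._≤_ (sym (ℕ.*-identityˡ b)) (sym (ℕ.*-identityʳ a)) h)

private
  rootNum-small : ∀ n r s .{{_ : NonZero r}} → rootNum n r s ℕ.^ r ℕ.* n ℕ.≤ s ℕ.^ r
  rootNum-small n (suc r) s with rootNum-holds n (suc r) s
  ... | inj₁ eq = subst (λ a → a ℕ.^ suc r ℕ.* n ℕ.≤ s ℕ.^ suc r) (sym eq) z≤n
  ... | inj₂ h  = h

  rootNum-large : ∀ n r s .{{_ : NonZero n}} → s ℕ.^ r ℕ.≤ suc (rootNum n r s) ℕ.^ r ℕ.* n
  rootNum-large n r s with suc (rootNum n r s) ℕ.≤? s
  ... | yes h = ℕ.<⇒≤ (rootNum-max n r s h)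
  ... | no ¬h = ℕ.≤-trans (ℕ.^-monoˡ-≤ r (ℕ.<⇒≤ (ℕ.≰⇒> ¬h))) (ℕ.m≤m*n _ n)

  rootSeq-upper : ∀ n r k .{{_ : NonZero r}} → pow (rootSeq n r k) r * (+ n / 1) ≤ 1ℚ
  rootSeq-upper n r k = ℚ.≤-trans (ℚ.≤-reflexive (pow-frac-* (rootNum n r (suc k)) (suc k) r n))
    (frac≤1 (rootNum n r (suc k) ℕ.^ r ℕ.* n) (suc k ℕ.^ r) {{ℕ.m^n≢0 (suc k) r}}
      (rootNum-small n r (suc k)))

  rearrange : ∀ y d c n → (y + d * c) * n ≡ y * n + d * (c * n)
  rearrange = solve 4 (λ y d c n → (y :+ d :* c) :* n := y :* n :+ d :* (c :* n)) refl
    where open +-*-Solver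

  pow-+-* : ∀ {x d n} r → 0ℚ ≤ x → x ≤ 1ℚ → 0ℚ ≤ d → d ≤ 1ℚ → 0ℚ ≤ n →
            pow (x + d) r * n ≤ pow x r * n + d * (slope r * n)
  pow-+-* {x} {d} {n} r 0≤x x≤1 0≤d d≤1 0≤n = ℚ.≤-trans
    (ℚ.*-monoʳ-≤-nonNeg n {{nonNegative 0≤n}} (pow-+ r 0≤x x≤1 0≤d d≤1))
    (ℚ.≤-reflexive (rearrange (pow x r) d (slope r) n))

  rootSeq-lower : ∀ n r k .{{_ : NonZero n}} →
    1ℚ ≤ pow (rootSeq n r k) r * (+ n / 1) + (+ 1 / suc k) * (slope r * (+ n / 1))
  rootSeq-lower n r k = ℚ.≤-trans
    (1≤frac (suc a ℕ.^ r ℕ.* n) (suc k ℕ.^ r) {{ℕ.m^n≢0 (suc k) r}} (rootNum-large n r (suc k)))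
    (ℚ.≤-trans (ℚ.≤-reflexive (trans (sym (pow-frac-* (suc a) (suc k) r n))
                                     (cong (λ z → pow z r * (+ n / 1)) (frac-suc a k))))
      (pow-+-* r (0≤frac a (suc k)) (frac≤1 a (suc k) (rootNum-≤ n r (suc k)))
                 (0≤frac 1 (suc k)) (frac≤1 1 (suc k) (s≤s z≤n)) (0≤frac n 1)))
    where
    a : ℕ
    a = rootNum n r (suc k)

  absorb : ∀ {d c η δ} → 0ℚ ≤ c → 0ℚ ≤ η → d ≤ η → (1ℚ + c) * η ≡ δ → d * c ≤ δ
  absorb {d} {c} {η} {δ} 0≤c 0≤η d≤η eq = begin
    d * c           ≤⟨ ℚ.*-monoʳ-≤-nonNeg c {{nonNegative 0≤c}} d≤η ⟩
    η * c           ≡⟨ trans (ℚ.*-comm η c) (sym (ℚ.+-identityˡ (c * η))) ⟩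
    0ℚ + c * η      ≤⟨ ℚ.+-monoˡ-≤ (c * η) 0≤η ⟩
    η + c * η       ≡⟨ cong (_+ c * η) (sym (ℚ.*-identityˡ η)) ⟩
    1ℚ * η + c * η  ≡⟨ ℚ.*-distribʳ-+ η 1ℚ c ⟨
    (1ℚ + c) * η    ≡⟨ eq ⟩
    δ               ∎

^-1/-spec : ∀ n r .{{_ : NonZero n}} .{{_ : NonZero r}} →
            (n ^-1/ r) ^ᴿ r *ᴿ fromℕ n ≃ᴿ 1ᴿ
^-1/-spec n r = upper , lower
  where
  upper : (n ^-1/ r) ^ᴿ r *ᴿ fromℕ n ≤ᴿ 1ᴿ
  upper δ 0<δ = 0 , λ k _ → begin
    seq ((n ^-1/ r) ^ᴿ r) k * (+ n / 1) ≡⟨ cong (_* (+ n / 1)) (seq-^ (n ^-1/ r) r k) ⟩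
    pow (rootSeq n r k) r * (+ n / 1)   ≤⟨ rootSeq-upper n r k ⟩
    1ℚ                                  ≡⟨ ℚ.+-identityʳ 1ℚ ⟨
    1ℚ + 0ℚ                             ≤⟨ ℚ.+-monoʳ-≤ 1ℚ (ℚ.<⇒≤ 0<δ) ⟩
    1ℚ + δ                              ∎

  c : ℚ
  c = slope r * (+ n / 1)

  0≤c : 0ℚ ≤ c
  0≤c = ℚ.nonNegative⁻¹ c
    {{ℚ.nonNeg*nonNeg⇒nonNeg (slope r) {{nonNegative (0≤slope r)}}
                             (+ n / 1) {{nonNegative (0≤frac n 1)}}}}

  finish : ∀ δ {η} → 0ℚ ≤ η → (1ℚ + c) * η ≡ δ → (∃[ N ] ∀ k → N ℕ.≤ k → + 1 / suc k ≤ η) →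
           ∃[ N ] ∀ k → N ℕ.≤ k → 1ℚ ≤ seq ((n ^-1/ r) ^ᴿ r *ᴿ fromℕ n) k + δ
  finish δ 0≤η eq (N , small) = N , λ k h → begin
    1ℚ
      ≤⟨ rootSeq-lower n r k ⟩
    pow (rootSeq n r k) r * (+ n / 1) + (+ 1 / suc k) * c
      ≤⟨ ℚ.+-monoʳ-≤ (pow (rootSeq n r k) r * (+ n / 1)) (absorb 0≤c 0≤η (small k h) eq) ⟩
    pow (rootSeq n r k) r * (+ n / 1) + δ
      ≡⟨ cong (λ z → z * (+ n / 1) + δ) (seq-^ (n ^-1/ r) r k) ⟨
    seq ((n ^-1/ r) ^ᴿ r) k * (+ n / 1) + δ ∎

  choose : ∀ δ → ∃[ η ] 0ℚ < η × (1ℚ + c) * η ≡ δ →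
           ∃[ N ] ∀ k → N ℕ.≤ k → 1ℚ ≤ seq ((n ^-1/ r) ^ᴿ r *ᴿ fromℕ n) k + δ
  choose δ (η , 0<η , eq) = finish δ (ℚ.<⇒≤ 0<η) eq (archimedean η 0<η)

  lower : 1ᴿ ≤ᴿ (n ^-1/ r) ^ᴿ r *ᴿ fromℕ n
  lower δ 0<δ =
    choose δ (divide (1ℚ + c) δ (ℚ.+-mono-<-≤ (ℚ.positive⁻¹ 1ℚ) 0≤c) 0<δ)

record Graph (n : ℕ) : Set₁ where
  field
    Adj        : Fin n → Fin n → Set
    adj?       : ∀ u v → Dec (Adj u v)
    adj-sym    : ∀ {u v} → Adj u v → Adj v u
    adj-irrefl : ∀ {v} → ¬ Adj v v

open Graph

DistAtMost : ∀ {n} → (Fin n → Fin n → Set) → ℕ → Fin n → Fin n → Set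
DistAtMost _~_ zero    u v = u ≡ v
DistAtMost _~_ (suc r) u v = u ≡ v ⊎ ∃[ w ] u ~ w × DistAtMost _~_ r w v

private
  distAtMost? : ∀ {n} (G : Graph n) r u v → Dec (DistAtMost (Adj G) r u v)
  distAtMost? G zero    u v = u Fin.≟ v
  distAtMost? G (suc r) u v =
    (u Fin.≟ v) ⊎-dec Fin.any? (λ w → adj? G u w ×-dec distAtMost? G r w v)

  dist-snoc : ∀ {n} (G : Graph n) r {u w v} →
              DistAtMost (Adj G) r u w → Adj G w v → DistAtMost (Adj G) (suc r) u v
  dist-snoc G zero    refl                e = inj₂ (_ , e , refl)
  dist-snoc G (suc r) (inj₁ refl)         e = inj₂ (_ , e , inj₁ refl)
  dist-snoc G (suc r) (inj₂ (x , f , d)) e = inj₂ (x , f , dist-snoc G r d e)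

  dist-sym : ∀ {n} (G : Graph n) r {u v} → DistAtMost (Adj G) r u v → DistAtMost (Adj G) r v u
  dist-sym G zero    refl                = refl
  dist-sym G (suc r) (inj₁ refl)         = inj₁ refl
  dist-sym G (suc r) (inj₂ (w , e , d)) = dist-snoc G r (dist-sym G r d) (adj-sym G e)

-- For r ≥ 1 every edge of G is an edge of power r G, so no separate clause
-- keeps the edges of G.
power : ∀ {n} → ℕ → Graph n → Graph n
power r G = record
  { Adj        = λ u v → u ≢ v × DistAtMost (Adj G) r u v
  ; adj?       = λ u v → ¬? (u Fin.≟ v) ×-dec distAtMost? G r u v
  ; adj-sym    = λ (u≢v , d) → (λ v≡u → u≢v (sym v≡u)) , dist-sym G r d
  ; adj-irrefl = λ (v≢v , _) → v≢v refl
  }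

record HamiltonCycle (n : ℕ) : Set where
  field
    3≤n      : 3 ℕ.≤ n
    vertices : Vec (Fin n) n
    distinct : Unique vertices

open HamiltonCycle

-- j is the cyclic successor of i.
Next : ∀ {n} → Fin n → Fin n → Set
Next {n} i j = suc (toℕ i) ≡ toℕ j ⊎ (suc (toℕ i) ≡ n × toℕ j ≡ 0)

private
  next? : ∀ {n} (i j : Fin n) → Dec (Next i j)
  next? {n} i j = (suc (toℕ i) ℕ.≟ toℕ j) ⊎-dec ((suc (toℕ i) ℕ.≟ n) ×-dec (toℕ j ℕ.≟ 0))

  next-irrefl : ∀ {n} → 3 ℕ.≤ n → (i : Fin n) → ¬ Next i i
  next-irrefl _ i (inj₁ eq) = ℕ.1+n≢n eq
  next-irrefl (s≤s (s≤s _)) i (inj₂ (eq , i≡0)) with trans (cong suc (sym i≡0)) eq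
  ... | ()

Consecutive : ∀ {m n} → Vec (Fin m) n → Fin m → Fin m → Set
Consecutive vs u v = ∃[ i ] ∃[ j ] Next i j × lookup vs i ≡ u × lookup vs j ≡ v

private
  consecutive? : ∀ {m n} (vs : Vec (Fin m) n) u v → Dec (Consecutive vs u v)
  consecutive? vs u v = Fin.any? λ i → Fin.any? λ j →
    next? i j ×-dec (lookup vs i Fin.≟ u) ×-dec (lookup vs j Fin.≟ v)

  consecutive-irrefl : ∀ {n} (C : HamiltonCycle n) {v} → ¬ Consecutive (vertices C) v v
  consecutive-irrefl C (i , j , i→j , refl , eq) =
    next-irrefl (3≤n C) i (subst (Next i) (lookup-injective (distinct C) j i eq) i→j)

cycle : ∀ {n} → HamiltonCycle n → Graph n
cycle C = record
  { Adj        = λ u v → Consecutive (vertices C) u v ⊎ Consecutive (vertices C) v u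
  ; adj?       = λ u v → consecutive? (vertices C) u v ⊎-dec consecutive? (vertices C) v u
  ; adj-sym    = λ { (inj₁ c) → inj₂ c ; (inj₂ c) → inj₁ c }
  ; adj-irrefl = λ { (inj₁ c) → consecutive-irrefl C c ; (inj₂ c) → consecutive-irrefl C c }
  }

-- The edge {u, v} with u < v is represented by the pair (u , v).
Edge : ℕ → Set
Edge n = Fin n × Fin n

pairs : ∀ n → List (Edge n)
pairs n = filter (λ (u , v) → u Fin.<? v) (cartesianProduct (allFin n) (allFin n))

-- The edges of a graph on Fin n, each listed once together with its colour.
ColouredGraph : ℕ → ℕ → Set
ColouredGraph n q = List (Edge n × Fin q)

HasEdge : ∀ {n q} → ColouredGraph n q → Fin n → Fin n → Fin q → Set
HasEdge G u v c = ((u , v) , c) ∈ G ⊎ ((v , u) , c) ∈ G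

_⊆ᴳ_ : ∀ {n q} → Graph n → ColouredGraph n q → Set
H ⊆ᴳ G = ∀ u v → Adj H u v → ∃[ c ] HasEdge G u v c

Rainbow : ∀ {n q} → Graph n → ColouredGraph n q → Set
Rainbow H G = ∀ u v x y → Adj H u v → Adj H x y →
              ∀ c → HasEdge G u v c → HasEdge G x y c →
              (u ≡ x × v ≡ y) ⊎ (u ≡ y × v ≡ x)

ContainsRainbowPower : ∀ {n q} → ℕ → ColouredGraph n q → Set
ContainsRainbowPower {n} r G =
  Σ (HamiltonCycle n) λ C → (power r (cycle C) ⊆ᴳ G) × Rainbow (power r (cycle C)) G

private
  hasEdge? : ∀ {n q} (G : ColouredGraph n q) u v c → Dec (HasEdge G u v c)
  hasEdge? G u v c = ((u , v) , c) ∈? G ⊎-dec ((v , u) , c) ∈? G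
    where open DecMembership (≡-dec (≡-dec Fin._≟_ Fin._≟_) Fin._≟_) using (_∈?_)

  ⊆ᴳ? : ∀ {n q} (H : Graph n) (G : ColouredGraph n q) → Dec (H ⊆ᴳ G)
  ⊆ᴳ? H G = Fin.all? λ u → Fin.all? λ v →
    adj? H u v →-dec Fin.any? (λ c → hasEdge? G u v c)

  rainbow? : ∀ {n q} (H : Graph n) (G : ColouredGraph n q) → Dec (Rainbow H G)
  rainbow? H G = Fin.all? λ u → Fin.all? λ v → Fin.all? λ x → Fin.all? λ y →
    adj? H u v →-dec (adj? H x y →-dec Fin.all? λ c →
    hasEdge? G u v c →-dec (hasEdge? G x y c →-dec
    (((u Fin.≟ x) ×-dec (v Fin.≟ y)) ⊎-dec ((u Fin.≟ y) ×-dec (v Fin.≟ x)))))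

  anyVec? : ∀ {m} k {P : Vec (Fin m) k → Set} → Decidable P → Dec (∃ P)
  anyVec? zero    P? = map′ ([] ,_) (λ { ([] , p) → p }) (P? [])
  anyVec? (suc k) P? = map′ (λ (x , xs , p) → (x ∷ xs) , p) (λ { ((x ∷ xs) , p) → x , xs , p })
    (Fin.any? λ x → anyVec? k (λ xs → P? (x ∷ xs)))

  anyHamiltonCycle? : ∀ {n} {P : HamiltonCycle n → Set} →
    (∀ {C D} → vertices C ≡ vertices D → P C → P D) → Decidable P → Dec (∃ P)
  anyHamiltonCycle? {n} {P} resp P? =
    map′ (λ (vs , h , u , p) → _ , p)
         (λ (C , p) → vertices C , 3≤n C , distinct C , resp refl p)
         (anyVec? n body?)
    where
    Body : Vec (Fin n) n → Set
    Body vs = Σ (3 ℕ.≤ n) λ h → Σ (Unique vs) λ u →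
              P (record { 3≤n = h ; vertices = vs ; distinct = u })
    body? : Decidable Body
    body? vs with 3 ℕ.≤? n | AllPairs.allPairs? (λ x y → ¬? (x Fin.≟ y)) vs
    ... | no ¬h | _     = no λ (h , _) → ¬h h
    ... | yes _ | no ¬u = no λ (_ , u , _) → ¬u u
    ... | yes h | yes u with P? (record { 3≤n = h ; vertices = vs ; distinct = u })
    ...   | yes p = yes (h , u , p)
    ...   | no ¬p = no λ (_ , _ , p) → ¬p (resp refl p)

containsRainbowPower? : ∀ {n q} r → Decidable (ContainsRainbowPower {n} {q} r)
containsRainbowPower? r G = anyHamiltonCycle? (λ { refl p → p })
  (λ C → ⊆ᴳ? (power r (cycle C)) G ×-dec rainbow? (power r (cycle C)) G)

-- A finite distribution is a list of weighted outcomes; the same outcome may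
-- occur several times, its probability being the sum of the weights.
Dist : Set → Set
Dist A = List (ℝ × A)

return : ∀ {A} → A → Dist A
return a = (1ᴿ , a) ∷ []

_>>=_ : ∀ {A B} → Dist A → (A → Dist B) → Dist B
d >>= f = concatMap (λ (w , a) → map (λ (w′ , b) → w *ᴿ w′ , b) (f a)) d

Pr : ∀ {A} {P : A → Set} → Dist A → Decidable P → ℝ
Pr []            P? = 0ᴿ
Pr ((w , a) ∷ d) P? = if does (P? a) then w +ᴿ Pr d P? else Pr d P?

bernoulli : ℝ → Dist Bool
bernoulli p = (p , true) ∷ (1ᴿ -ᴿ p , false) ∷ []

uniform : ∀ q → Dist (Fin q)
uniform q = map (λ c → fromℚ ((+ 1 / q) {{Fin.nonZeroIndex c}}) , c) (allFin q)

randomSubset : ∀ {A} → ℝ → List A → Dist (List A)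
randomSubset p []       = return []
randomSubset p (x ∷ xs) = do
  b ← bernoulli p
  S ← randomSubset p xs
  return (if b then x ∷ S else S)

binomialGraph : ∀ n → ℝ → Dist (List (Edge n))
binomialGraph n p = randomSubset p (pairs n)

randomColouring : ∀ {A} q → List A → Dist (List (A × Fin q))
randomColouring q []       = return []
randomColouring q (e ∷ es) = do
  c ← uniform q
  cs ← randomColouring q es
  return ((e , c) ∷ cs)

randomColouredGraph : ∀ n → ℝ → ∀ q → Dist (ColouredGraph n q)
randomColouredGraph n p q = do
  E ← binomialGraph n p
  randomColouring q E

-- At a fixed index of the Cauchy sequences all weights are rational, so the
-- statement is about a finite product space.  Choose m with 2 / m ≤ p and
-- expose the coloured graph in two rounds of edge probability 1 / m each,
-- every coloured edge then having weight ρ = 1 / (m q) in a round.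
--
-- First round: plant a random coloured copy A in the outcome W.  If x is the
-- normalised mass of the copies in Z whose intersection with every copy in Z
-- has at least t edges, then x² is at most the mass of the pairs of copies in
-- Z with at least t common edges, so E x is small once the average of ρ^-|A∩B|
-- over the pairs with |A∩B| ≥ t is.  Hence typically some copy B in W ∪ A has
-- a fragment A ∩ B of fewer than t edges outside W.
--
-- Second round: the second moment method for the fragments, which needs that
-- the average over B of ρ^-|F∩B|, restricted to F ∩ B nonempty, is small for
-- every F of fewer than t edges.
--
-- Both averages are bounded by exploring the fixed copy position by position.
-- The colours contribute a constant times 1 / q per common edge, whence a
-- factor O(m); each common edge of a spanning forest contributes O(1 / n).
-- Keep one edge to an earlier vertex at every position that has one, and two
-- (if there are two) when none of the preceding r positions has one.  Since
-- n ≥ K m^r, a position then costs a small constant, and O(m / n) when it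
-- starts a new run, so all choices together have mass exp(O(m)) or, among
-- t = O(m) positions, 1 + o(1).
--
-- Finally, if y of the q colours of an edge would help, two rounds miss them
-- with probability (1 - y / (m q))² ≥ 1 - p y / q: two independent rounds are
-- no better than the given model.

module Submission where

open import Defs
open import Data.Bool.Base using (Bool; true; false; if_then_else_)
open import Data.Empty using (⊥-elim)
open import Data.Fin.Base using (Fin; zero; suc; punchIn; punchOut; toℕ; fromℕ<; combine)
import Data.Fin.Properties as Fin
import Data.Integer.Base as ℤ
import Data.Integer.Properties as ℤ
import Data.Integer.Solver as IntSolver
open import Data.List.Base
  using (List; []; _∷_; map; _++_; concatMap; length; replicate; allFin; tabulate; filter;
         cartesianProduct)
import Data.List.Membership.DecPropositional as DecMembership
open import Data.List.Membership.Propositional using (_∈_; _∉_; find; lose)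
open import Data.List.Membership.Propositional.Properties
  using (∈-allFin; ∈-map⁺; ∈-map⁻; ∈-++⁺ˡ; ∈-++⁺ʳ; ∈-++⁻; ∈-concatMap⁻; ∈-tabulate⁻; ∈-filter⁺;
         ∈-filter⁻; ∈-cartesianProduct⁺)
open import Data.List.Properties
  using (length-tabulate; length-++; length-map; map-++; length-filter; map-tabulate;
         length-replicate)
open import Data.List.Relation.Unary.All as ListAll using ([]; _∷_)
import Data.List.Relation.Unary.All.Properties as ListAll
open import Data.List.Relation.Unary.AllPairs using ([]; _∷_)
open import Data.List.Relation.Unary.Any using (Any; here; there; any?)
import Data.List.Relation.Unary.Unique.Propositional as List
import Data.List.Relation.Unary.Unique.Propositional.Properties as ListUnique
open import Data.Maybe.Base using (Maybe; just; nothing)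
open import Data.Maybe.Properties using (just-injective)
open import Data.Nat.Base
open import Data.Nat.DivMod
open import Data.Nat.Properties
open import Data.Nat.Tactic.RingSolver using (solve-∀)
open import Data.Product.Base using (Σ; ∃-syntax; _×_; _,_; proj₁; proj₂)
open import Data.Product.Properties using (≡-dec)
open import Data.Rational.Base using (ℚ; mkℚ; 0ℚ; 1ℚ)
  renaming (_+_ to _⊕_; _*_ to _⊗_; _-_ to _⊖_; -_ to ⊝_; _/_ to _//_; _≤_ to _≼_; _<_ to _≺_)
import Data.Rational.Base as ℚ
import Data.Rational.Properties as ℚ
open import Data.Rational.Solver using (module +-*-Solver)
import Data.Rational.Unnormalised.Base as ℚᵘ
import Data.Rational.Unnormalised.Properties as ℚᵘ
open import Data.Sum.Base using (_⊎_; inj₁; inj₂)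
open import Data.Unit.Base using (⊤; tt)
open import Data.Vec.Base as Vec using (Vec; []; _∷_; lookup; zipWith; _[_]≔_)
import Data.Vec.Relation.Unary.All as All
import Data.Vec.Relation.Unary.All.Properties as All
open import Data.Vec.Relation.Unary.AllPairs using ([]; _∷_)
open import Data.Vec.Relation.Unary.Unique.Propositional using (Unique)
import Data.Vec.Relation.Unary.Unique.Propositional.Properties as Unique
open import Relation.Binary.Definitions using (tri<; tri≈; tri>)
open import Relation.Binary.PropositionalEquality
open import Relation.Nullary using (¬_; Dec; yes; no; does)
open import Relation.Nullary.Decidable using (_×-dec_; _⊎-dec_; ¬?; map′)
open import Relation.Unary using (Decidable)

-- The second moment method is not applied to whole copies, because the bound for the average of
-- ρ^-|A∩B| over all pairs is only exp(O(m)): each of the n positions may start a run at price O(m /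
-- n). For intersections of at least t edges this loss is repaired by a spare factor 2 per common
-- edge in the inverse weight, which gains 2^t and changes only constants. A fragment of fewer than
-- t edges touches fewer than t positions, so that the average exceeds 1 by O(m t / n) = O(m² / n)
-- only, which is small because r ≥ 2. Such a fragment also leaves r consecutive positions free, and
-- the cycle is cut there; edges across the cut would cost a factor polynomial in m, harmless
-- against 2^t but fatal for 1 + o(1). The second forest edge at the start of a run is forced by the
-- colours: up to r edges chosen at one position bring a factor up to m^r, which a single forest
-- edge reduces to a constant, far above the O(m / n) that a new run may cost.

open ℝ
open Graph

-- Finite sums

opaque
  ∑ : {A : Set} → List A → (A → ℕ) → ℕ
  ∑ []       f = 0
  ∑ (x ∷ xs) f = f x + ∑ xs f

syntax ∑ xs (λ x → e) = ∑[ x ∈ xs ] e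

infix 5 ∑

module _ {A : Set} where
  opaque
    unfolding ∑

    ∑-[] : ∀ (f : A → ℕ) → ∑ [] f ≡ 0
    ∑-[] f = refl

    ∑-∷ : ∀ x (xs : List A) f → ∑ (x ∷ xs) f ≡ f x + ∑ xs f
    ∑-∷ x xs f = refl

    ∑-cong : ∀ (xs : List A) {f g : A → ℕ} → (∀ x → f x ≡ g x) → ∑ xs f ≡ ∑ xs g
    ∑-cong []       h = refl
    ∑-cong (x ∷ xs) h = cong₂ _+_ (h x) (∑-cong xs h)

    ∑-mono-∈ : ∀ (xs : List A) {f g : A → ℕ} → (∀ x → x ∈ xs → f x ≤ g x) → ∑ xs f ≤ ∑ xs g
    ∑-mono-∈ []       h = z≤n
    ∑-mono-∈ (x ∷ xs) h = +-mono-≤ (h x (here refl)) (∑-mono-∈ xs λ y y∈ → h y (there y∈))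

    ∑-mono : ∀ (xs : List A) {f g : A → ℕ} → (∀ x → f x ≤ g x) → ∑ xs f ≤ ∑ xs g
    ∑-mono xs h = ∑-mono-∈ xs λ x _ → h x

    ∑-+ : ∀ (xs : List A) (f g : A → ℕ) → ∑ xs (λ x → f x + g x) ≡ ∑ xs f + ∑ xs g
    ∑-+ []       f g = refl
    ∑-+ (x ∷ xs) f g = trans (cong (f x + g x +_) (∑-+ xs f g)) (lemma (f x) (g x) (∑ xs f) (∑ xs g))
      where
      lemma : ∀ a b c d → a + b + (c + d) ≡ a + c + (b + d)
      lemma = solve-∀

    ∑-*ˡ : ∀ (xs : List A) c (f : A → ℕ) → ∑ xs (λ x → c * f x) ≡ c * ∑ xs f
    ∑-*ˡ []       c f = sym (*-zeroʳ c)
    ∑-*ˡ (x ∷ xs) c f = trans (cong (c * f x +_) (∑-*ˡ xs c f)) (sym (*-distribˡ-+ c (f x) (∑ xs f)))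

    ∑-*ʳ : ∀ (xs : List A) c (f : A → ℕ) → ∑ xs (λ x → f x * c) ≡ ∑ xs f * c
    ∑-*ʳ xs c f = trans (∑-cong xs λ x → *-comm (f x) c) (trans (∑-*ˡ xs c f) (*-comm c (∑ xs f)))

    ∑-const : ∀ (xs : List A) c → ∑ xs (λ _ → c) ≡ length xs * c
    ∑-const []       c = refl
    ∑-const (x ∷ xs) c = cong (c +_) (∑-const xs c)

    ∑-0 : ∀ (xs : List A) → ∑ xs (λ _ → 0) ≡ 0
    ∑-0 xs = trans (∑-const xs 0) (*-zeroʳ (length xs))

    ∑-≤-const : ∀ (xs : List A) {f : A → ℕ} {c} → (∀ x → f x ≤ c) → ∑ xs f ≤ length xs * c
    ∑-≤-const xs {c = c} h = ≤-trans (∑-mono xs h) (≤-reflexive (∑-const xs c))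

    ∑-++ : ∀ (xs ys : List A) f → ∑ (xs ++ ys) f ≡ ∑ xs f + ∑ ys f
    ∑-++ []       ys f = refl
    ∑-++ (x ∷ xs) ys f = trans (cong (f x +_) (∑-++ xs ys f)) (sym (+-assoc (f x) _ _))

    ≤-∑ : ∀ {xs : List A} {x} (f : A → ℕ) → x ∈ xs → f x ≤ ∑ xs f
    ≤-∑ {y ∷ xs} f (here refl) = m≤m+n (f y) _
    ≤-∑ {y ∷ xs} f (there x∈)  = ≤-trans (≤-∑ f x∈) (m≤n+m _ (f y))

    ∑≡0 : ∀ (xs : List A) {f : A → ℕ} → (∀ x → x ∈ xs → f x ≡ 0) → ∑ xs f ≡ 0
    ∑≡0 xs {f} h = n≤0⇒n≡0 (≤-trans (∑-mono-∈ xs λ x x∈ → ≤-reflexive (h x x∈)) (≤-reflexive (∑-0 xs)))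

module _ {A B : Set} where
  opaque
    unfolding ∑

    ∑-map : ∀ (h : A → B) xs f → ∑ (map h xs) f ≡ ∑ xs (λ x → f (h x))
    ∑-map h []       f = refl
    ∑-map h (x ∷ xs) f = cong (f (h x) +_) (∑-map h xs f)

    ∑-concatMap : ∀ (h : A → List B) xs f → ∑ (concatMap h xs) f ≡ ∑ xs (λ x → ∑ (h x) f)
    ∑-concatMap h []       f = refl
    ∑-concatMap h (x ∷ xs) f =
      trans (∑-++ (h x) (concatMap h xs) f) (cong (∑ (h x) f +_) (∑-concatMap h xs f))

    ∑-swap : ∀ (xs : List A) (ys : List B) (f : A → B → ℕ) →
             ∑[ x ∈ xs ] ∑[ y ∈ ys ] f x y ≡ ∑[ y ∈ ys ] ∑[ x ∈ xs ] f x y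
    ∑-swap []       ys f = sym (∑-0 ys)
    ∑-swap (x ∷ xs) ys f =
      trans (cong (∑ ys (f x) +_) (∑-swap xs ys f)) (sym (∑-+ ys (f x) λ y → ∑ xs λ x → f x y))

    ∑-*-∑ : ∀ (xs : List A) (ys : List B) f g →
            ∑ xs f * ∑ ys g ≡ ∑[ x ∈ xs ] ∑[ y ∈ ys ] (f x * g y)
    ∑-*-∑ xs ys f g = trans (sym (∑-*ʳ xs (∑ ys g) f)) (∑-cong xs λ x → sym (∑-*ˡ ys (f x) g))

𝟙 : {P : Set} → Dec P → ℕ
𝟙 P? = if does P? then 1 else 0

𝟙-yes : ∀ {P : Set} (P? : Dec P) → P → 𝟙 P? ≡ 1
𝟙-yes (yes _) p = refl
𝟙-yes (no ¬p) p = ⊥-elim (¬p p)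

𝟙-no : ∀ {P : Set} (P? : Dec P) → ¬ P → 𝟙 P? ≡ 0
𝟙-no (yes p) ¬p = ⊥-elim (¬p p)
𝟙-no (no _)  ¬p = refl

𝟙≤1 : ∀ {P : Set} (P? : Dec P) → 𝟙 P? ≤ 1
𝟙≤1 (yes _) = s≤s z≤n
𝟙≤1 (no _)  = z≤n

𝟙-mono : ∀ {P Q : Set} (P? : Dec P) (Q? : Dec Q) → (P → Q) → 𝟙 P? ≤ 𝟙 Q?
𝟙-mono (no _)  Q? f = z≤n
𝟙-mono (yes p) Q? f = ≤-reflexive (sym (𝟙-yes Q? (f p)))

𝟙-cong : ∀ {P Q : Set} (P? : Dec P) (Q? : Dec Q) → (P → Q) → (Q → P) → 𝟙 P? ≡ 𝟙 Q?
𝟙-cong P? Q? f g = ≤-antisym (𝟙-mono P? Q? f) (𝟙-mono Q? P? g)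

𝟙-× : ∀ {P Q : Set} (P? : Dec P) (Q? : Dec Q) → 𝟙 (P? ×-dec Q?) ≡ 𝟙 P? * 𝟙 Q?
𝟙-× (yes _) (yes _) = refl
𝟙-× (yes _) (no _)  = refl
𝟙-× (no _)  Q?      = refl

𝟙-*-≤ : ∀ {P : Set} (P? : Dec P) {m n} → (P → m ≤ n) → 𝟙 P? * m ≤ 𝟙 P? * n
𝟙-*-≤ (yes p) h = *-monoʳ-≤ 1 (h p)
𝟙-*-≤ (no _)  h = z≤n

𝟙*≤ : ∀ {P : Set} (P? : Dec P) {m n} → (P → m ≤ n) → 𝟙 P? * m ≤ n
𝟙*≤ (yes p) {m} h = ≤-trans (≤-reflexive (+-identityʳ m)) (h p)
𝟙*≤ (no _)  h = z≤n

𝟙-¬ : ∀ {P : Set} (P? : Dec P) → 𝟙 P? + 𝟙 (¬? P?) ≡ 1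
𝟙-¬ (yes _) = refl
𝟙-¬ (no _)  = refl

-- Sums over intervals of positions

sumFrom : ℕ → ℕ → (ℕ → ℕ) → ℕ
sumFrom zero    i g = 0
sumFrom (suc m) i g = g i + sumFrom m (suc i) g

sumFrom-+ : ∀ m k i g → sumFrom (m + k) i g ≡ sumFrom m i g + sumFrom k (m + i) g
sumFrom-+ zero    k i g = refl
sumFrom-+ (suc m) k i g = trans (cong (g i +_) (trans (sumFrom-+ m k (suc i) g)
  (cong (λ z → sumFrom m (suc i) g + sumFrom k z g) (+-suc m i)))) (sym (+-assoc (g i) _ _))

sumFrom-mono : ∀ m i {f g} → (∀ j → i ≤ j → j < i + m → f j ≤ g j) → sumFrom m i f ≤ sumFrom m i g
sumFrom-mono zero    i h = z≤n
sumFrom-mono (suc m) i h = +-mono-≤ (h i ≤-refl (m<m+n i (s≤s z≤n)))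
  (sumFrom-mono m (suc i) λ j i<j j< → h j (<⇒≤ i<j) (≤-trans j< (≤-reflexive (sym (+-suc i m)))))

sumFrom-const : ∀ m i c → sumFrom m i (λ _ → c) ≡ m * c
sumFrom-const zero    i c = refl
sumFrom-const (suc m) i c = cong (c +_) (sumFrom-const m (suc i) c)

term≤sumFrom : ∀ m i g l → l < m → g (i + l) ≤ sumFrom m i g
term≤sumFrom (suc m) i g zero    _         = ≤-trans (≤-reflexive (cong g (+-identityʳ i))) (m≤m+n (g i) _)
term≤sumFrom (suc m) i g (suc l) (s≤s l<m) =
  ≤-trans (≤-trans (≤-reflexive (cong g (+-suc i l))) (term≤sumFrom m (suc i) g l l<m)) (m≤n+m _ (g i))

-- Pigeonhole: `t` consecutive blocks of length `r`, each with a positive term, would have sum at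
-- least `t`. This later supplies the place where the cycle is cut open.
zero-block : ∀ r t i g → sumFrom (t * r) i g < t →
             ∃[ j ] j + r ≤ t * r + i × (∀ l → l < r → g (j + l) ≡ 0)
zero-block r (suc t) i g h with sumFrom r i g ≟ 0
... | yes eq = i , ≤-trans (≤-reflexive (+-comm i r)) (+-monoˡ-≤ i (m≤m+n r (t * r)))
             , λ l l<r → n≤0⇒n≡0 (≤-trans (term≤sumFrom r i g l l<r) (≤-reflexive eq))
... | no ≢0 with zero-block r t (r + i) g (s≤s⁻¹ (≤-trans (s≤s (+-monoˡ-≤ _ (n≢0⇒n>0 ≢0)))
                   (≤-trans (s≤s (≤-reflexive (sym (sumFrom-+ r (t * r) i g)))) h)))
...   | j , le , zeros = j , ≤-trans le (≤-reflexive (reorder (t * r) r i)) , zeros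
  where
  reorder : ∀ a b c → a + (b + c) ≡ b + a + c
  reorder = solve-∀

-- Partial colourings and the two rounds

-- A partial colouring of a list of e edges; as an outcome of the random
-- choices, "nothing" means that the edge is absent.
Config : ℕ → ℕ → Set
Config q e = Vec (Maybe (Fin q)) e

module _ {q : ℕ} where

  infix 4 _⊑_ _⊆ᶜ_

  -- The two sides read `nothing` differently: on the left it is an edge of which nothing is asked,
  -- on the right an edge that received no colour.
  _⊑_ : Maybe (Fin q) → Maybe (Fin q) → Set
  nothing ⊑ w = ⊤
  just c  ⊑ w = w ≡ just c

  _⊑?_ : ∀ a w → Dec (a ⊑ w)
  nothing ⊑? w       = yes tt
  just c  ⊑? nothing = no λ ()
  just c  ⊑? just d  = map′ (cong just) (λ { refl → refl }) (d Fin.≟ c)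

  _⊆ᶜ_ : ∀ {e} → Config q e → Config q e → Set
  []      ⊆ᶜ []      = ⊤
  (a ∷ A) ⊆ᶜ (w ∷ W) = a ⊑ w × A ⊆ᶜ W

  _⊆ᶜ?_ : ∀ {e} (A W : Config q e) → Dec (A ⊆ᶜ W)
  []      ⊆ᶜ? []      = yes tt
  (a ∷ A) ⊆ᶜ? (w ∷ W) = a ⊑? w ×-dec A ⊆ᶜ? W

  size₁ : Maybe (Fin q) → ℕ
  size₁ nothing  = 0
  size₁ (just _) = 1

  size : ∀ {e} → Config q e → ℕ
  size []      = 0
  size (a ∷ A) = size₁ a + size A

  -- A common edge must also have the same colour in both. An edge coloured differently is kept by
  -- `diff₁`, so that `size-diff` is an equality.
  meet₁ diff₁ : Maybe (Fin q) → Maybe (Fin q) → Maybe (Fin q)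
  meet₁ (just a) (just b) = if does (a Fin.≟ b) then just a else nothing
  meet₁ _        _        = nothing
  diff₁ (just b) (just a) = if does (b Fin.≟ a) then nothing else just b
  diff₁ b        nothing  = b
  diff₁ nothing  (just _) = nothing

  over₁ : Maybe (Fin q) → Maybe (Fin q) → Maybe (Fin q)
  over₁ w (just c) = just c
  over₁ w nothing  = w

  infixl 7 _⊓ᶜ_ _∖ᶜ_ _◁_

  _⊓ᶜ_ _∖ᶜ_ : ∀ {e} → Config q e → Config q e → Config q e
  _⊓ᶜ_ = zipWith meet₁
  _∖ᶜ_ = zipWith diff₁

  _◁_ : ∀ {e} → Config q e → Config q e → Config q e
  _◁_ = zipWith over₁

  -- Each edge may be served by either round, so an edge can carry two colours here. `merge` later
  -- shows that this is no better than a single colour at a larger edge probability.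
  Covered : ∀ {e} → Config q e → Config q e → Config q e → Set
  Covered []      []      []        = ⊤
  Covered (a ∷ A) (w ∷ W) (w′ ∷ W′) = (a ⊑ w ⊎ a ⊑ w′) × Covered A W W′

  ⊆ᶜ-refl : ∀ {e} (A : Config q e) → A ⊆ᶜ A
  ⊆ᶜ-refl []            = tt
  ⊆ᶜ-refl (nothing ∷ A) = tt , ⊆ᶜ-refl A
  ⊆ᶜ-refl (just _ ∷ A)  = refl , ⊆ᶜ-refl A

  ⊓-⊆ : ∀ {e} (A B : Config q e) → A ⊓ᶜ B ⊆ᶜ A
  ⊓-⊆ []             []             = tt
  ⊓-⊆ (nothing ∷ A) (b ∷ B)       = tt , ⊓-⊆ A B
  ⊓-⊆ (just a ∷ A)  (nothing ∷ B) = tt , ⊓-⊆ A B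
  ⊓-⊆ (just a ∷ A)  (just b ∷ B) with a Fin.≟ b
  ... | yes _ = refl , ⊓-⊆ A B
  ... | no _  = tt , ⊓-⊆ A B

  size-diff : ∀ {e} (A B : Config q e) → size B ≡ size (B ∖ᶜ A) + size (A ⊓ᶜ B)
  size-diff [] [] = refl
  size-diff (nothing ∷ A) (nothing ∷ B) = size-diff A B
  size-diff (nothing ∷ A) (just _ ∷ B)  = cong suc (size-diff A B)
  size-diff (just _ ∷ A)  (nothing ∷ B) = size-diff A B
  size-diff (just a ∷ A)  (just b ∷ B) with b Fin.≟ a | a Fin.≟ b
  ... | yes refl | yes _  = trans (cong suc (size-diff A B)) (sym (+-suc _ _))
  ... | yes refl | no a≢a = ⊥-elim (a≢a refl)
  ... | no a≢a | yes refl = ⊥-elim (a≢a refl)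
  ... | no _   | no _     = cong suc (size-diff A B)

  -- Only the edges outside `A` have to come from `W`; an edge coloured differently in `A` and `B`
  -- contradicts the hypothesis, because `A` overrides `W`.
  diff-⊆ : ∀ {e} (A B W : Config q e) → B ⊆ᶜ W ◁ A → B ∖ᶜ A ⊆ᶜ W
  diff-⊆ [] [] [] _ = tt
  diff-⊆ (nothing ∷ A) (nothing ∷ B) (w ∷ W) (h , hs) = tt , diff-⊆ A B W hs
  diff-⊆ (nothing ∷ A) (just b ∷ B)  (w ∷ W) (h , hs) = h , diff-⊆ A B W hs
  diff-⊆ (just a ∷ A)  (nothing ∷ B) (w ∷ W) (h , hs) = tt , diff-⊆ A B W hs
  diff-⊆ (just a ∷ A)  (just b ∷ B)  (w ∷ W) (refl , hs) with b Fin.≟ b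
  ... | yes _ = tt , diff-⊆ A B W hs
  ... | no b≢b = ⊥-elim (b≢b refl)

  -- What planting contributes to `B` is its intersection with `A`, so it is enough that the second
  -- round provides this fragment.
  covered-◁ : ∀ {e} (A B W W′ : Config q e) → B ⊆ᶜ W ◁ A → A ⊓ᶜ B ⊆ᶜ W′ → Covered B W W′
  covered-◁ [] [] [] [] _ _ = tt
  covered-◁ (a ∷ A) (nothing ∷ B) (w ∷ W) (w′ ∷ W′) (h , hs) (k , ks) =
    inj₁ tt , covered-◁ A B W W′ hs ks
  covered-◁ (nothing ∷ A) (just b ∷ B) (w ∷ W) (w′ ∷ W′) (h , hs) (k , ks) =
    inj₁ h , covered-◁ A B W W′ hs ks
  covered-◁ (just a ∷ A) (just b ∷ B) (w ∷ W) (w′ ∷ W′) (refl , hs) (k , ks) with b Fin.≟ b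
  ... | yes _  = inj₂ k , covered-◁ A B W W′ hs ks
  ... | no b≢b = ⊥-elim (b≢b refl)

  ⊓-mono-size : ∀ {e} (F A B : Config q e) → A ⊆ᶜ B → size (F ⊓ᶜ A) ≤ size (F ⊓ᶜ B)
  ⊓-mono-size [] [] [] _ = z≤n
  ⊓-mono-size (nothing ∷ F) (a ∷ A) (b ∷ B) (h , hs) = ⊓-mono-size F A B hs
  ⊓-mono-size (just f ∷ F) (nothing ∷ A) (b ∷ B) (h , hs) =
    ≤-trans (⊓-mono-size F A B hs) (m≤n+m _ _)
  ⊓-mono-size (just f ∷ F) (just a ∷ A) (.(just a) ∷ B) (refl , hs) =
    +-monoʳ-≤ _ (⊓-mono-size F A B hs)

  covered? : ∀ {e} (A W W′ : Config q e) → Dec (Covered A W W′)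
  covered? []      []      []        = yes tt
  covered? (a ∷ A) (w ∷ W) (w′ ∷ W′) = (a ⊑? w ⊎-dec a ⊑? w′) ×-dec covered? A W W′

  Hit : ∀ {e} → List (Config q e) → Config q e → Config q e → Set
  Hit 𝓘 W W′ = Any (λ A → Covered A W W′) 𝓘

  hit? : ∀ {e} (𝓘 : List (Config q e)) W W′ → Dec (Hit 𝓘 W W′)
  hit? 𝓘 W W′ = any? (λ A → covered? A W W′) 𝓘

xy≤xx+yy : ∀ x y → x * y ≤ x * x + y * y
xy≤xx+yy x y with ≤-total x y
... | inj₁ x≤y = ≤-trans (*-monoˡ-≤ y x≤y) (m≤n+m (y * y) (x * x))
... | inj₂ y≤x = ≤-trans (*-monoʳ-≤ x y≤x) (m≤m+n (x * x) (y * y))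

2xy≤xx+yy : ∀ x y → 2 * (x * y) ≤ x * x + y * y
2xy≤xx+yy x y with ≤-total x y
... | inj₁ x≤y with m≤n⇒∃[o]m+o≡n x≤y
...   | d , refl = ≤-trans (m≤m+n _ (d * d)) (≤-reflexive (lemma x d))
  where
  lemma : ∀ x d → 2 * (x * (x + d)) + d * d ≡ x * x + (x + d) * (x + d)
  lemma = solve-∀
2xy≤xx+yy x y | inj₂ y≤x with m≤n⇒∃[o]m+o≡n y≤x
...   | d , refl = ≤-trans (m≤m+n _ (d * d)) (≤-reflexive (lemma y d))
  where
  lemma : ∀ y d → 2 * ((y + d) * y) + d * d ≡ (y + d) * (y + d) + y * y
  lemma = solve-∀

-- The outcomes of one round: every edge draws a token from a list of N
-- tokens, in which every colour occurs exactly once.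
module Rounds {q : ℕ} (toks : List (Maybe (Fin q)))
              (toks-1 : ∀ c → ∑[ w ∈ toks ] 𝟙 (just c ⊑? w) ≡ 1)
              {{_ : NonZero (length toks)}} where

  N : ℕ
  N = length toks

  Ω : ∀ e → List (Config q e)
  Ω zero    = [] ∷ []
  Ω (suc e) = concatMap (λ w → map (w ∷_) (Ω e)) toks

  ∑-Ω : ∀ e f → ∑ (Ω (suc e)) f ≡ ∑[ w ∈ toks ] ∑[ W ∈ Ω e ] f (w ∷ W)
  ∑-Ω e f = trans (∑-concatMap (λ w → map (w ∷_) (Ω e)) toks f)
                  (∑-cong toks λ w → ∑-map (w ∷_) (Ω e) f)

  length-Ω : ∀ e → ∑ (Ω e) (λ _ → 1) ≡ N ^ e
  length-Ω zero    = trans (∑-∷ [] [] _) (cong suc (∑-[] _))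
  length-Ω (suc e) = trans (∑-Ω e _) (trans (∑-cong toks λ _ → length-Ω e) (∑-const toks (N ^ e)))

  ∑-toks : ∀ c (g : Maybe (Fin q) → ℕ) → ∑[ w ∈ toks ] (𝟙 (just c ⊑? w) * g w) ≡ g (just c)
  ∑-toks c g = trans (∑-cong toks λ w → lemma w (just c ⊑? w))
    (trans (∑-*ʳ toks (g (just c)) _) (trans (cong (_* g (just c)) (toks-1 c)) (+-identityʳ _)))
    where
    lemma : ∀ w (d : Dec (w ≡ just c)) → 𝟙 d * g w ≡ 𝟙 d * g (just c)
    lemma w (yes refl) = refl
    lemma w (no _)     = refl

  private
    Z-sum : ∀ {e} → Config q e → (Config q e → ℕ) → ℕ
    Z-sum A g = ∑[ Z ∈ Ω _ ] (𝟙 (A ⊆ᶜ? Z) * g Z)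

  -- Planting is a change of measure: a `Z` containing `A` equals `W ◁ A` for exactly `N ^ size A`
  -- outcomes `W`, since the overwritten tokens are arbitrary.
  ∑-over : ∀ {e} (A : Config q e) (g : Config q e → ℕ) →
           ∑[ W ∈ Ω e ] g (W ◁ A) ≡ N ^ size A * Z-sum A g
  ∑-over [] g = sym (trans (*-identityˡ _) (∑-cong (Ω 0) λ { [] → *-identityˡ (g []) }))
  ∑-over {suc e} (a ∷ A) g = begin
    ∑[ W ∈ Ω (suc e) ] g (W ◁ (a ∷ A))
      ≡⟨ ∑-Ω e _ ⟩
    ∑[ w ∈ toks ] ∑[ W ∈ Ω e ] g (over₁ w a ∷ (W ◁ A))
      ≡⟨ ∑-cong toks (λ w → ∑-over A (λ Z → g (over₁ w a ∷ Z))) ⟩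
    ∑[ w ∈ toks ] (N ^ size A * Z-sum A (λ Z → g (over₁ w a ∷ Z)))
      ≡⟨ ∑-*ˡ toks (N ^ size A) _ ⟩
    N ^ size A * (∑[ w ∈ toks ] Z-sum A (λ Z → g (over₁ w a ∷ Z)))
      ≡⟨ cong (N ^ size A *_) (head a) ⟩
    N ^ size A * (N ^ size₁ a * (∑[ w ∈ toks ] (𝟙 (a ⊑? w) * Z-sum A (λ Z → g (w ∷ Z)))))
      ≡⟨ *-assoc (N ^ size A) (N ^ size₁ a) _ ⟨
    N ^ size A * N ^ size₁ a * (∑[ w ∈ toks ] (𝟙 (a ⊑? w) * Z-sum A (λ Z → g (w ∷ Z))))
      ≡⟨ cong₂ _*_ (trans (*-comm (N ^ size A) _) (sym (^-distribˡ-+-* N (size₁ a) (size A))))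
           (∑-cong toks λ w → merge w) ⟩
    N ^ (size₁ a + size A) * (∑[ w ∈ toks ] ∑[ Z ∈ Ω e ] (𝟙 ((a ∷ A) ⊆ᶜ? (w ∷ Z)) * g (w ∷ Z)))
      ≡⟨ cong (N ^ (size₁ a + size A) *_) (∑-Ω e _) ⟨
    N ^ size (a ∷ A) * Z-sum (a ∷ A) g ∎
    where
    open ≡-Reasoning
    head : ∀ a → ∑[ w ∈ toks ] Z-sum A (λ Z → g (over₁ w a ∷ Z))
               ≡ N ^ size₁ a * (∑[ w ∈ toks ] (𝟙 (a ⊑? w) * Z-sum A (λ Z → g (w ∷ Z))))
    head nothing = sym (trans (*-identityˡ _) (∑-cong toks λ w → *-identityˡ _))
    head (just c) = trans (∑-const toks _)
      (cong₂ _*_ (sym (*-identityʳ N)) (sym (∑-toks c λ w → Z-sum A (λ Z → g (w ∷ Z)))))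
    merge : ∀ w → 𝟙 (a ⊑? w) * Z-sum A (λ Z → g (w ∷ Z))
                ≡ ∑[ Z ∈ Ω e ] (𝟙 ((a ∷ A) ⊆ᶜ? (w ∷ Z)) * g (w ∷ Z))
    merge w = trans (sym (∑-*ˡ (Ω e) (𝟙 (a ⊑? w)) _)) (∑-cong (Ω e) λ Z →
      trans (sym (*-assoc (𝟙 (a ⊑? w)) _ _)) (cong (_* g (w ∷ Z)) (sym (𝟙-× (a ⊑? w) (A ⊆ᶜ? Z)))))

  ∑-⊆ : ∀ {e} (A : Config q e) → ∑[ W ∈ Ω e ] 𝟙 (A ⊆ᶜ? W) * N ^ size A ≡ N ^ e
  ∑-⊆ {e} A = trans (∑-*ʳ (Ω e) (N ^ size A) _) (trans (*-comm _ (N ^ size A))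
    (trans (cong (N ^ size A *_) (∑-cong (Ω e) λ Z → sym (*-identityʳ (𝟙 (A ⊆ᶜ? Z)))))
    (trans (sym (∑-over A λ _ → 1)) (length-Ω e))))

  -- The pair demands `size A + size B - size (A ⊓ᶜ B)` tokens and cannot occur at all if colours
  -- conflict, whence an inequality. In the proof `A` is planted, and then only `B ∖ᶜ A` must be
  -- found in `W`.
  ∑-⊆⊆ : ∀ {e} (A B : Config q e) →
         ∑[ W ∈ Ω e ] (𝟙 (A ⊆ᶜ? W) * N ^ size A * (𝟙 (B ⊆ᶜ? W) * N ^ size B))
         ≤ N ^ e * N ^ size (A ⊓ᶜ B)
  ∑-⊆⊆ {e} A B = begin
    ∑[ W ∈ Ω e ] (𝟙 (A ⊆ᶜ? W) * N ^ size A * (𝟙 (B ⊆ᶜ? W) * N ^ size B))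
      ≡⟨ ∑-cong (Ω e) (λ W → reorder (𝟙 (A ⊆ᶜ? W)) (N ^ size A) (𝟙 (B ⊆ᶜ? W)) (N ^ size B)) ⟩
    ∑[ W ∈ Ω e ] (N ^ size A * (𝟙 (A ⊆ᶜ? W) * 𝟙 (B ⊆ᶜ? W)) * N ^ size B)
      ≡⟨ ∑-*ʳ (Ω e) (N ^ size B) _ ⟩
    (∑[ W ∈ Ω e ] (N ^ size A * (𝟙 (A ⊆ᶜ? W) * 𝟙 (B ⊆ᶜ? W)))) * N ^ size B
      ≡⟨ cong (_* N ^ size B) (∑-*ˡ (Ω e) (N ^ size A) _) ⟩
    N ^ size A * (∑[ W ∈ Ω e ] (𝟙 (A ⊆ᶜ? W) * 𝟙 (B ⊆ᶜ? W))) * N ^ size B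
      ≡⟨ cong (_* N ^ size B) (sym (∑-over A λ Z → 𝟙 (B ⊆ᶜ? Z))) ⟩
    (∑[ W ∈ Ω e ] 𝟙 (B ⊆ᶜ? (W ◁ A))) * N ^ size B
      ≤⟨ *-monoˡ-≤ (N ^ size B) (∑-mono (Ω e) λ W →
           𝟙-mono (B ⊆ᶜ? (W ◁ A)) ((B ∖ᶜ A) ⊆ᶜ? W) (diff-⊆ A B W)) ⟩
    (∑[ W ∈ Ω e ] 𝟙 ((B ∖ᶜ A) ⊆ᶜ? W)) * N ^ size B
      ≡⟨ cong (S *_) (trans (cong (N ^_) (size-diff A B))
           (^-distribˡ-+-* N (size (B ∖ᶜ A)) (size (A ⊓ᶜ B)))) ⟩
    (∑[ W ∈ Ω e ] 𝟙 ((B ∖ᶜ A) ⊆ᶜ? W)) * (N ^ size (B ∖ᶜ A) * N ^ size (A ⊓ᶜ B))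
      ≡⟨ *-assoc S (N ^ size (B ∖ᶜ A)) _ ⟨
    (∑[ W ∈ Ω e ] 𝟙 ((B ∖ᶜ A) ⊆ᶜ? W)) * N ^ size (B ∖ᶜ A) * N ^ size (A ⊓ᶜ B)
      ≡⟨ cong (_* N ^ size (A ⊓ᶜ B)) (trans (sym (∑-*ʳ (Ω e) _ _)) (∑-⊆ (B ∖ᶜ A))) ⟩
    N ^ e * N ^ size (A ⊓ᶜ B) ∎
    where
    open ≤-Reasoning
    S : ℕ
    S = ∑[ W ∈ Ω e ] 𝟙 ((B ∖ᶜ A) ⊆ᶜ? W)
    reorder : ∀ a b c d → a * b * (c * d) ≡ b * (a * c) * d
    reorder = solve-∀

  -- `1 / D` is the precision. `spread-large` asks for its square because the first round controls
  -- only the second moment of the bad mass.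
  module TwoRounds {e : ℕ} (𝓘 : List (Config q e)) (D t : ℕ)
    {{_ : NonZero (length 𝓘)}}
    (spread-large : D * D * (∑[ A ∈ 𝓘 ] ∑[ B ∈ 𝓘 ] (𝟙 (t ≤? size (A ⊓ᶜ B)) * N ^ size (A ⊓ᶜ B)))
                    ≤ length 𝓘 * length 𝓘)
    (spread-small : ∀ A → A ∈ 𝓘 → ∀ F → F ⊆ᶜ A → size F < t →
                    D * (∑[ B ∈ 𝓘 ] (𝟙 (1 ≤? size (F ⊓ᶜ B)) * N ^ size (F ⊓ᶜ B))) ≤ length 𝓘)
    where

    open ≤-Reasoning

    I : ℕ
    I = length 𝓘

    -- Some member of 𝓘 inside Z has only a small part that A may have planted.
    Good : Config q e → Config q e → Set
    Good A Z = Any (λ B → B ⊆ᶜ Z × size (A ⊓ᶜ B) < t) 𝓘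

    good? : ∀ A Z → Dec (Good A Z)
    good? A Z = any? (λ B → (B ⊆ᶜ? Z) ×-dec (suc (size (A ⊓ᶜ B)) ≤? t)) 𝓘

    bad-meet : ∀ {A B Z} → ¬ Good A Z → B ∈ 𝓘 → B ⊆ᶜ Z → t ≤ size (A ⊓ᶜ B)
    bad-meet {A} {B} ¬good B∈ B⊆Z = ≮⇒≥ λ lt → ¬good (lose B∈ (B⊆Z , lt))

    badMass : Config q e → ℕ
    badMass Z = ∑[ A ∈ 𝓘 ] (𝟙 (A ⊆ᶜ? Z) * (N ^ size A * 𝟙 (¬? (good? A Z))))

    weight : Config q e → Config q e → ℕ
    weight A Z = 𝟙 (A ⊆ᶜ? Z) * N ^ size A

    -- One bad member of the pair is enough: if `A` is bad for `Z`, every member inside `Z` meets it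
    -- in at least `t` edges.
    badMass²≤ : ∀ Z → badMass Z * badMass Z ≤
      ∑[ A ∈ 𝓘 ] ∑[ B ∈ 𝓘 ] (𝟙 (t ≤? size (A ⊓ᶜ B)) * (weight A Z * weight B Z))
    badMass²≤ Z = begin
      badMass Z * badMass Z
        ≡⟨ ∑-*-∑ 𝓘 𝓘 _ _ ⟩
      ∑[ A ∈ 𝓘 ] ∑[ B ∈ 𝓘 ] (𝟙 (A ⊆ᶜ? Z) * (N ^ size A * 𝟙 (¬? (good? A Z)))
                            * (𝟙 (B ⊆ᶜ? Z) * (N ^ size B * 𝟙 (¬? (good? B Z)))))
        ≤⟨ ∑-mono-∈ 𝓘 (λ A A∈ → ∑-mono-∈ 𝓘 λ B B∈ →
             pointwise (A ⊆ᶜ? Z) (¬? (good? A Z)) (B ⊆ᶜ? Z) (¬? (good? B Z))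
                       (t ≤? size (A ⊓ᶜ B)) (N ^ size A) (N ^ size B)
                       (λ ¬good B⊆Z → bad-meet {A} {B} ¬good B∈ B⊆Z)) ⟩
      ∑[ A ∈ 𝓘 ] ∑[ B ∈ 𝓘 ] (𝟙 (t ≤? size (A ⊓ᶜ B)) * (weight A Z * weight B Z)) ∎
      where
      pointwise : ∀ {P Q P′ Q′ R : Set} (P? : Dec P) (Q? : Dec Q) (P′? : Dec P′) (Q′? : Dec Q′)
                  (R? : Dec R) m n → (Q → P′ → R) →
                  𝟙 P? * (m * 𝟙 Q?) * (𝟙 P′? * (n * 𝟙 Q′?)) ≤ 𝟙 R? * (𝟙 P? * m * (𝟙 P′? * n))
      pointwise (no _) Q? P′? Q′? R? m n h = z≤n
      pointwise (yes _) (no _) P′? Q′? R? m n h =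
        ≤-trans (≤-reflexive (cong (λ z → (z + 0) * (𝟙 P′? * (n * 𝟙 Q′?))) (*-zeroʳ m))) z≤n
      pointwise (yes _) (yes q) (no _) Q′? R? m n h =
        ≤-trans (≤-reflexive (*-zeroʳ (m * 1 + 0))) z≤n
      pointwise (yes _) (yes q) (yes p′) Q′? R? m n h rewrite 𝟙-yes R? (h q p′) = begin
        (m * 1 + 0) * (n * 𝟙 Q′? + 0)     ≤⟨ *-monoʳ-≤ (m * 1 + 0) (+-monoˡ-≤ 0 (*-monoʳ-≤ n (𝟙≤1 Q′?))) ⟩
        (m * 1 + 0) * (n * 1 + 0)         ≡⟨ lemma m n ⟩
        (m + 0) * (n + 0) + 0 ∎
        where
        lemma : ∀ m n → (m * 1 + 0) * (n * 1 + 0) ≡ (m + 0) * (n + 0) + 0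
        lemma = solve-∀

    ∑badMass² : D * D * (∑[ Z ∈ Ω e ] (badMass Z * badMass Z)) ≤ N ^ e * (I * I)
    ∑badMass² = begin
      D * D * (∑[ Z ∈ Ω e ] (badMass Z * badMass Z))
        ≤⟨ *-monoʳ-≤ (D * D) (∑-mono (Ω e) badMass²≤) ⟩
      D * D * (∑[ Z ∈ Ω e ] ∑[ A ∈ 𝓘 ] ∑[ B ∈ 𝓘 ] (𝟙 (t ≤? size (A ⊓ᶜ B)) * (weight A Z * weight B Z)))
        ≡⟨ cong (D * D *_) (trans (∑-swap (Ω e) 𝓘 _) (∑-cong 𝓘 λ A →
             trans (∑-swap (Ω e) 𝓘 _) (∑-cong 𝓘 λ B → ∑-*ˡ (Ω e) (𝟙 (t ≤? size (A ⊓ᶜ B))) _))) ⟩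
      D * D * (∑[ A ∈ 𝓘 ] ∑[ B ∈ 𝓘 ]
        (𝟙 (t ≤? size (A ⊓ᶜ B)) * (∑[ Z ∈ Ω e ] (weight A Z * weight B Z))))
        ≤⟨ *-monoʳ-≤ (D * D) (∑-mono 𝓘 λ A → ∑-mono 𝓘 λ B →
             *-monoʳ-≤ (𝟙 (t ≤? size (A ⊓ᶜ B))) (∑-⊆⊆ A B)) ⟩
      D * D * (∑[ A ∈ 𝓘 ] ∑[ B ∈ 𝓘 ] (𝟙 (t ≤? size (A ⊓ᶜ B)) * (N ^ e * N ^ size (A ⊓ᶜ B))))
        ≡⟨ cong (D * D *_) (trans (∑-cong 𝓘 λ A → trans (∑-cong 𝓘 λ B →
             swap (𝟙 (t ≤? size (A ⊓ᶜ B))) (N ^ e) _) (∑-*ˡ 𝓘 (N ^ e) _)) (∑-*ˡ 𝓘 (N ^ e) _)) ⟩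
      D * D * (N ^ e * Γ)
        ≡⟨ swap (D * D) (N ^ e) Γ ⟩
      N ^ e * (D * D * Γ)
        ≤⟨ *-monoʳ-≤ (N ^ e) spread-large ⟩
      N ^ e * (I * I) ∎
      where
      Γ : ℕ
      Γ = ∑[ A ∈ 𝓘 ] ∑[ B ∈ 𝓘 ] (𝟙 (t ≤? size (A ⊓ᶜ B)) * N ^ size (A ⊓ᶜ B))
      swap : ∀ a b c → a * (b * c) ≡ b * (a * c)
      swap = solve-∀

    -- x ≤ δ + x² / δ with δ = 1 / D, for x = badMass Z / I.
    ∑badMass : D * (∑[ Z ∈ Ω e ] badMass Z) ≤ 2 * N ^ e * I
    ∑badMass = *-cancelˡ-≤ I (begin
      I * (D * (∑[ Z ∈ Ω e ] badMass Z))
        ≡⟨ trans (sym (*-assoc I D _)) (sym (∑-*ˡ (Ω e) (I * D) badMass)) ⟩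
      ∑[ Z ∈ Ω e ] (I * D * badMass Z)
        ≤⟨ ∑-mono (Ω e) (λ Z → begin
             I * D * badMass Z                                  ≡⟨ *-assoc I D (badMass Z) ⟩
             I * (D * badMass Z)                                ≤⟨ xy≤xx+yy I (D * badMass Z) ⟩
             I * I + D * badMass Z * (D * badMass Z)            ≡⟨ lemma₁ I D (badMass Z) ⟩
             I * I * 1 + D * D * (badMass Z * badMass Z)        ∎) ⟩
      ∑[ Z ∈ Ω e ] (I * I * 1 + D * D * (badMass Z * badMass Z))
        ≡⟨ trans (∑-+ (Ω e) _ _) (cong₂ _+_ (trans (∑-*ˡ (Ω e) (I * I) λ _ → 1)
             (cong (I * I *_) (length-Ω e))) (∑-*ˡ (Ω e) (D * D) _)) ⟩
      I * I * N ^ e + D * D * (∑[ Z ∈ Ω e ] (badMass Z * badMass Z))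
        ≤⟨ +-monoʳ-≤ (I * I * N ^ e) ∑badMass² ⟩
      I * I * N ^ e + N ^ e * (I * I)
        ≡⟨ lemma₂ I (N ^ e) ⟩
      I * (2 * N ^ e * I) ∎)
      where
      lemma₁ : ∀ i d b → i * i + d * b * (d * b) ≡ i * i * 1 + d * d * (b * b)
      lemma₁ = solve-∀
      lemma₂ : ∀ i x → i * i * x + x * (i * i) ≡ i * (2 * x * i)
      lemma₂ = solve-∀

    -- `∑-over` under the sum over the family: planting a random member in a random outcome amounts
    -- to weighting the members that lie in `Z`.
    ∑bad : ∑[ W ∈ Ω e ] ∑[ A ∈ 𝓘 ] 𝟙 (¬? (good? A (W ◁ A))) ≡ ∑[ Z ∈ Ω e ] badMass Z
    ∑bad = trans (∑-swap (Ω e) 𝓘 _) (trans (∑-cong 𝓘 λ A →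
      trans (∑-over A λ Z → 𝟙 (¬? (good? A Z))) (trans (sym (∑-*ˡ (Ω e) (N ^ size A) _))
        (∑-cong (Ω e) λ Z → swap (N ^ size A) (𝟙 (A ⊆ᶜ? Z)) (𝟙 (¬? (good? A Z))))))
      (∑-swap 𝓘 (Ω e) _))
      where
      swap : ∀ a b c → a * (b * c) ≡ b * (a * c)
      swap = solve-∀

    fragment : ∀ A Z → Dec (Good A Z) → Config q e
    fragment A Z (yes g) = A ⊓ᶜ proj₁ (find g)
    -- A placeholder: the factor `ok A` removes it from every sum.
    fragment A Z (no _)  = A

    fragment-⊆ : ∀ A Z (g : Dec (Good A Z)) → fragment A Z g ⊆ᶜ A
    fragment-⊆ A Z (yes g) = ⊓-⊆ A (proj₁ (find g))
    fragment-⊆ A Z (no _)  = ⊆ᶜ-refl A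

    fragment-small : ∀ A Z (g : Dec (Good A Z)) → Good A Z → size (fragment A Z g) < t
    fragment-small A Z (yes g) _ = proj₂ (proj₂ (proj₂ (find g)))
    fragment-small A Z (no ¬g) g = ⊥-elim (¬g g)

    fragment-hit : ∀ A W W′ (g : Dec (Good A (W ◁ A))) → Good A (W ◁ A) →
                   fragment A (W ◁ A) g ⊆ᶜ W′ → Hit 𝓘 W W′
    fragment-hit A W W′ (no ¬g) g _ = ⊥-elim (¬g g)
    fragment-hit A W W′ (yes g) _ F⊆ with find g
    ... | B , B∈ , B⊆ , _ = lose B∈ (covered-◁ A B W W′ B⊆ F⊆)

    module Second (W : Config q e) where

      ok : Config q e → ℕ
      ok A = 𝟙 (good? A (W ◁ A))

      F : Config q e → Config q e
      F A = fragment A (W ◁ A) (good? A (W ◁ A))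

      good bad : ℕ
      good = ∑[ A ∈ 𝓘 ] ok A
      bad  = ∑[ A ∈ 𝓘 ] 𝟙 (¬? (good? A (W ◁ A)))

      good+bad : good + bad ≡ I
      good+bad = trans (sym (∑-+ 𝓘 _ _)) (trans (∑-cong 𝓘 λ A → 𝟙-¬ (good? A (W ◁ A)))
        (trans (∑-const 𝓘 1) (*-identityʳ I)))

      X : Config q e → ℕ
      X W′ = ∑[ A ∈ 𝓘 ] (ok A * weight (F A) W′)

      ∑X : ∑[ W′ ∈ Ω e ] X W′ ≡ good * N ^ e
      ∑X = trans (∑-swap (Ω e) 𝓘 _) (trans (∑-cong 𝓘 λ A →
        trans (∑-*ˡ (Ω e) (ok A) _) (cong (ok A *_) (∑-⊆ (F A)))) (∑-*ʳ 𝓘 (N ^ e) ok))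

      -- Disjoint fragments are uncorrelated and contribute `ok B`. For the others, replacing the
      -- fragment of `B` by `B` itself only enlarges the intersection and gives a term that
      -- `spread-small` controls.
      pair : ∀ A B → ok B * N ^ size (F A ⊓ᶜ F B)
                   ≤ ok B + 𝟙 (1 ≤? size (F A ⊓ᶜ B)) * N ^ size (F A ⊓ᶜ B)
      pair A B = lemma (ok B) (𝟙≤1 (good? B (W ◁ B))) (1 ≤? size (F A ⊓ᶜ B))
        (⊓-mono-size (F A) (F B) B (fragment-⊆ B (W ◁ B) (good? B (W ◁ B))))
        where
        lemma : ∀ {k l} o → o ≤ 1 → (d : Dec (1 ≤ l)) → k ≤ l → o * N ^ k ≤ o + 𝟙 d * N ^ l
        lemma {k} o o≤1 (no ¬h) k≤l = ≤-trans (≤-reflexive (trans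
          (cong (λ z → o * N ^ z) (n≤0⇒n≡0 (≤-trans k≤l (s≤s⁻¹ (≰⇒> ¬h))))) (*-identityʳ o))) (m≤m+n o 0)
        lemma o o≤1 (yes _) k≤l = ≤-trans (*-mono-≤ o≤1 (^-monoʳ-≤ N k≤l)) (m≤n+m _ o)

      β : Config q e → ℕ
      β A = ∑[ B ∈ 𝓘 ] (𝟙 (1 ≤? size (F A ⊓ᶜ B)) * N ^ size (F A ⊓ᶜ B))

      ok*Dβ≤ : ∀ A → A ∈ 𝓘 → ok A * (D * β A) ≤ I
      ok*Dβ≤ A A∈ = 𝟙*≤ (good? A (W ◁ A)) λ g →
        spread-small A A∈ (F A) (fragment-⊆ A (W ◁ A) (good? A (W ◁ A)))
          (fragment-small A (W ◁ A) (good? A (W ◁ A)) g)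

      ∑X² : D * (∑[ W′ ∈ Ω e ] (X W′ * X W′)) ≤ N ^ e * (D * (good * good) + I * I)
      ∑X² = begin
        D * (∑[ W′ ∈ Ω e ] (X W′ * X W′))
          ≡⟨ cong (D *_) (trans (∑-cong (Ω e) λ W′ → ∑-*-∑ 𝓘 𝓘 _ _)
               (trans (∑-swap (Ω e) 𝓘 _) (∑-cong 𝓘 λ A → trans (∑-swap (Ω e) 𝓘 _)
                 (∑-cong 𝓘 λ B → trans (∑-cong (Ω e) λ W′ → regroup (ok A) (weight (F A) W′) (ok B) _)
                   (∑-*ˡ (Ω e) (ok A * ok B) _))))) ⟩
        D * (∑[ A ∈ 𝓘 ] ∑[ B ∈ 𝓘 ] (ok A * ok B * (∑[ W′ ∈ Ω e ] (weight (F A) W′ * weight (F B) W′))))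
          ≤⟨ *-monoʳ-≤ D (∑-mono 𝓘 λ A → ∑-mono 𝓘 λ B → *-monoʳ-≤ (ok A * ok B) (∑-⊆⊆ (F A) (F B))) ⟩
        D * (∑[ A ∈ 𝓘 ] ∑[ B ∈ 𝓘 ] (ok A * ok B * (N ^ e * N ^ size (F A ⊓ᶜ F B))))
          ≡⟨ cong (D *_) (∑-cong 𝓘 λ A → ∑-cong 𝓘 λ B → regroup₂ (ok A) (ok B) (N ^ e) _) ⟩
        D * (∑[ A ∈ 𝓘 ] ∑[ B ∈ 𝓘 ] (N ^ e * ok A * (ok B * N ^ size (F A ⊓ᶜ F B))))
          ≤⟨ *-monoʳ-≤ D (∑-mono 𝓘 λ A → ∑-mono 𝓘 λ B → *-monoʳ-≤ (N ^ e * ok A) (pair A B)) ⟩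
        D * (∑[ A ∈ 𝓘 ] ∑[ B ∈ 𝓘 ] (N ^ e * ok A *
              (ok B + 𝟙 (1 ≤? size (F A ⊓ᶜ B)) * N ^ size (F A ⊓ᶜ B))))
          ≡⟨ cong (D *_) (∑-cong 𝓘 λ A → trans (∑-*ˡ 𝓘 (N ^ e * ok A) _)
               (cong (N ^ e * ok A *_) (∑-+ 𝓘 _ _))) ⟩
        D * (∑[ A ∈ 𝓘 ] (N ^ e * ok A * (good + β A)))
          ≡⟨ ∑-*ˡ 𝓘 D _ ⟨
        ∑[ A ∈ 𝓘 ] (D * (N ^ e * ok A * (good + β A)))
          ≡⟨ ∑-cong 𝓘 (λ A → regroup₃ D (N ^ e) (ok A) good (β A)) ⟩
        ∑[ A ∈ 𝓘 ] (ok A * (N ^ e * D * good) + N ^ e * (ok A * (D * β A)))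
          ≤⟨ ∑-mono-∈ 𝓘 (λ A A∈ → +-monoʳ-≤ _ (*-monoʳ-≤ (N ^ e) (ok*Dβ≤ A A∈))) ⟩
        ∑[ A ∈ 𝓘 ] (ok A * (N ^ e * D * good) + N ^ e * I)
          ≡⟨ trans (∑-+ 𝓘 _ _) (cong₂ _+_ (∑-*ʳ 𝓘 (N ^ e * D * good) ok) (∑-const 𝓘 (N ^ e * I))) ⟩
        good * (N ^ e * D * good) + I * (N ^ e * I)
          ≡⟨ regroup₄ D (N ^ e) good I ⟩
        N ^ e * (D * (good * good) + I * I) ∎
        where
        regroup : ∀ a b c d → a * b * (c * d) ≡ a * c * (b * d)
        regroup = solve-∀
        regroup₂ : ∀ a b c d → a * b * (c * d) ≡ c * a * (b * d)
        regroup₂ = solve-∀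
        regroup₃ : ∀ d n o g b → d * (n * o * (g + b)) ≡ o * (n * d * g) + n * (o * (d * b))
        regroup₃ = solve-∀
        regroup₄ : ∀ d n g i → g * (n * d * g) + i * (n * i) ≡ n * (d * (g * g) + i * i)
        regroup₄ = solve-∀

      miss : Config q e → ℕ
      miss W′ = 𝟙 (¬? (hit? 𝓘 W W′))

      -- (I - X)² ≥ I² when X = 0.
      miss-X : ∀ W′ → I * I * miss W′ + 2 * (I * X W′) ≤ I * I * 1 + X W′ * X W′
      miss-X W′ with hit? 𝓘 W W′
      ... | yes _ = ≤-trans (≤-reflexive (cong (_+ 2 * (I * X W′)) (*-zeroʳ (I * I))))
                      (≤-trans (2xy≤xx+yy I (X W′))
                        (≤-reflexive (cong (_+ X W′ * X W′) (sym (*-identityʳ (I * I))))))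
      ... | no ¬hit = +-monoʳ-≤ (I * I * 1) (≤-trans (≤-reflexive 2IX≡0) z≤n)
        where
        X≡0 : X W′ ≡ 0
        X≡0 = ∑≡0 𝓘 λ A _ → zero-term A
          where
          zero-term : ∀ A → ok A * weight (F A) W′ ≡ 0
          zero-term A with good? A (W ◁ A)
          ... | no _ = refl
          ... | yes g with fragment A (W ◁ A) (yes g) ⊆ᶜ? W′
          ...   | no _  = refl
          ...   | yes f = ⊥-elim (¬hit (fragment-hit A W W′ (yes g) g f))
        2IX≡0 : 2 * (I * X W′) ≡ 0
        2IX≡0 = trans (cong (λ z → 2 * (I * z)) X≡0) (cong (2 *_) (*-zeroʳ I))

      -- Chebyshev's inequality for `X`, with `I` in place of the mean: since `I - good = bad`, the
      -- average of `(I - X)²` is at most `bad² + I² / D`, and `bad² ≤ I * bad`.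
      ∑miss : D * I * (∑[ W′ ∈ Ω e ] miss W′) ≤ N ^ e * (D * bad + I)
      ∑miss = *-cancelˡ-≤ I (+-cancelʳ-≤ (2 * D * I * (good * N ^ e)) _ _ (begin
        I * (D * I * M) + 2 * D * I * (good * N ^ e)
          ≡⟨ cong (λ z → I * (D * I * M) + 2 * D * I * z) (sym ∑X) ⟩
        I * (D * I * M) + 2 * D * I * (∑ (Ω e) X)
          ≡⟨ lemma₁ D I M (∑ (Ω e) X) ⟩
        D * (I * I * M + 2 * (I * ∑ (Ω e) X))
          ≡⟨ cong (D *_) (cong₂ _+_ (sym (∑-*ˡ (Ω e) (I * I) miss))
               (trans (cong (2 *_) (sym (∑-*ˡ (Ω e) I X))) (sym (∑-*ˡ (Ω e) 2 _)))) ⟩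
        D * (∑ (Ω e) (λ W′ → I * I * miss W′) + ∑ (Ω e) (λ W′ → 2 * (I * X W′)))
          ≡⟨ cong (D *_) (∑-+ (Ω e) _ _) ⟨
        D * (∑[ W′ ∈ Ω e ] (I * I * miss W′ + 2 * (I * X W′)))
          ≤⟨ *-monoʳ-≤ D (∑-mono (Ω e) miss-X) ⟩
        D * (∑[ W′ ∈ Ω e ] (I * I * 1 + X W′ * X W′))
          ≡⟨ cong (D *_) (trans (∑-+ (Ω e) _ _) (cong (_+ ∑X²′)
               (trans (∑-*ˡ (Ω e) (I * I) λ _ → 1) (cong (I * I *_) (length-Ω e))))) ⟩
        D * (I * I * N ^ e + ∑X²′)
          ≡⟨ *-distribˡ-+ D (I * I * N ^ e) ∑X²′ ⟩
        D * (I * I * N ^ e) + D * ∑X²′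
          ≤⟨ +-monoʳ-≤ (D * (I * I * N ^ e)) ∑X² ⟩
        D * (I * I * N ^ e) + N ^ e * (D * (good * good) + I * I)
          ≤⟨ final D (N ^ e) good bad I good+bad ⟩
        I * (N ^ e * (D * bad + I)) + 2 * D * I * (good * N ^ e) ∎))
        where
        M ∑X²′ : ℕ
        M = ∑[ W′ ∈ Ω e ] miss W′
        ∑X²′ = ∑[ W′ ∈ Ω e ] (X W′ * X W′)
        lemma₁ : ∀ d i m x → i * (d * i * m) + 2 * d * i * x ≡ d * (i * i * m + 2 * (i * x))
        lemma₁ = solve-∀
        final : ∀ d n g b i → g + b ≡ i → d * (i * i * n) + n * (d * (g * g) + i * i)
                ≤ i * (n * (d * b + i)) + 2 * d * i * (g * n)
        final d n g b .(g + b) refl = ≤-trans (m≤m+n _ (d * n * (g * b))) (≤-reflexive (lemma d n g b))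
          where
          lemma : ∀ d n g b → d * ((g + b) * (g + b) * n) + n * (d * (g * g) + (g + b) * (g + b)) + d * n * (g * b)
                ≡ (g + b) * (n * (d * b + (g + b))) + 2 * d * (g + b) * (g * n)
          lemma = solve-∀

    -- Of the 3, two come from the bad mass of the first round and one from the variance in the
    -- second.
    two-rounds : D * (∑[ W ∈ Ω e ] ∑[ W′ ∈ Ω e ] 𝟙 (¬? (hit? 𝓘 W W′))) ≤ 3 * (N ^ e * N ^ e)
    two-rounds = *-cancelˡ-≤ I (begin
      I * (D * M)
        ≡⟨ reorder I D M ⟩
      D * I * M
        ≡⟨ ∑-*ˡ (Ω e) (D * I) _ ⟨
      ∑[ W ∈ Ω e ] (D * I * (∑[ W′ ∈ Ω e ] 𝟙 (¬? (hit? 𝓘 W W′))))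
        ≤⟨ ∑-mono (Ω e) (λ W → Second.∑miss W) ⟩
      ∑[ W ∈ Ω e ] (N ^ e * (D * Second.bad W + I))
        ≡⟨ ∑-*ˡ (Ω e) (N ^ e) _ ⟩
      N ^ e * (∑[ W ∈ Ω e ] (D * Second.bad W + I))
        ≡⟨ cong (N ^ e *_) (trans (∑-+ (Ω e) _ _) (cong₂ _+_ (∑-*ˡ (Ω e) D Second.bad)
             (trans (∑-cong (Ω e) λ _ → sym (*-identityʳ I))
               (trans (∑-*ˡ (Ω e) I λ _ → 1) (cong (I *_) (length-Ω e)))))) ⟩
      N ^ e * (D * ∑ (Ω e) Second.bad + I * N ^ e)
        ≡⟨ cong (λ z → N ^ e * (D * z + I * N ^ e)) ∑bad ⟩
      N ^ e * (D * ∑ (Ω e) badMass + I * N ^ e)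
        ≤⟨ *-monoʳ-≤ (N ^ e) (+-monoˡ-≤ (I * N ^ e) ∑badMass) ⟩
      N ^ e * (2 * N ^ e * I + I * N ^ e)
        ≡⟨ lemma (N ^ e) I ⟩
      I * (3 * (N ^ e * N ^ e)) ∎)
      where
      M : ℕ
      M = ∑[ W ∈ Ω e ] ∑[ W′ ∈ Ω e ] 𝟙 (¬? (hit? 𝓘 W W′))
      reorder : ∀ i d m → i * (d * m) ≡ d * i * m
      reorder = solve-∀
      lemma : ∀ n i → n * (2 * n * i + i * n) ≡ i * (3 * (n * n))
      lemma = solve-∀

-- Injective sequences with prescribed entries

-- An integer form of `1 - bP/n ≤ (1 + b/n)^(-P)`. Truncated subtraction makes it trivial as soon as
-- `b * P` reaches `n`.
bernoulli-≤ : ∀ n b P → (n + b) ^ P * (n ∸ b * P) ≤ n ^ suc P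
bernoulli-≤ n b zero = ≤-reflexive (trans (*-identityˡ _)
  (trans (cong (n ∸_) (*-zeroʳ b)) (sym (*-identityʳ n))))
bernoulli-≤ n b (suc P) = begin
  (n + b) * (n + b) ^ P * (n ∸ b * suc P)   ≡⟨ reorder (n + b) ((n + b) ^ P) _ ⟩
  (n + b) ^ P * ((n + b) * (n ∸ b * suc P)) ≤⟨ *-monoʳ-≤ ((n + b) ^ P) step ⟩
  (n + b) ^ P * ((n ∸ b * P) * n)           ≡⟨ *-assoc ((n + b) ^ P) (n ∸ b * P) n ⟨
  (n + b) ^ P * (n ∸ b * P) * n             ≤⟨ *-monoˡ-≤ n (bernoulli-≤ n b P) ⟩
  n ^ suc P * n                             ≡⟨ *-comm (n ^ suc P) n ⟩
  n ^ suc (suc P) ∎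
  where
  open ≤-Reasoning
  reorder : ∀ x y z → x * y * z ≡ y * (x * z)
  reorder = solve-∀
  step : (n + b) * (n ∸ b * suc P) ≤ (n ∸ b * P) * n
  step with ≤-total n (b * suc P)
  ... | inj₁ n≤ = ≤-trans (≤-reflexive (trans (cong ((n + b) *_) (m≤n⇒m∸n≡0 n≤)) (*-zeroʳ (n + b)))) z≤n
  ... | inj₂ ≤n with m≤n⇒∃[o]m+o≡n ≤n
  ...   | d , refl = begin
    (b * suc P + d + b) * (b * suc P + d ∸ b * suc P) ≡⟨ cong ((b * suc P + d + b) *_) (m+n∸m≡n (b * suc P) d) ⟩
    (b * suc P + d + b) * d                           ≡⟨ lemma b P d ⟩
    (b + d) * d + b * P * d + b * d                   ≤⟨ m≤m+n _ (b * (b * P + b)) ⟩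
    (b + d) * d + b * P * d + b * d + b * (b * P + b) ≡⟨ lemma₂ b P d ⟩
    (b + d) * (b * suc P + d)                         ≡⟨ cong (_* (b * suc P + d)) (sym sub) ⟩
    (b * suc P + d ∸ b * P) * (b * suc P + d) ∎
    where
    lemma : ∀ b P d → (b * (1 + P) + d + b) * d ≡ (b + d) * d + b * P * d + b * d
    lemma = solve-∀
    lemma₂ : ∀ b P d → (b + d) * d + b * P * d + b * d + b * (b * P + b) ≡ (b + d) * (b * (1 + P) + d)
    lemma₂ = solve-∀
    split : ∀ b P d → b * (1 + P) + d ≡ b * P + (b + d)
    split = solve-∀
    sub : b * suc P + d ∸ b * P ≡ b + d
    sub = trans (cong (_∸ b * P) (split b P d)) (m+n∸m≡n (b * P) (b + d))

private
  double : ∀ h q → h + h ≤ q → (1 + q) ^ h ≤ 2 * q ^ h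
  double zero q _ = s≤s z≤n
  double h@(suc _) q@(suc _) hh≤q = *-cancelʳ-≤ ((1 + q) ^ h) (2 * q ^ h) q (begin
    (1 + q) ^ h * q                 ≤⟨ *-monoʳ-≤ ((1 + q) ^ h) q≤ ⟩
    (1 + q) ^ h * (2 * (q ∸ 1 * h)) ≡⟨ reorder ((1 + q) ^ h) (q ∸ 1 * h) ⟩
    2 * ((1 + q) ^ h * (q ∸ 1 * h)) ≡⟨ cong (λ z → 2 * (z ^ h * (q ∸ 1 * h))) (+-comm 1 q) ⟩
    2 * ((q + 1) ^ h * (q ∸ 1 * h)) ≤⟨ *-monoʳ-≤ 2 (bernoulli-≤ q 1 h) ⟩
    2 * (q * q ^ h)                 ≡⟨ reorder₂ q (q ^ h) ⟩
    2 * q ^ h * q ∎)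
    where
    open ≤-Reasoning
    reorder : ∀ x y → x * (2 * y) ≡ 2 * (x * y)
    reorder = solve-∀
    reorder₂ : ∀ x y → 2 * (x * y) ≡ 2 * y * x
    reorder₂ = solve-∀
    q≤ : q ≤ 2 * (q ∸ 1 * h)
    q≤ with m≤n⇒∃[o]m+o≡n hh≤q
    ... | d , eq = subst (λ q → q ≤ 2 * (q ∸ 1 * h)) eq (begin
      h + h + d                 ≤⟨ m≤m+n (h + h + d) d ⟩
      h + h + d + d             ≡⟨ lemma h d ⟩
      2 * (h + d)               ≡⟨ cong (2 *_) (sym (trans (cong₂ _∸_ (+-assoc h h d) (*-identityˡ h)) (m+n∸m≡n h (h + d)))) ⟩
      2 * (h + h + d ∸ 1 * h) ∎)
      where
      lemma : ∀ h d → h + h + d + d ≡ 2 * (h + d)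
      lemma = solve-∀

-- Replaces `(1 + 1/q)^q ≤ e`: of the `s` factors one is at most 2, and the others form two halves
-- to which `double` applies.
[1+q]^s≤8*q^s : ∀ s q → s ≤ q → (1 + q) ^ s ≤ 8 * q ^ s
[1+q]^s≤8*q^s zero q _ = s≤s z≤n
[1+q]^s≤8*q^s (suc s) q@(suc q′) s≤q = begin
  (1 + q) ^ suc s                          ≡⟨ cong ((1 + q) ^_) (cong suc (sym (⌊n/2⌋+⌈n/2⌉≡n s))) ⟩
  (1 + q) * (1 + q) ^ (h + k)              ≡⟨ cong ((1 + q) *_) (^-distribˡ-+-* (1 + q) h k) ⟩
  (1 + q) * ((1 + q) ^ h * (1 + q) ^ k)    ≤⟨ *-mono-≤ 1+q≤2q (*-mono-≤ (double h q h≤) (double k q k≤)) ⟩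
  2 * q * (2 * q ^ h * (2 * q ^ k))        ≡⟨ reorder q (q ^ h) (q ^ k) ⟩
  8 * (q * (q ^ h * q ^ k))                ≡⟨ cong (λ z → 8 * (q * z)) (sym (^-distribˡ-+-* q h k)) ⟩
  8 * (q * q ^ (h + k))                    ≡⟨ cong (λ z → 8 * (q * q ^ z)) (⌊n/2⌋+⌈n/2⌉≡n s) ⟩
  8 * q ^ suc s ∎
  where
  open ≤-Reasoning
  h k : ℕ
  h = ⌊ s /2⌋
  k = ⌈ s /2⌉
  h≤k : h ≤ k
  h≤k = ⌊n/2⌋-mono (n≤1+n s)
  k≤ : k + k ≤ q
  k≤ = ≤-trans (lemma s) s≤q
    where
    lemma : ∀ s → ⌈ s /2⌉ + ⌈ s /2⌉ ≤ suc s
    lemma zero = z≤n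
    lemma (suc zero) = s≤s (s≤s z≤n)
    lemma (suc (suc s)) = s≤s (≤-trans (≤-reflexive (+-suc _ _)) (s≤s (lemma s)))
  h≤ : h + h ≤ q
  h≤ = ≤-trans (+-mono-≤ h≤k h≤k) k≤
  1+q≤2q : 1 + q ≤ 2 * q
  1+q≤2q = s≤s (≤-trans (≤-reflexive (+-comm 1 q′)) (+-monoʳ-≤ q′ (s≤s z≤n)))
  reorder : ∀ q x y → 2 * q * (2 * x * (2 * y)) ≡ 8 * (q * (x * y))
  reorder = solve-∀

fall : ℕ → ℕ → ℕ
fall q       zero    = 1
fall zero    (suc k) = 0
fall (suc q) (suc k) = suc q * fall q k

-- Taking values without repetition costs only a constant factor per value: passing from `suc q` to
-- `q` changes the remaining `s` factors by at most 8 altogether.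
q^s≤8^s*fall : ∀ s q → s ≤ q → q ^ s ≤ 8 ^ s * fall q s
q^s≤8^s*fall zero q _ = s≤s z≤n
q^s≤8^s*fall (suc s) (suc q) (s≤s s≤q) = begin
  suc q * suc q ^ s                ≤⟨ *-monoʳ-≤ (suc q) ([1+q]^s≤8*q^s s q s≤q) ⟩
  suc q * (8 * q ^ s)              ≤⟨ *-monoʳ-≤ (suc q) (*-monoʳ-≤ 8 (q^s≤8^s*fall s q s≤q)) ⟩
  suc q * (8 * (8 ^ s * fall q s)) ≡⟨ reorder (suc q) (8 ^ s) (fall q s) ⟩
  8 * 8 ^ s * (suc q * fall q s) ∎
  where
  open ≤-Reasoning
  reorder : ∀ a b c → a * (8 * (b * c)) ≡ 8 * b * (a * c)
  reorder = solve-∀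

fall-suc : ∀ q s → fall q s * (q ∸ s) ≡ fall q (suc s)
fall-suc zero    zero    = refl
fall-suc (suc q) zero    = trans (*-identityˡ (suc q)) (sym (*-identityʳ (suc q)))
fall-suc zero    (suc s) = refl
fall-suc (suc q) (suc s) = trans (*-assoc (suc q) (fall q s) _) (cong (suc q *_) (fall-suc q s))

fall-pos : ∀ {q k} → k ≤ q → 0 < fall q k
fall-pos {q}     {zero}  _         = s≤s z≤n
fall-pos {suc q} {suc k} (s≤s k≤q) = *-mono-≤ {1} {suc q} (s≤s z≤n) (fall-pos k≤q)

injections : ∀ k q → List (Vec (Fin q) k)
injections zero    q       = [] ∷ []
injections (suc k) zero    = []
injections (suc k) (suc q) =
  concatMap (λ x → map (λ v → x ∷ Vec.map (punchIn x) v) (injections k q)) (allFin (suc q))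

∑-injections : ∀ k q f → ∑ (injections (suc k) (suc q)) f
             ≡ ∑[ x ∈ allFin (suc q) ] ∑[ v ∈ injections k q ] f (x ∷ Vec.map (punchIn x) v)
∑-injections k q f = trans (∑-concatMap _ (allFin (suc q)) f)
  (∑-cong (allFin (suc q)) λ x → ∑-map _ (injections k q) f)

length-allFin : ∀ n → length (allFin n) ≡ n
length-allFin n = length-tabulate {n = n} (λ i → i)

∑-injections-1 : ∀ k q → ∑ (injections k q) (λ _ → 1) ≡ fall q k
∑-injections-1 zero    q       = trans (∑-∷ [] [] _) (cong suc (∑-[] _))
∑-injections-1 (suc k) zero    = ∑-[] _
∑-injections-1 (suc k) (suc q) = trans (∑-injections k q _)
  (trans (∑-cong (allFin (suc q)) λ _ → ∑-injections-1 k q)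
    (trans (∑-const (allFin (suc q)) (fall q k)) (cong (_* fall q k) (length-allFin (suc q)))))

injections-unique : ∀ k q {v} → v ∈ injections k q → Unique v
injections-unique zero q {[]} _ = []
injections-unique (suc k) (suc q) v∈ with find (∈-concatMap⁻ _ {xs = allFin (suc q)} v∈)
... | x , _ , v∈x with ∈-map⁻ _ v∈x
...   | w , w∈ , refl = All.map⁺ (All.universal (λ y x≡ → Fin.punchInᵢ≢i x y (sym x≡)) w)
                      ∷ Unique.map⁺ (Fin.punchIn-injective x _ _) (injections-unique k q w∈)

-- A `Config` now serves as a prescription of some entries of a sequence.
Match : ∀ {q k} → Config q k → Vec (Fin q) k → Set
Match []      []      = ⊤
Match (a ∷ c) (x ∷ v) = a ⊑ just x × Match c v

match? : ∀ {q k} (c : Config q k) v → Dec (Match c v)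
match? []      []      = yes tt
match? (a ∷ c) (x ∷ v) = a ⊑? just x ×-dec match? c v

occ₁ : ∀ {q} → Maybe (Fin q) → Fin q → ℕ
occ₁ nothing  y = 0
occ₁ (just z) y = 𝟙 (z Fin.≟ y)

occ : ∀ {q k} → Config q k → Fin q → ℕ
occ []      y = 0
occ (a ∷ c) y = occ₁ a y + occ c y

Distinct : ∀ {q k} → Config q k → Set
Distinct c = ∀ y → occ c y ≤ 1

∑-allFin-𝟙 : ∀ {q} (z : Fin q) → ∑[ y ∈ allFin q ] 𝟙 (z Fin.≟ y) ≡ 1
∑-allFin-𝟙 {q} z = go q (λ i → i) (λ e → e) z
  where
  go : ∀ m (f : Fin m → Fin q) → (∀ {i j} → f i ≡ f j → i ≡ j) → ∀ i → ∑ (tabulate f) (λ y → 𝟙 (f i Fin.≟ y)) ≡ 1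
  go (suc m) f inj zero = trans (∑-∷ _ _ _) (cong₂ _+_ (𝟙-yes (f zero Fin.≟ f zero) refl)
    (∑≡0 _ λ y y∈ → 𝟙-no (f zero Fin.≟ y) (none y∈)))
    where
    none : ∀ {y} → y ∈ tabulate (λ i → f (suc i)) → f zero ≢ y
    none y∈ refl with ∈-tabulate⁻ y∈
    ... | i , eq with inj eq
    ...   | ()
  go (suc m) f inj (suc i) = trans (∑-∷ _ _ _) (cong₂ _+_
    (𝟙-no (f (suc i) Fin.≟ f zero) (λ eq → Fin.0≢1+n (sym (inj eq))))
    (go m (λ j → f (suc j)) (λ e → Fin.suc-injective (inj e)) i))

∑-occ : ∀ {q k} (c : Config q k) → ∑ (allFin q) (occ c) ≡ size c
∑-occ {q} []         = ∑-0 (allFin q)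
∑-occ (nothing ∷ c)  = ∑-occ c
∑-occ {q} (just z ∷ c) = trans (∑-+ (allFin q) _ _) (cong₂ _+_ (∑-allFin-𝟙 z) (∑-occ c))

unused : ∀ {q k} → Config q k → ℕ
unused {q} c = ∑[ y ∈ allFin q ] 𝟙 (occ c y ≟ 0)

unused+size≤ : ∀ {q k} (c : Config q k) → Distinct c → unused c + size c ≤ q
unused+size≤ {q} c dist = begin
  unused c + size c                                 ≡⟨ cong (unused c +_) (∑-occ c) ⟨
  unused c + ∑ (allFin q) (occ c)                   ≡⟨ ∑-+ (allFin q) _ _ ⟨
  ∑[ y ∈ allFin q ] (𝟙 (occ c y ≟ 0) + occ c y)     ≤⟨ ∑-≤-const (allFin q) (λ y → lemma (dist y)) ⟩
  length (allFin q) * 1                             ≡⟨ trans (*-identityʳ _) (length-allFin q) ⟩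
  q ∎
  where
  open ≤-Reasoning
  lemma : ∀ {n} → n ≤ 1 → 𝟙 (n ≟ 0) + n ≤ 1
  lemma {zero} _ = s≤s z≤n
  lemma {suc n} h = h

-- What the prescription for the tail becomes when the first entry takes the value `x`. The case of
-- an entry equal to `x` is a default; by `match-occ` it cannot arise from a match.
out₁ : ∀ {q} → Fin (suc q) → Maybe (Fin (suc q)) → Maybe (Fin q)
out₁ x nothing  = nothing
out₁ x (just z) with x Fin.≟ z
... | yes _  = nothing
... | no x≢z = just (punchOut x≢z)

out : ∀ {q k} → Fin (suc q) → Config (suc q) k → Config q k
out x = Vec.map (out₁ x)

out-size : ∀ {q k} x (c : Config (suc q) k) → occ c x ≡ 0 → size (out x c) ≡ size c
out-size x [] _ = refl
out-size x (nothing ∷ c) h = out-size x c h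
out-size x (just z ∷ c) h with x Fin.≟ z
... | yes refl = ⊥-elim (1+n≢0 (trans (cong (_+ occ c x) (sym (𝟙-yes (x Fin.≟ x) refl))) h))
... | no x≢z   = cong suc (out-size x c (m+n≡0⇒n≡0 (𝟙 (z Fin.≟ x)) h))

out-occ : ∀ {q k} x (c : Config (suc q) k) y → occ (out x c) y ≤ occ c (punchIn x y)
out-occ x [] y = z≤n
out-occ x (nothing ∷ c) y = out-occ x c y
out-occ x (just z ∷ c) y with x Fin.≟ z
... | yes _  = ≤-trans (out-occ x c y) (m≤n+m _ _)
... | no x≢z = +-mono-≤ (𝟙-mono (punchOut x≢z Fin.≟ y) (z Fin.≟ punchIn x y)
                 λ eq → trans (sym (Fin.punchIn-punchOut x≢z)) (cong (punchIn x) eq)) (out-occ x c y)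

out-match : ∀ {q k} x (c : Config (suc q) k) v → Match c (Vec.map (punchIn x) v) → Match (out x c) v
out-match x [] [] _ = tt
out-match x (nothing ∷ c) (y ∷ v) (_ , m) = tt , out-match x c v m
out-match x (just z ∷ c) (y ∷ v) (e , m) with x Fin.≟ z
... | yes _  = tt , out-match x c v m
... | no x≢z = cong just (trans (sym (Fin.punchOut-punchIn x))
                 (Fin.punchOut-cong x (just-injective e))) , out-match x c v m

match-occ : ∀ {q k} x (c : Config (suc q) k) v → Match c (Vec.map (punchIn x) v) → occ c x ≡ 0
match-occ x [] [] _ = refl
match-occ x (nothing ∷ c) (y ∷ v) (_ , m) = match-occ x c v m
match-occ x (just z ∷ c) (y ∷ v) (e , m) = cong₂ _+_
  (𝟙-no (z Fin.≟ x) λ { refl → Fin.punchInᵢ≢i x y (just-injective e) }) (match-occ x c v m)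

count : ∀ {q k} → Config q k → ℕ
count {q} {k} c = ∑[ v ∈ injections k q ] 𝟙 (match? c v)

-- The exact count is the falling factorial of `q - s` of length `k - s`, with `s` the number of
-- prescribed entries; the product form avoids subtraction. A prescribed first entry leaves one
-- choice, a free one at most `q - s`, as it must avoid the values prescribed later.
count-fall : ∀ {q k} (c : Config q k) → Distinct c → count c * fall q (size c) ≤ fall q k
count-fall {q} [] _ = ≤-reflexive (trans (*-identityʳ _) (trans (∑-∷ [] [] _) (cong suc (∑-[] _))))
count-fall {zero} (a ∷ c) _ = ≤-trans (≤-reflexive (cong (_* fall 0 (size (a ∷ c))) (∑-[] _))) z≤n
count-fall {suc q} {suc k} (a ∷ c) dist = begin
  count (a ∷ c) * fall (suc q) (size (a ∷ c))
    ≡⟨ cong (_* fall (suc q) (size (a ∷ c))) (∑-injections k q _) ⟩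
  (∑[ x ∈ allFin (suc q) ] ∑[ v ∈ injections k q ] 𝟙 (match? (a ∷ c) (x ∷ Vec.map (punchIn x) v)))
    * fall (suc q) (size (a ∷ c))
    ≤⟨ *-monoˡ-≤ (fall (suc q) (size (a ∷ c))) (∑-mono (allFin (suc q)) term≤) ⟩
  (∑[ x ∈ allFin (suc q) ] (𝟙 (a ⊑? just x) * (𝟙 (occ c x ≟ 0) * count (out x c))))
    * fall (suc q) (size (a ∷ c))
    ≤⟨ by-head a dist ⟩
  suc q * fall q k ∎
  where
  open ≤-Reasoning
  term≤ : ∀ x → ∑[ v ∈ injections k q ] 𝟙 (match? (a ∷ c) (x ∷ Vec.map (punchIn x) v))
              ≤ 𝟙 (a ⊑? just x) * (𝟙 (occ c x ≟ 0) * count (out x c))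
  term≤ x = begin
    ∑[ v ∈ injections k q ] 𝟙 (match? (a ∷ c) (x ∷ Vec.map (punchIn x) v))
      ≤⟨ ∑-mono (injections k q) (λ v → pointwise v) ⟩
    ∑[ v ∈ injections k q ] (𝟙 (a ⊑? just x) * (𝟙 (occ c x ≟ 0) * 𝟙 (match? (out x c) v)))
      ≡⟨ trans (∑-*ˡ (injections k q) (𝟙 (a ⊑? just x)) _)
         (cong (𝟙 (a ⊑? just x) *_) (∑-*ˡ (injections k q) (𝟙 (occ c x ≟ 0)) _)) ⟩
    𝟙 (a ⊑? just x) * (𝟙 (occ c x ≟ 0) * count (out x c)) ∎
    where
    pointwise : ∀ v → 𝟙 (match? (a ∷ c) (x ∷ Vec.map (punchIn x) v))
              ≤ 𝟙 (a ⊑? just x) * (𝟙 (occ c x ≟ 0) * 𝟙 (match? (out x c) v))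
    pointwise v = ≤-trans
      (𝟙-mono (match? (a ∷ c) (x ∷ Vec.map (punchIn x) v))
              ((a ⊑? just x) ×-dec ((occ c x ≟ 0) ×-dec match? (out x c) v))
              λ (h , m) → h , match-occ x c v m , out-match x c v m)
      (≤-reflexive (trans (𝟙-× (a ⊑? just x) ((occ c x ≟ 0) ×-dec match? (out x c) v))
        (cong (𝟙 (a ⊑? just x) *_) (𝟙-× (occ c x ≟ 0) (match? (out x c) v)))))

  inner : Distinct c → ∀ x → 𝟙 (occ c x ≟ 0) * count (out x c) * fall q (size c)
                           ≤ 𝟙 (occ c x ≟ 0) * fall q k
  inner distc x = ≤-trans (≤-reflexive (*-assoc (𝟙 (occ c x ≟ 0)) _ _)) (𝟙-*-≤ (occ c x ≟ 0) λ x∉ →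
    subst (λ s → count (out x c) * fall q s ≤ fall q k) (out-size x c x∉)
      (count-fall (out x c) λ y → ≤-trans (out-occ x c y) (distc (punchIn x y))))

  by-head : ∀ a → Distinct (a ∷ c) →
    (∑[ x ∈ allFin (suc q) ] (𝟙 (a ⊑? just x) * (𝟙 (occ c x ≟ 0) * count (out x c))))
      * fall (suc q) (size (a ∷ c)) ≤ suc q * fall q k
  by-head (just y) dist = begin
    S * (suc q * fall q (size c))             ≡⟨ reorder S (suc q) (fall q (size c)) ⟩
    suc q * (S * fall q (size c))             ≤⟨ *-monoʳ-≤ (suc q) S*≤ ⟩
    suc q * fall q k ∎
    where
    S : ℕ
    S = ∑[ x ∈ allFin (suc q) ] (𝟙 (just y ⊑? just x) * (𝟙 (occ c x ≟ 0) * count (out x c)))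
    reorder : ∀ a b c → a * (b * c) ≡ b * (a * c)
    reorder = solve-∀
    distc : Distinct c
    distc z = ≤-trans (m≤n+m _ _) (dist z)
    S*≤ : S * fall q (size c) ≤ fall q k
    S*≤ = begin
      S * fall q (size c)
        ≡⟨ ∑-*ʳ (allFin (suc q)) (fall q (size c)) _ ⟨
      ∑[ x ∈ allFin (suc q) ] (𝟙 (just y ⊑? just x) * (𝟙 (occ c x ≟ 0) * count (out x c)) * fall q (size c))
        ≤⟨ ∑-mono (allFin (suc q)) (λ x → ≤-trans (≤-reflexive (*-assoc (𝟙 (just y ⊑? just x)) _ _))
             (*-mono-≤ (𝟙-mono (just y ⊑? just x) (y Fin.≟ x) (λ e → sym (just-injective e)))
               (≤-trans (inner distc x) (≤-trans (*-monoˡ-≤ (fall q k) (𝟙≤1 (occ c x ≟ 0)))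
                 (≤-reflexive (*-identityˡ _)))))) ⟩
      ∑[ x ∈ allFin (suc q) ] (𝟙 (y Fin.≟ x) * fall q k)
        ≡⟨ trans (∑-*ʳ (allFin (suc q)) (fall q k) _) (cong (_* fall q k) (∑-allFin-𝟙 y)) ⟩
      1 * fall q k
        ≡⟨ *-identityˡ _ ⟩
      fall q k ∎
  by-head nothing dist with size c ≤? q
  -- All `suc q` values are prescribed in the tail, so none is left for the first entry.
  ... | no ¬s≤q = ≤-trans (≤-reflexive (cong (_* fall (suc q) (size c)) (trans
          (∑-cong (allFin (suc q)) λ x → *-identityˡ _)
          (∑≡0 (allFin (suc q)) λ x x∈ → cong (_* count (out x c)) (none x x∈))))) z≤n
    where
    none : ∀ x → x ∈ allFin (suc q) → 𝟙 (occ c x ≟ 0) ≡ 0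
    none x x∈ = n≤0⇒n≡0 (≤-trans (≤-∑ (λ y → 𝟙 (occ c y ≟ 0)) x∈)
      (+-cancelʳ-≤ (size c) _ 0 (≤-trans (unused+size≤ c dist) (≰⇒> ¬s≤q))))
  ... | yes s≤q = *-cancelʳ-≤ _ _ (suc q ∸ size c) {{>-nonZero (m<n⇒0<n∸m (s≤s s≤q))}} (begin
    S * fall (suc q) (size c) * (suc q ∸ size c)
      ≡⟨ trans (*-assoc S _ _) (cong (S *_) (fall-suc (suc q) (size c))) ⟩
    S * (suc q * fall q (size c))
      ≡⟨ reorder S (suc q) (fall q (size c)) ⟩
    suc q * (S * fall q (size c))
      ≡⟨ cong (suc q *_) (∑-*ʳ (allFin (suc q)) (fall q (size c)) _) ⟨
    suc q * (∑[ x ∈ allFin (suc q) ] (1 * (𝟙 (occ c x ≟ 0) * count (out x c)) * fall q (size c)))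
      ≤⟨ *-monoʳ-≤ (suc q) (∑-mono (allFin (suc q)) λ x →
           ≤-trans (≤-reflexive (cong (_* fall q (size c)) (*-identityˡ (𝟙 (occ c x ≟ 0) * count (out x c))))) (inner dist x)) ⟩
    suc q * (∑[ x ∈ allFin (suc q) ] (𝟙 (occ c x ≟ 0) * fall q k))
      ≡⟨ cong (suc q *_) (∑-*ʳ (allFin (suc q)) (fall q k) _) ⟩
    suc q * (unused c * fall q k)
      ≤⟨ *-monoʳ-≤ (suc q) (*-monoˡ-≤ (fall q k) (m+n≤o⇒m≤o∸n (unused c) {size c} (unused+size≤ c dist))) ⟩
    suc q * ((suc q ∸ size c) * fall q k)
      ≡⟨ reorder₂ (suc q) (suc q ∸ size c) (fall q k) ⟩
    suc q * fall q k * (suc q ∸ size c) ∎)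
    where
    S : ℕ
    S = ∑[ x ∈ allFin (suc q) ] (1 * (𝟙 (occ c x ≟ 0) * count (out x c)))
    reorder : ∀ a b c → a * (b * c) ≡ b * (a * c)
    reorder = solve-∀
    reorder₂ : ∀ a b c → a * (b * c) ≡ a * c * b
    reorder₂ = solve-∀

count-≤ : ∀ {q k} (c : Config q k) → Distinct c → count c * q ^ size c ≤ 8 ^ size c * fall q k
count-≤ {q} {k} c dist = begin
  count c * q ^ size c                      ≤⟨ *-monoʳ-≤ (count c) (q^s≤8^s*fall (size c) q
                                                 (≤-trans (m≤n+m _ _) (unused+size≤ c dist))) ⟩
  count c * (8 ^ size c * fall q (size c))  ≡⟨ reorder (count c) (8 ^ size c) (fall q (size c)) ⟩
  8 ^ size c * (count c * fall q (size c))  ≤⟨ *-monoʳ-≤ (8 ^ size c) (count-fall c dist) ⟩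
  8 ^ size c * fall q k ∎
  where
  open ≤-Reasoning
  reorder : ∀ a b c → a * (b * c) ≡ b * (a * c)
  reorder = solve-∀

record Extends {q k} (c : Config q k) (j : Fin k) (b : Fin q) (c′ : Config q k) : Set where
  field
    size-ext : size c′ ≡ suc (size c)
    occ-ext  : ∀ y → occ c′ y ≡ occ c y + 𝟙 (b Fin.≟ y)

open Extends

match-lookup : ∀ {q k} (c : Config q k) v j {d} → Match c v → lookup c j ≡ just d → lookup v j ≡ d
match-lookup (just _ ∷ c) (x ∷ v) zero    (m , _) refl = just-injective m
match-lookup (_ ∷ c)      (x ∷ v) (suc j) (_ , m) eq   = match-lookup c v j m eq

occ-lookup : ∀ {q k} (c : Config q k) j {d} → lookup c j ≡ just d → 1 ≤ occ c d
occ-lookup (just d ∷ c) zero refl = ≤-trans (≤-reflexive (sym (𝟙-yes (d Fin.≟ d) refl))) (m≤m+n _ _)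
occ-lookup (a ∷ c) (suc j) eq = ≤-trans (occ-lookup c j eq) (m≤n+m _ _)

lookup-occ : ∀ {q k} (c : Config q k) d → occ c d ≢ 0 → ∃[ j ] lookup c j ≡ just d
lookup-occ [] d h = ⊥-elim (h refl)
lookup-occ (nothing ∷ c) d h with lookup-occ c d h
... | j , eq = suc j , eq
lookup-occ (just z ∷ c) d h with z Fin.≟ d
... | yes refl = zero , refl
... | no z≢d with lookup-occ c d h
...   | j , eq = suc j , eq

extend : ∀ {q k} (c : Config q k) j b → lookup c j ≡ nothing → Extends c j b (c [ j ]≔ just b)
extend (nothing ∷ c) zero b refl = record
  { size-ext = refl
  ; occ-ext  = λ y → +-comm _ (occ c y)
  }
extend (a ∷ c) (suc j) b eq = record
  { size-ext = trans (cong (size₁ a +_) (size-ext (extend c j b eq))) (+-suc (size₁ a) (size c))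
  ; occ-ext  = λ y → trans (cong (occ₁ a y +_) (occ-ext (extend c j b eq) y)) (sym (+-assoc (occ₁ a y) _ _))
  }

match-extend : ∀ {q k} (c : Config q k) v j b → Match c v → lookup v j ≡ b → Match (c [ j ]≔ just b) v
match-extend (a ∷ c) (x ∷ v) zero    b (_ , m) refl = refl , m
match-extend (a ∷ c) (x ∷ v) (suc j) b (h , m) eq   = h , match-extend c v j b m eq

∅ : ∀ {q k} → Config q k
∅ = Vec.replicate _ nothing

size-∅ : ∀ {q} k → size (∅ {q} {k}) ≡ 0
size-∅ zero    = refl
size-∅ (suc k) = size-∅ k

occ-∅ : ∀ {q} k (y : Fin q) → occ (∅ {q} {k}) y ≡ 0
occ-∅ zero    y = refl
occ-∅ (suc k) y = occ-∅ k y

match-∅ : ∀ {q k} (v : Vec (Fin q) k) → Match ∅ v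
match-∅ []      = tt
match-∅ (x ∷ v) = tt , match-∅ v

^-distribʳ-* : ∀ a b n → (a * b) ^ n ≡ a ^ n * b ^ n
^-distribʳ-* a b zero    = refl
^-distribʳ-* a b (suc n) =
  trans (cong (a * b *_) (^-distribʳ-* a b n)) ([m*n]*[o*p]≡[m*o]*[n*p] a b (a ^ n) (b ^ n))

-- Prescribed values and forests in a random injection

module _ {q : ℕ} where

  -- Edges are listed from the newest to the oldest; the second endpoint of
  -- every edge is new.
  vertexList : List (Fin q × Fin q) → List (Fin q)
  vertexList []             = []
  vertexList ((x , y) ∷ Fs) = x ∷ y ∷ vertexList Fs

  Forest : List (Fin q × Fin q) → Set
  Forest []             = ⊤
  Forest ((x , y) ∷ Fs) = x ≢ y × y ∉ vertexList Fs × Forest Fs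

module _ {q k : ℕ} where

  total : Config q k → (Vec (Fin q) k → ℕ) → ℕ
  total c g = ∑[ v ∈ injections k q ] (𝟙 (match? c v) * g v)

  total-cong : ∀ c {g h} → (∀ v → g v ≡ h v) → total c g ≡ total c h
  total-cong c eq = ∑-cong (injections k q) λ v → cong (𝟙 (match? c v) *_) (eq v)

  total-∑ : ∀ {A : Set} c (xs : List A) (g : A → Vec (Fin q) k → ℕ) →
            total c (λ v → ∑[ x ∈ xs ] g x v) ≡ ∑[ x ∈ xs ] total c (g x)
  total-∑ c xs g = trans (∑-cong (injections k q) λ v → sym (∑-*ˡ xs (𝟙 (match? c v)) (λ x → g x v)))
    (∑-swap (injections k q) xs _)

  distinct-extend : ∀ {c c′ : Config q k} {j b} → Distinct c → occ c b ≡ 0 → Extends c j b c′ → Distinct c′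
  distinct-extend {c} {c′} {j} {b} dist b∉ ext y rewrite occ-ext ext y with b Fin.≟ y
  ... | yes refl = ≤-reflexive (cong (_+ 1) b∉)
  ... | no _     = ≤-trans (≤-reflexive (+-identityʳ _)) (dist y)

  -- Since `b` is prescribed nowhere, a position that is already prescribed cannot hold `b`; a free
  -- one can be added to the prescription.
  total-place : ∀ (c : Config q k) j b (g : Vec (Fin q) k → ℕ) s K → Distinct c → occ c b ≡ 0 →
    (∀ c′ → Extends c j b c′ → Distinct c′ → total c′ g * s ≤ K) →
    total c (λ v → 𝟙 (lookup v j Fin.≟ b) * g v) * s ≤ K
  total-place c j b g s K dist b∉ h with lookup c j in eq
  ... | just d = ≤-trans (≤-reflexive (cong (_* s) (∑≡0 (injections k q) λ v _ → zero-term v))) z≤n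
    where
    zero-term : ∀ v → 𝟙 (match? c v) * (𝟙 (lookup v j Fin.≟ b) * g v) ≡ 0
    zero-term v with match? c v
    ... | no _ = refl
    ... | yes m = trans (+-identityʳ _) (cong (_* g v) (𝟙-no (lookup v j Fin.≟ b) λ vj≡b →
            <⇒≢ (occ-lookup c j (trans eq (cong just (trans (sym (match-lookup c v j m eq)) vj≡b)))) (sym b∉)))
  ... | nothing = ≤-trans (*-monoˡ-≤ s (∑-mono (injections k q) term≤))
                          (h (c [ j ]≔ just b) (extend c j b eq) (distinct-extend {j = j} dist b∉ (extend c j b eq)))
    where
    term≤ : ∀ v → 𝟙 (match? c v) * (𝟙 (lookup v j Fin.≟ b) * g v) ≤ 𝟙 (match? (c [ j ]≔ just b) v) * g v
    term≤ v = ≤-trans (≤-reflexive (trans (sym (*-assoc (𝟙 (match? c v)) _ _))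
      (cong (_* g v) (sym (𝟙-× (match? c v) (lookup v j Fin.≟ b))))))
      (*-monoˡ-≤ (g v) (𝟙-mono (match? c v ×-dec (lookup v j Fin.≟ b)) (match? (c [ j ]≔ just b) v)
        λ (m , e) → match-extend c v j b m e))

  -- A task (J , b) asks for the value b at one of the positions in J.
  Task : Set
  Task = List (Fin k) × Fin q

  tasks : List Task → Vec (Fin q) k → ℕ
  tasks []            v = 1
  tasks ((J , b) ∷ L) v = (∑[ j ∈ J ] 𝟙 (lookup v j Fin.≟ b)) * tasks L v

  -- The product of sums is expanded one task at a time: each of the at most `ℓ` positions becomes
  -- one more prescribed entry, which `count-≤` finally prices at `8 / q`. Distinct values keep the
  -- prescription injective.
  total-tasks : ∀ ℓ L (c : Config q k) → Distinct c →
    List.Unique (map proj₂ L) → (∀ {b} → b ∈ map proj₂ L → occ c b ≡ 0) →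
    ListAll.All (λ l → length (proj₁ l) ≤ ℓ) L →
    total c (tasks L) * q ^ (size c + length L) ≤ 8 ^ (size c + length L) * (ℓ ^ length L * fall q k)
  total-tasks ℓ [] c dist _ _ _ rewrite +-identityʳ (size c) = begin
    total c (λ _ → 1) * q ^ size c   ≡⟨ cong (_* q ^ size c) (∑-cong (injections k q) λ v → *-identityʳ _) ⟩
    count c * q ^ size c             ≤⟨ count-≤ c dist ⟩
    8 ^ size c * fall q k            ≡⟨ cong (8 ^ size c *_) (sym (*-identityˡ _)) ⟩
    8 ^ size c * (1 * fall q k) ∎
    where open ≤-Reasoning
  total-tasks ℓ ((J , b) ∷ L) c dist (b∉L ∷ uniq) fresh (J≤ ∷ Js≤) = begin
    total c (tasks ((J , b) ∷ L)) * Q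
      ≡⟨ cong (_* Q) (trans (total-cong c λ v → sym (∑-*ʳ J (tasks L v) _)) (total-∑ c J _)) ⟩
    (∑[ j ∈ J ] total c (λ v → 𝟙 (lookup v j Fin.≟ b) * tasks L v)) * Q
      ≡⟨ ∑-*ʳ J Q _ ⟨
    ∑[ j ∈ J ] (total c (λ v → 𝟙 (lookup v j Fin.≟ b) * tasks L v) * Q)
      ≤⟨ ∑-≤-const J (λ j → total-place c j b (tasks L) Q K dist (fresh (here refl)) (step j)) ⟩
    length J * K
      ≤⟨ *-monoˡ-≤ K J≤ ⟩
    ℓ * K
      ≡⟨ reorder ℓ (8 ^ (size c + suc (length L))) (ℓ ^ length L) (fall q k) ⟩
    8 ^ (size c + suc (length L)) * (ℓ * ℓ ^ length L * fall q k) ∎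
    where
    open ≤-Reasoning
    Q K : ℕ
    Q = q ^ (size c + suc (length L))
    K = 8 ^ (size c + suc (length L)) * (ℓ ^ length L * fall q k)
    reorder : ∀ a b c d → a * (b * (c * d)) ≡ b * (a * c * d)
    reorder = solve-∀
    step : ∀ j c′ → Extends c j b c′ → Distinct c′ → total c′ (tasks L) * Q ≤ K
    step j c′ ext dist′ = subst
      (λ n → total c′ (tasks L) * q ^ n ≤ 8 ^ n * (ℓ ^ length L * fall q k))
      (trans (cong (_+ length L) (size-ext ext)) (sym (+-suc (size c) (length L))))
      (total-tasks ℓ L c′ dist′ uniq
        (λ {b′} b′∈ → trans (occ-ext ext b′) (cong₂ _+_ (fresh (there b′∈))
          (𝟙-no (b Fin.≟ b′) (ListAll.lookup b∉L b′∈))))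
        Js≤)

  tasks-bound : ∀ ℓ L → List.Unique (map proj₂ L) → ListAll.All (λ l → length (proj₁ l) ≤ ℓ) L →
    (∑[ v ∈ injections k q ] tasks L v) * q ^ length L ≤ (8 * ℓ) ^ length L * fall q k
  tasks-bound ℓ L uniq J≤ = begin
    (∑[ v ∈ injections k q ] tasks L v) * q ^ length L
      ≡⟨ cong₂ (λ x s → x * q ^ (s + length L)) (∑-cong (injections k q) λ v →
           sym (trans (cong (_* tasks L v) (𝟙-yes (match? (∅ {q} {k}) v) (match-∅ v))) (*-identityˡ _))) (sym (size-∅ {q} k)) ⟩
    total (∅ {q} {k}) (tasks L) * q ^ (size (∅ {q} {k}) + length L)
      ≤⟨ total-tasks ℓ L ∅ (λ y → ≤-trans (≤-reflexive (occ-∅ k y)) z≤n) uniq (λ {b} _ → occ-∅ k b) J≤ ⟩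
    8 ^ (size (∅ {q} {k}) + length L) * (ℓ ^ length L * fall q k)
      ≡⟨ trans (cong (λ s → 8 ^ (s + length L) * (ℓ ^ length L * fall q k)) (size-∅ {q} k))
           (trans (sym (*-assoc (8 ^ length L) _ _)) (cong (_* fall q k) (sym (^-distribʳ-* 8 ℓ (length L))))) ⟩
    (8 * ℓ) ^ length L * fall q k ∎
    where
    open ≤-Reasoning

  module _ (near : Fin k → List (Fin k)) (ℓ : ℕ) (near≤ℓ : ∀ i → length (near i) ≤ ℓ) where

    adjacent : Fin q → Fin q → Vec (Fin q) k → ℕ
    adjacent x y v = ∑[ i ∈ allFin k ] (𝟙 (lookup v i Fin.≟ x) * (∑[ j ∈ near i ] 𝟙 (lookup v j Fin.≟ y)))

    forestWeight : List (Fin q × Fin q) → Vec (Fin q) k → ℕ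
    forestWeight []             v = 1
    forestWeight ((x , y) ∷ Fs) v = forestWeight Fs v * adjacent x y v

    private
      -- In terms of densities: prescribing `c` costs `(8 / k) ^ size c`, and `K / s` collects the
      -- price of the edges in `g`, which are not yet turned into prescribed entries.
      Bound : (Vec (Fin q) k → ℕ) → ℕ → ℕ → Config q k → Set
      Bound g s K c = total c g * (k ^ size c * s) ≤ 8 ^ size c * K

      ℓ-fold : ∀ c y g s K → Distinct c → occ c y ≡ 0 → ∀ i0 →
        (∀ c′ → size c′ ≡ suc (size c) → Distinct c′ → (∀ z → occ c′ z ≡ occ c z + 𝟙 (y Fin.≟ z)) → Bound g s K c′) →
        total c (λ v → (∑[ j ∈ near i0 ] 𝟙 (lookup v j Fin.≟ y)) * g v) * (k ^ suc (size c) * s)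
        ≤ ℓ * (8 ^ suc (size c) * K)
      ℓ-fold c y g s K dist y∉ i0 h = begin
        total c (λ v → (∑[ j ∈ near i0 ] 𝟙 (lookup v j Fin.≟ y)) * g v) * S
          ≡⟨ cong (_* S) (trans (total-cong c λ v → sym (∑-*ʳ (near i0) (g v) _)) (total-∑ c (near i0) _)) ⟩
        (∑[ j ∈ near i0 ] total c (λ v → 𝟙 (lookup v j Fin.≟ y) * g v)) * S
          ≡⟨ ∑-*ʳ (near i0) S _ ⟨
        ∑[ j ∈ near i0 ] (total c (λ v → 𝟙 (lookup v j Fin.≟ y) * g v) * S)
          ≤⟨ ∑-≤-const (near i0) (λ j → total-place c j y g S K′ dist y∉ λ c′ ext dist′ →
               subst (λ n → total c′ g * (k ^ n * s) ≤ 8 ^ n * K) (size-ext ext)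
                 (h c′ (size-ext ext) dist′ (occ-ext ext))) ⟩
        length (near i0) * K′
          ≤⟨ *-monoˡ-≤ K′ (near≤ℓ i0) ⟩
        ℓ * K′ ∎
        where
        open ≤-Reasoning
        S K′ : ℕ
        S  = k ^ suc (size c) * s
        K′ = 8 ^ suc (size c) * K

      -- The position of `x` is known, so `y` has at most `ℓ` places, and only one new entry is
      -- prescribed, at price `8 / k`.
      tied : ∀ c x y g s K → Distinct c → occ c y ≡ 0 → ∀ i0 → lookup c i0 ≡ just x →
        (∀ c′ → size c′ ≡ suc (size c) → Distinct c′ → (∀ z → occ c′ z ≡ occ c z + 𝟙 (y Fin.≟ z)) → Bound g s K c′) →
        Bound (λ v → adjacent x y v * g v) (s * k) (64 * ℓ * K) c
      tied c x y g s K dist y∉ i0 eq h = begin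
        total c (λ v → adjacent x y v * g v) * (k ^ size c * (s * k))
          ≡⟨ cong (total c (λ v → adjacent x y v * g v) *_) (reorder (k ^ size c) s k) ⟩
        total c (λ v → adjacent x y v * g v) * (k ^ suc (size c) * s)
          ≤⟨ *-monoˡ-≤ (k ^ suc (size c) * s) (∑-mono-∈ (injections k q) λ v v∈ →
               𝟙-*-≤ (match? c v) λ m → *-monoˡ-≤ (g v) (adjacent≤ v v∈ (match-lookup c v i0 m eq))) ⟩
        total c (λ v → (∑[ j ∈ near i0 ] 𝟙 (lookup v j Fin.≟ y)) * g v) * (k ^ suc (size c) * s)
          ≤⟨ ℓ-fold c y g s K dist y∉ i0 h ⟩
        ℓ * (8 ^ suc (size c) * K)
          -- The factor 8 given away makes this edge as expensive as one in `free`.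
          ≤⟨ m≤m+n _ (7 * (ℓ * (8 ^ suc (size c) * K))) ⟩
        8 * (ℓ * (8 * 8 ^ size c * K))
          ≡⟨ reorder₂ ℓ (8 ^ size c) K ⟩
        8 ^ size c * (64 * ℓ * K) ∎
        where
        open ≤-Reasoning
        reorder : ∀ a s n → a * (s * n) ≡ n * a * s
        reorder = solve-∀
        reorder₂ : ∀ l e K → 8 * (l * (8 * e * K)) ≡ e * (64 * l * K)
        reorder₂ = solve-∀
        adjacent≤ : ∀ v → v ∈ injections k q → lookup v i0 ≡ x →
                    adjacent x y v ≤ ∑[ j ∈ near i0 ] 𝟙 (lookup v j Fin.≟ y)
        adjacent≤ v v∈ refl = begin
          adjacent x y v
            ≤⟨ ∑-mono (allFin k) (λ i → pointwise i) ⟩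
          ∑[ i ∈ allFin k ] (𝟙 (i0 Fin.≟ i) * T)
            ≡⟨ trans (∑-*ʳ (allFin k) T _) (cong (_* T) (∑-allFin-𝟙 i0)) ⟩
          1 * T
            ≡⟨ *-identityˡ T ⟩
          T ∎
          where
          T : ℕ
          T = ∑[ j ∈ near i0 ] 𝟙 (lookup v j Fin.≟ y)
          pointwise : ∀ i → 𝟙 (lookup v i Fin.≟ lookup v i0) * (∑[ j ∈ near i ] 𝟙 (lookup v j Fin.≟ y))
                          ≤ 𝟙 (i0 Fin.≟ i) * T
          pointwise i with lookup v i Fin.≟ lookup v i0
          ... | no _ = z≤n
          ... | yes e with Unique.lookup-injective (injections-unique k q v∈) i i0 e
          ...   | refl = ≤-reflexive (cong (_* T) (sym (𝟙-yes (i0 Fin.≟ i0) refl)))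

      -- Both ends are new: there are `k` places for `x`, `ℓ` for `y`, and two entries at price
      -- `8 / k`, so one factor `1 / k` survives.
      free : ∀ c x y g s K → {{_ : NonZero k}} → Distinct c → occ c x ≡ 0 → occ c y ≡ 0 → x ≢ y →
        (∀ c′ → size c′ ≡ suc (suc (size c)) → Distinct c′ →
           (∀ z → occ c′ z ≡ occ c z + 𝟙 (x Fin.≟ z) + 𝟙 (y Fin.≟ z)) → Bound g s K c′) →
        Bound (λ v → adjacent x y v * g v) (s * k) (64 * ℓ * K) c
      free c x y g s K dist x∉ y∉ x≢y h = *-cancelˡ-≤ k (begin
        k * (total c (λ v → adjacent x y v * g v) * (k ^ size c * (s * k)))
          ≡⟨ reorder k (total c (λ v → adjacent x y v * g v)) (k ^ size c) s ⟩
        total c (λ v → adjacent x y v * g v) * S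
          ≡⟨ cong (_* S) (trans (total-cong c λ v → trans (sym (∑-*ʳ (allFin k) (g v) _))
               (∑-cong (allFin k) λ i → *-assoc (𝟙 (lookup v i Fin.≟ x)) _ (g v))) (total-∑ c (allFin k) _)) ⟩
        (∑[ i ∈ allFin k ] total c (λ v → 𝟙 (lookup v i Fin.≟ x) * (near-y i v * g v))) * S
          ≡⟨ ∑-*ʳ (allFin k) S _ ⟨
        ∑[ i ∈ allFin k ] (total c (λ v → 𝟙 (lookup v i Fin.≟ x) * (near-y i v * g v)) * S)
          ≤⟨ ∑-≤-const (allFin k) (λ i → total-place c i x (λ v → near-y i v * g v) S K′ dist x∉ λ c′ ext dist′ →
               subst (λ n → total c′ (λ v → near-y i v * g v) * (k ^ suc n * s) ≤ ℓ * (8 ^ suc n * K)) (size-ext ext)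
                 (ℓ-fold c′ y g s K dist′
                   (trans (occ-ext ext y) (cong₂ _+_ y∉ (𝟙-no (x Fin.≟ y) x≢y))) i
                   λ c″ sz″ dist″ occ″ → h c″ (trans sz″ (cong suc (size-ext ext))) dist″
                     λ z → trans (occ″ z) (cong (_+ 𝟙 (y Fin.≟ z)) (occ-ext ext z)))) ⟩
        length (allFin k) * K′
          ≡⟨ cong (_* K′) (length-allFin k) ⟩
        k * K′
          ≡⟨ cong (k *_) (reorder₂ ℓ (8 ^ size c) K) ⟩
        k * (8 ^ size c * (64 * ℓ * K)) ∎)
        where
        open ≤-Reasoning
        near-y : Fin k → Vec (Fin q) k → ℕ
        near-y i v = ∑[ j ∈ near i ] 𝟙 (lookup v j Fin.≟ y)
        S K′ : ℕ
        S  = k ^ suc (suc (size c)) * s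
        K′ = ℓ * (8 ^ suc (suc (size c)) * K)
        reorder : ∀ n t a s → n * (t * (a * (s * n))) ≡ t * (n * (n * a) * s)
        reorder = solve-∀
        reorder₂ : ∀ l e K → l * (8 * (8 * e) * K) ≡ e * (64 * l * K)
        reorder₂ = solve-∀

      UsedIn : Config q k → List (Fin q) → Set
      UsedIn c xs = ∀ z → occ c z ≢ 0 → z ∈ xs

    -- The newest edge is moved into `g` and waits until the older edges are placed. Hence `h`
    -- ranges over all prescriptions that these can produce; as they use only vertices of `Fs`, the
    -- second endpoint `y` of the newest edge is still free.
    forest-step : {{_ : NonZero k}} → ∀ Fs → Forest Fs → ∀ g s K →
      (∀ c → Distinct c → UsedIn c (vertexList Fs) → Bound g s K c) →
      total ∅ (λ v → forestWeight Fs v * g v) * (k ^ length Fs * s) ≤ (64 * ℓ) ^ length Fs * K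
    forest-step [] _ g s K h = begin
      total ∅ (λ v → 1 * g v) * (1 * s)
        ≡⟨ cong (_* (1 * s)) (total-cong ∅ λ v → *-identityˡ (g v)) ⟩
      total ∅ g * (1 * s)
        ≡⟨ cong (λ n → total ∅ g * (k ^ n * s)) (size-∅ {q} k) ⟨
      total ∅ g * (k ^ size (∅ {q} {k}) * s)
        ≤⟨ h ∅ (λ y → ≤-trans (≤-reflexive (occ-∅ k y)) z≤n) (λ z occ≢0 → ⊥-elim (occ≢0 (occ-∅ k z))) ⟩
      8 ^ size (∅ {q} {k}) * K
        ≡⟨ cong (λ n → 8 ^ n * K) (size-∅ {q} k) ⟩
      1 * K ∎
      where open ≤-Reasoning
    forest-step ((x , y) ∷ Fs) (x≢y , y∉Fs , forest) g s K h = begin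
      total ∅ (λ v → forestWeight Fs v * adjacent x y v * g v) * (k ^ suc (length Fs) * s)
        ≡⟨ cong₂ _*_ (total-cong ∅ λ v → *-assoc (forestWeight Fs v) (adjacent x y v) (g v))
             (reorder k (k ^ length Fs) s) ⟩
      total ∅ (λ v → forestWeight Fs v * (adjacent x y v * g v)) * (k ^ length Fs * (s * k))
        ≤⟨ forest-step Fs forest (λ v → adjacent x y v * g v) (s * k) (64 * ℓ * K) step ⟩
      (64 * ℓ) ^ length Fs * (64 * ℓ * K)
        ≡⟨ reorder₂ (64 * ℓ) ((64 * ℓ) ^ length Fs) K ⟩
      (64 * ℓ) ^ suc (length Fs) * K ∎
      where
      open ≤-Reasoning
      reorder : ∀ n a s → n * a * s ≡ a * (s * n)
      reorder = solve-∀
      reorder₂ : ∀ l a K → a * (l * K) ≡ l * a * K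
      reorder₂ = solve-∀
      step : ∀ c → Distinct c → UsedIn c (vertexList Fs) → Bound (λ v → adjacent x y v * g v) (s * k) (64 * ℓ * K) c
      step c dist used = by-x (occ c x ≟ 0)
        where
        y∉ : occ c y ≡ 0
        y∉ with occ c y ≟ 0
        ... | yes eq  = eq
        ... | no occ≢0 = ⊥-elim (y∉Fs (used y occ≢0))
        by-x : Dec (occ c x ≡ 0) → Bound (λ v → adjacent x y v * g v) (s * k) (64 * ℓ * K) c
        by-x (yes x∉) = free c x y g s K dist x∉ y∉ x≢y λ c′ _ dist′ occ′ → h c′ dist′ (used′ {c′} occ′)
          where
          used′ : ∀ {c′} → (∀ z → occ c′ z ≡ occ c z + 𝟙 (x Fin.≟ z) + 𝟙 (y Fin.≟ z)) →
                  UsedIn c′ (vertexList ((x , y) ∷ Fs))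
          used′ occ′ z occ≢0 with x Fin.≟ z | y Fin.≟ z | occ′ z
          ... | yes refl | _ | _ = here refl
          ... | no _ | yes refl | _ = there (here refl)
          ... | no _ | no _ | e = there (there (used z λ occ≡0 →
            occ≢0 (trans e (trans (+-identityʳ _) (trans (+-identityʳ _) occ≡0)))))
        by-x (no x∈) with lookup-occ c x x∈
        ... | i0 , eq = tied c x y g s K dist y∉ i0 eq λ c′ _ dist′ occ′ → h c′ dist′ (used′ {c′} occ′)
          where
          used′ : ∀ {c′} → (∀ z → occ c′ z ≡ occ c z + 𝟙 (y Fin.≟ z)) →
                  UsedIn c′ (vertexList ((x , y) ∷ Fs))
          used′ occ′ z occ≢0 with y Fin.≟ z | occ′ z
          ... | yes refl | _ = there (here refl)
          ... | no _ | e = there (there (used z λ occ≡0 → occ≢0 (trans e (trans (+-identityʳ _) occ≡0))))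

  forest-bound : ∀ near ℓ near≤ℓ → q ≡ k → {{_ : NonZero k}} → ∀ Fs → Forest Fs →
    (∑[ v ∈ injections k q ] forestWeight near ℓ near≤ℓ Fs v) * k ^ length Fs
    ≤ (64 * ℓ) ^ length Fs * fall q k
  forest-bound near ℓ near≤ℓ refl Fs forest = begin
    (∑[ v ∈ injections k k ] fw v) * k ^ length Fs
      ≡⟨ cong₂ _*_ (∑-cong (injections k k) λ v → sym (trans (cong (_* (fw v * 1)) (𝟙-yes (match? ∅ v) (match-∅ v)))
           (trans (*-identityˡ _) (*-identityʳ _)))) (sym (*-identityʳ _)) ⟩
    total ∅ (λ v → fw v * 1) * (k ^ length Fs * 1)
      ≤⟨ forest-step near ℓ near≤ℓ Fs forest (λ _ → 1) 1 (fall k k) (λ c dist _ → begin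
           total c (λ _ → 1) * (k ^ size c * 1)
             ≡⟨ cong₂ _*_ (∑-cong (injections k k) λ v → *-identityʳ _) (*-identityʳ _) ⟩
           count c * k ^ size c
             ≤⟨ count-≤ c dist ⟩
           8 ^ size c * fall k k ∎) ⟩
    (64 * ℓ) ^ length Fs * fall k k ∎
    where
    open ≤-Reasoning
    fw : Vec (Fin k) k → ℕ
    fw = forestWeight near ℓ near≤ℓ Fs

-- Copies of the r-th power of a cycle

module Cyclic (n : ℕ) {{_ : NonZero n}} where

  pos : ℕ → Fin n
  pos i = fromℕ< (m%n<n i n)

  toℕ-pos : ∀ i → toℕ (pos i) ≡ i % n
  toℕ-pos i = Fin.toℕ-fromℕ< (m%n<n i n)

  pos-cong : ∀ {i j} → i % n ≡ j % n → pos i ≡ pos j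
  pos-cong {i} {j} eq = Fin.toℕ-injective (trans (toℕ-pos i) (trans eq (sym (toℕ-pos j))))

  pos-toℕ : ∀ i → pos (toℕ i) ≡ i
  pos-toℕ i = Fin.toℕ-injective (trans (toℕ-pos (toℕ i)) (m<n⇒m%n≡m (Fin.toℕ<n i)))

  pos-+ : ∀ i k → pos (toℕ (pos i) + k) ≡ pos (i + k)
  pos-+ i k = pos-cong (trans (cong (λ z → (z + k) % n) (toℕ-pos i)) (begin
    (i % n + k) % n           ≡⟨ %-distribˡ-+ (i % n) k n ⟩
    (i % n % n + k % n) % n   ≡⟨ cong (λ z → (z + k % n) % n) (m%n%n≡m%n i n) ⟩
    (i % n + k % n) % n       ≡⟨ %-distribˡ-+ i k n ⟨
    (i + k) % n ∎))
    where open ≡-Reasoning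

  pos-+n : ∀ i → pos (i + n) ≡ pos i
  pos-+n i = pos-cong ([m+n]%n≡m%n i n)

  pos-injective : ∀ {i j} → i < n → j < n → pos i ≡ pos j → i ≡ j
  pos-injective {i} {j} i<n j<n eq = trans (sym (m<n⇒m%n≡m i<n))
    (trans (trans (sym (toℕ-pos i)) (trans (cong toℕ eq) (toℕ-pos j))) (m<n⇒m%n≡m j<n))

-- In the r-th power of a cycle on n positions, the edge between position i
-- and position i - 1 - d (mod n) is called the slot (i , d).
module Template (n r q : ℕ) {{_ : NonZero n}} (r≤n : r ≤ n) where

  open Cyclic n public

  back ahead : Fin n → Fin r → Fin n
  back  i d = pos (toℕ i + (n ∸ suc (toℕ d)))
  ahead i d = pos (toℕ i + suc (toℕ d))

  suc-d≤n : (d : Fin r) → suc (toℕ d) ≤ n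
  suc-d≤n d = ≤-trans (Fin.toℕ<n d) r≤n

  ahead-back : ∀ i d → ahead (back i d) d ≡ i
  ahead-back i d = trans (pos-+ (toℕ i + (n ∸ suc (toℕ d))) (suc (toℕ d)))
    (trans (cong pos (trans (+-assoc (toℕ i) _ _) (cong (toℕ i +_) (m∸n+n≡m (suc-d≤n d)))))
      (trans (pos-+n (toℕ i)) (pos-toℕ i)))

  back-ahead : ∀ i d → back (ahead i d) d ≡ i
  back-ahead i d = trans (pos-+ (toℕ i + suc (toℕ d)) (n ∸ suc (toℕ d)))
    (trans (cong pos (trans (+-assoc (toℕ i) _ _) (cong (toℕ i +_) (m+[n∸m]≡n (suc-d≤n d)))))
      (trans (pos-+n (toℕ i)) (pos-toℕ i)))

  near : Fin n → List (Fin n)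
  near i = map (back i) (allFin r) ++ map (ahead i) (allFin r)

  near-length : ∀ i → length (near i) ≤ r + r
  near-length i = ≤-reflexive (trans (length-++ (map (back i) (allFin r)))
    (cong₂ _+_ (trans (length-map (back i) (allFin r)) (length-allFin r))
               (trans (length-map (ahead i) (allFin r)) (length-allFin r))))

  Arrangement : Set
  Arrangement = Vec (Fin n) n

  Colouring : Set
  Colouring = Vec (Fin q) (n * r)

  Joins : Arrangement → Fin n → Fin r → Fin n → Fin n → Set
  Joins σ i d u v = (lookup σ i ≡ u × lookup σ (back i d) ≡ v) ⊎ (lookup σ i ≡ v × lookup σ (back i d) ≡ u)

  joins? : ∀ σ i d u v → Dec (Joins σ i d u v)
  joins? σ i d u v = ((lookup σ i Fin.≟ u) ×-dec (lookup σ (back i d) Fin.≟ v))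
              ⊎-dec ((lookup σ i Fin.≟ v) ×-dec (lookup σ (back i d) Fin.≟ u))

  Copy : Set
  Copy = Arrangement × Colouring

  Item : Set
  Item = Fin n × Fin n × Fin q

  colour : Item → Fin q
  colour (_ , _ , c) = c

  Has : Copy → Item → Set
  Has (σ , π) (u , v , c) = ∃[ i ] ∃[ d ] Joins σ i d u v × lookup π (combine i d) ≡ c

  has? : ∀ B l → Dec (Has B l)
  has? (σ , π) (u , v , c) = Fin.any? λ i → Fin.any? λ d → joins? σ i d u v ×-dec (lookup π (combine i d) Fin.≟ c)

  Linked : Arrangement → Fin n × Fin n → Set
  Linked σ (u , v) = ∃[ i ] ∃[ d ] Joins σ i d u v

  copies : List Copy
  copies = concatMap (λ σ → map (σ ,_) (injections (n * r) q)) (injections n n)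

  ∑-copies : ∀ f → ∑ copies f ≡ ∑[ σ ∈ injections n n ] ∑[ π ∈ injections (n * r) q ] f (σ , π)
  ∑-copies f = trans (∑-concatMap _ (injections n n) f)
    (∑-cong (injections n n) λ σ → ∑-map (σ ,_) (injections (n * r) q) f)

  I : ℕ
  I = fall n n * fall q (n * r)

  ∑-copies-1 : ∑ copies (λ _ → 1) ≡ I
  ∑-copies-1 = trans (∑-copies _) (trans (∑-cong (injections n n) λ _ → ∑-injections-1 (n * r) q)
    (trans (∑-cong (injections n n) λ _ → sym (*-identityˡ (fall q (n * r))))
      (trans (∑-*ʳ (injections n n) (fall q (n * r)) _)
        (cong (_* fall q (n * r)) (∑-injections-1 n n)))))

  Sat : List Item → Copy → Set
  Sat L B = ListAll.All (Has B) L

  sat? : ∀ L B → Dec (Sat L B)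
  sat? L B = ListAll.all? (has? B) L

  slotsAt : ∀ {σ : Arrangement} {u} → Dec (∃[ i ] lookup σ i ≡ u) → List (Fin (n * r))
  slotsAt (yes (i , _)) = map (combine i) (allFin r)
  slotsAt (no _)        = []

  -- With `σ` fixed, an edge `uv` can only sit in one of the `2 * r` slots that start at the
  -- position of `u` or of `v`, and its colour must be found there.
  candidates : Arrangement → Item → List (Fin (n * r))
  candidates σ (u , v , c) = slotsAt {σ} (Fin.any? λ i → lookup σ i Fin.≟ u) ++ slotsAt {σ} (Fin.any? λ i → lookup σ i Fin.≟ v)

  candidates-length : ∀ σ l → length (candidates σ l) ≤ r + r
  candidates-length σ (u , v , c) = ≤-trans (≤-reflexive (length-++ (slotsAt {σ} (u∈?))))
    (+-mono-≤ (slotsAt-length u∈?) (slotsAt-length (Fin.any? λ i → lookup σ i Fin.≟ v)))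
    where
    u∈? : Dec (∃[ i ] lookup σ i ≡ u)
    u∈? = Fin.any? λ i → lookup σ i Fin.≟ u
    slotsAt-length : ∀ {u} (d : Dec (∃[ i ] lookup σ i ≡ u)) → length (slotsAt {σ} d) ≤ r
    slotsAt-length (yes (i , _)) = ≤-reflexive (trans (length-map (combine i) (allFin r)) (length-allFin r))
    slotsAt-length (no _) = z≤n

  slotsAt-∈ : ∀ {σ} → σ ∈ injections n n → ∀ {u} (u? : Dec (∃[ i ] lookup σ i ≡ u)) i d →
              lookup σ i ≡ u → combine i d ∈ slotsAt {σ} u?
  slotsAt-∈ σ∈ (no ¬u)          i d eq = ⊥-elim (¬u (i , eq))
  slotsAt-∈ σ∈ (yes (j , refl)) i d eq with Unique.lookup-injective (injections-unique n n σ∈) i j eq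
  ... | refl = ∈-map⁺ (combine i) (∈-allFin d)

  has-candidate : ∀ {σ} → σ ∈ injections n n → ∀ π l → Has (σ , π) l →
                  1 ≤ ∑[ j ∈ candidates σ l ] 𝟙 (lookup π j Fin.≟ colour l)
  has-candidate {σ} σ∈ π l@(u , v , c) (i , d , joins , eq) =
    ≤-trans (≤-reflexive (sym (𝟙-yes (lookup π (combine i d) Fin.≟ c) eq)))
      (≤-∑ (λ j → 𝟙 (lookup π j Fin.≟ c)) (∈-candidates joins))
    where
    ∈-candidates : Joins σ i d u v → combine i d ∈ candidates σ l
    ∈-candidates (inj₁ (eq , _)) = ∈-++⁺ˡ (slotsAt-∈ σ∈ (Fin.any? λ i → lookup σ i Fin.≟ u) i d eq)
    ∈-candidates (inj₂ (eq , _)) = ∈-++⁺ʳ (slotsAt {σ} (Fin.any? λ i → lookup σ i Fin.≟ u)) (slotsAt-∈ σ∈ (Fin.any? λ i → lookup σ i Fin.≟ v) i d eq)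

  linked-adjacent : ∀ σ u v → Linked σ (u , v) → 1 ≤ adjacent near (r + r) near-length u v σ
  linked-adjacent σ u v (i , d , inj₁ (refl , refl)) = ≤-trans (*-mono-≤
      (≤-reflexive (sym (𝟙-yes (lookup σ i Fin.≟ lookup σ i) refl)))
      (≤-trans (≤-reflexive (sym (𝟙-yes (lookup σ (back i d) Fin.≟ lookup σ (back i d)) refl)))
        (≤-∑ (λ j → 𝟙 (lookup σ j Fin.≟ lookup σ (back i d))) (∈-++⁺ˡ (∈-map⁺ (back i) (∈-allFin d))))))
    (≤-∑ (λ i′ → 𝟙 (lookup σ i′ Fin.≟ lookup σ i) * (∑[ j ∈ near i′ ] 𝟙 (lookup σ j Fin.≟ lookup σ (back i d)))) (∈-allFin i))
  linked-adjacent σ u v (i , d , inj₂ (refl , refl)) = ≤-trans (*-mono-≤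
      (≤-reflexive (sym (𝟙-yes (lookup σ (back i d) Fin.≟ lookup σ (back i d)) refl)))
      (≤-trans (≤-reflexive (sym (𝟙-yes (lookup σ i Fin.≟ lookup σ i) refl)))
        (≤-∑ (λ j → 𝟙 (lookup σ j Fin.≟ lookup σ i)) (∈-++⁺ʳ (map (back (back i d)) (allFin r))
          (subst (λ z → z ∈ map (ahead (back i d)) (allFin r)) (ahead-back i d) (∈-map⁺ (ahead (back i d)) (∈-allFin d)))))))
    (≤-∑ (λ i′ → 𝟙 (lookup σ i′ Fin.≟ lookup σ (back i d)) * (∑[ j ∈ near i′ ] 𝟙 (lookup σ j Fin.≟ lookup σ i))) (∈-allFin (back i d)))

  C₁ C₂ : ℕ
  C₁ = 64 * (r + r)
  C₂ = 8 * (r + r)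

  -- `σ` and `π` are chosen independently, so the two prices multiply. Every edge of `L` pays for
  -- its colour, but only the edges of `Fs` pay for their place, since each vertex can be charged
  -- for its position only once.
  spread : ∀ L Fs → List.Unique (map colour L) → Forest Fs →
           (∀ B → Sat L B → ListAll.All (Linked (proj₁ B)) Fs) →
           (∑[ B ∈ copies ] 𝟙 (sat? L B)) * (q ^ length L * n ^ length Fs) ≤ I * (C₂ ^ length L * C₁ ^ length Fs)
  spread L Fs uniq forest linked = begin
    (∑[ B ∈ copies ] 𝟙 (sat? L B)) * (q ^ length L * n ^ length Fs)
      ≡⟨ cong (_* (q ^ length L * n ^ length Fs)) (∑-copies _) ⟩
    (∑[ σ ∈ injections n n ] ∑[ π ∈ injections (n * r) q ] 𝟙 (sat? L (σ , π))) * (q ^ length L * n ^ length Fs)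
      ≤⟨ *-monoˡ-≤ _ (∑-mono-∈ (injections n n) λ σ σ∈ → ∑-mono (injections (n * r) q) λ π → pointwise σ σ∈ π) ⟩
    (∑[ σ ∈ injections n n ] ∑[ π ∈ injections (n * r) q ] (fw σ * tasks (tl σ) π)) * (q ^ length L * n ^ length Fs)
      ≡⟨ cong (_* (q ^ length L * n ^ length Fs)) (∑-cong (injections n n) λ σ → ∑-*ˡ (injections (n * r) q) (fw σ) _) ⟩
    (∑[ σ ∈ injections n n ] (fw σ * T σ)) * (q ^ length L * n ^ length Fs)
      ≡⟨ *-assoc (∑[ σ ∈ injections n n ] (fw σ * T σ)) (q ^ length L) (n ^ length Fs) ⟨
    (∑[ σ ∈ injections n n ] (fw σ * T σ)) * q ^ length L * n ^ length Fs
      ≡⟨ cong (_* n ^ length Fs) (∑-*ʳ (injections n n) (q ^ length L) _) ⟨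
    (∑[ σ ∈ injections n n ] (fw σ * T σ * q ^ length L)) * n ^ length Fs
      ≤⟨ *-monoˡ-≤ (n ^ length Fs) (∑-mono (injections n n) λ σ →
           ≤-trans (≤-reflexive (*-assoc (fw σ) (T σ) (q ^ length L))) (*-monoʳ-≤ (fw σ) (T≤ σ))) ⟩
    (∑[ σ ∈ injections n n ] (fw σ * (C₂ ^ length L * fall q (n * r)))) * n ^ length Fs
      ≡⟨ cong (_* n ^ length Fs) (∑-*ʳ (injections n n) (C₂ ^ length L * fall q (n * r)) fw) ⟩
    ∑ (injections n n) fw * (C₂ ^ length L * fall q (n * r)) * n ^ length Fs
      ≡⟨ reorder (∑ (injections n n) fw) (C₂ ^ length L * fall q (n * r)) (n ^ length Fs) ⟩
    ∑ (injections n n) fw * n ^ length Fs * (C₂ ^ length L * fall q (n * r))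
      ≤⟨ *-monoˡ-≤ (C₂ ^ length L * fall q (n * r)) (forest-bound near (r + r) near-length refl Fs forest) ⟩
    C₁ ^ length Fs * fall n n * (C₂ ^ length L * fall q (n * r))
      ≡⟨ reorder₂ (C₁ ^ length Fs) (fall n n) (C₂ ^ length L) (fall q (n * r)) ⟩
    I * (C₂ ^ length L * C₁ ^ length Fs) ∎
    where
    open ≤-Reasoning
    reorder : ∀ a b c → a * b * c ≡ a * c * b
    reorder = solve-∀
    reorder₂ : ∀ a b c d → a * b * (c * d) ≡ b * d * (c * a)
    reorder₂ = solve-∀
    fw : Arrangement → ℕ
    fw = forestWeight near (r + r) near-length Fs
    tasksOf : Arrangement → List Item → List (Task {q} {n * r})
    tasksOf σ = map (λ l → candidates σ l , colour l)
    tl : Arrangement → List (Task {q} {n * r})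
    tl σ = tasksOf σ L
    T : Arrangement → ℕ
    T σ = ∑ (injections (n * r) q) (tasks (tl σ))
    colours-tl : ∀ σ L → map proj₂ (tasksOf σ L) ≡ map colour L
    colours-tl σ []      = refl
    colours-tl σ (l ∷ L) = cong (colour l ∷_) (colours-tl σ L)
    short : ∀ σ L → ListAll.All (λ l → length (proj₁ l) ≤ r + r) (tasksOf σ L)
    short σ []      = []
    short σ (l ∷ L) = candidates-length σ l ∷ short σ L
    T≤ : ∀ σ → T σ * q ^ length L ≤ C₂ ^ length L * fall q (n * r)
    T≤ σ = subst (λ m → T σ * q ^ m ≤ C₂ ^ m * fall q (n * r)) (length-map _ L)
      (tasks-bound (r + r) (tl σ) (subst List.Unique (sym (colours-tl σ L)) uniq) (short σ L))
    forest≥1 : ∀ σ Fs → ListAll.All (Linked σ) Fs → 1 ≤ forestWeight near (r + r) near-length Fs σ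
    forest≥1 σ [] [] = s≤s z≤n
    forest≥1 σ ((u , v) ∷ Fs) (l ∷ ls) = *-mono-≤ (forest≥1 σ Fs ls) (linked-adjacent σ u v l)
    tasks≥1 : ∀ σ → σ ∈ injections n n → ∀ π L → Sat L (σ , π) → 1 ≤ tasks (tasksOf σ L) π
    tasks≥1 σ σ∈ π [] [] = s≤s z≤n
    tasks≥1 σ σ∈ π (l ∷ L) (h ∷ hs) = *-mono-≤ (has-candidate σ∈ π l h) (tasks≥1 σ σ∈ π L hs)
    pointwise : ∀ σ → σ ∈ injections n n → ∀ π → 𝟙 (sat? L (σ , π)) ≤ fw σ * tasks (tl σ) π
    pointwise σ σ∈ π with sat? L (σ , π)
    ... | no _  = z≤n
    ... | yes s = *-mono-≤ (forest≥1 σ Fs (linked (σ , π) s)) (tasks≥1 σ σ∈ π L s)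

-- Exploring a copy position by position

sublists⁺ : {A : Set} → List A → List (List A)
sublists⁺ []       = []
sublists⁺ (d ∷ ds) = (d ∷ []) ∷ (map (d ∷_) (sublists⁺ ds) ++ sublists⁺ ds)

module _ {A : Set} where

  record Sublist (b ds : List A) : Set where
    field
      sub-length : length b ≤ length ds
      sub-∈      : ∀ {d} → d ∈ b → d ∈ ds
      sub-unique : List.Unique ds → List.Unique b

  open Sublist public

  sublists⁺-sub : ∀ ds {b : List A} → b ∈ sublists⁺ ds → Sublist b ds
  sublists⁺-sub (d ∷ ds) (here refl) = record
    { sub-length = s≤s z≤n ; sub-∈ = λ { (here e) → here e } ; sub-unique = λ _ → [] ∷ [] }
  sublists⁺-sub (d ∷ ds) (there b∈) with ∈-++⁻ (map (d ∷_) (sublists⁺ ds)) b∈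
  ... | inj₂ b∈ds = record
    { sub-length = m≤n⇒m≤1+n (sub-length IH)
    ; sub-∈      = λ d∈ → there (sub-∈ IH d∈)
    ; sub-unique = λ { (_ ∷ u) → sub-unique IH u }
    }
    where
    IH = sublists⁺-sub ds b∈ds
  ... | inj₁ b∈map with ∈-map⁻ (d ∷_) b∈map
  ...   | b′ , b′∈ , refl = record
    { sub-length = s≤s (sub-length IH)
    ; sub-∈      = λ { (here e) → here e ; (there d∈) → there (sub-∈ IH d∈) }
    ; sub-unique = λ { (d∉ ∷ u) → ListAll.tabulate (λ e∈ → ListAll.lookup d∉ (sub-∈ IH e∈)) ∷ sub-unique IH u }
    }
    where
    IH = sublists⁺-sub ds b′∈

  sublists⁺-nonempty : ∀ ds → [] ∉ sublists⁺ {A} ds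
  sublists⁺-nonempty (d ∷ ds) (there b∈) with ∈-++⁻ (map (d ∷_) (sublists⁺ ds)) b∈
  ... | inj₂ b∈ds = sublists⁺-nonempty ds b∈ds
  ... | inj₁ b∈map with ∈-map⁻ (d ∷_) b∈map
  ...   | _ , _ , ()

  ∏₁₊ : (A → ℕ) → List A → ℕ
  ∏₁₊ f []       = 1
  ∏₁₊ f (d ∷ ds) = (1 + f d) * ∏₁₊ f ds

  ∏ : (A → ℕ) → List A → ℕ
  ∏ f []       = 1
  ∏ f (d ∷ ds) = f d * ∏ f ds

  ∑-sublists⁺ : ∀ (f : A → ℕ) ds → 1 + ∑ (sublists⁺ ds) (∏ f) ≡ ∏₁₊ f ds
  ∑-sublists⁺ f [] = cong suc (∑-[] _)
  ∑-sublists⁺ f (d ∷ ds) = trans (cong suc (trans (∑-∷ _ _ _) (cong (f d * 1 +_)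
      (trans (∑-++ (map (d ∷_) (sublists⁺ ds)) (sublists⁺ ds) _)
        (cong (_+ S) (trans (∑-map (d ∷_) (sublists⁺ ds) _) (∑-*ˡ (sublists⁺ ds) (f d) (∏ f))))))))
    (trans (lemma (f d) S) (cong ((1 + f d) *_) (∑-sublists⁺ f ds)))
    where
    S : ℕ
    S = ∑ (sublists⁺ ds) (∏ f)
    lemma : ∀ a s → 1 + (a * 1 + (a * s + s)) ≡ (1 + a) * (1 + s)
    lemma = solve-∀

  ∏-const : ∀ c (ds : List A) → ∏ (λ _ → c) ds ≡ c ^ length ds
  ∏-const c []       = refl
  ∏-const c (d ∷ ds) = cong (c *_) (∏-const c ds)

  ∏₁₊-const : ∀ c (ds : List A) → ∏₁₊ (λ _ → c) ds ≡ (1 + c) ^ length ds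
  ∏₁₊-const c []       = refl
  ∏₁₊-const c (d ∷ ds) = cong ((1 + c) *_) (∏₁₊-const c ds)

  length-sublists⁺ : ∀ (ds : List A) → length (sublists⁺ ds) ≤ 2 ^ length ds
  length-sublists⁺ ds = begin
    length (sublists⁺ ds)                    ≡⟨ *-identityʳ _ ⟨
    length (sublists⁺ ds) * 1                ≡⟨ ∑-const (sublists⁺ ds) 1 ⟨
    ∑ (sublists⁺ ds) (λ _ → 1)               ≡⟨ ∑-cong (sublists⁺ ds) (λ b → sym (trans (∏-const 1 b) (^-zeroˡ (length b)))) ⟩
    ∑ (sublists⁺ ds) (∏ (λ _ → 1))           ≤⟨ n≤1+n _ ⟩
    1 + ∑ (sublists⁺ ds) (∏ (λ _ → 1))       ≡⟨ trans (∑-sublists⁺ (λ _ → 1) ds) (∏₁₊-const 1 ds) ⟩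
    2 ^ length ds ∎
    where open ≤-Reasoning

-- x lists distinct vertices; at a position i, the entries of D i are the
-- indices d of the flagged edges x i — y i d, coloured by κ i d.
module Core (n r q μ : ℕ) {{_ : NonZero n}} (r≤n : r ≤ n)
  (x : ℕ → Fin n) (y : ℕ → Fin r → Fin n) (κ : ℕ → Fin r → Fin q) (D : ℕ → List (Fin r))
  (x-injective : ∀ {i j} → i < n → j < n → x i ≡ x j → i ≡ j)
  (κ-injective : ∀ {i j d d′} → i < n → j < n → κ i d ≡ κ j d′ → i ≡ j × d ≡ d′)
  (y≡ : ∀ {i} d → r ≤ i → i < n → y i d ≡ x (i ∸ suc (toℕ d)))
  (D-unique : ∀ i → List.Unique (D i)) (D-length : ∀ i → length (D i) ≤ r)
  where

  open Template n r q r≤n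

  -- ν will be twice the inverse weight of a coloured edge.  At a position where
  -- some of the r preceding ones has a chosen edge, the nonempty choices weigh
  -- at most Y / n in total; elsewhere a new run starts and they weigh at most
  -- Z / n.
  ν M Y Z : ℕ
  ν = μ * q
  M = μ * C₂
  Y = 2 ^ r * (M ^ r * C₁)
  Z = 2 ^ r * (M * C₁)

  item : ℕ → Fin r → Item
  item i d = x i , y i d , κ i d

  items : ℕ → List (Fin r) → List Item
  items i = map (item i)

  h : ℕ → Copy → ℕ
  h i B = ∏₁₊ (λ d → ν * 𝟙 (has? B (item i d))) (D i)

  H : ℕ → ℕ → Copy → ℕ
  H zero      i B = 1
  H (suc rem) i B = h i B * H rem (suc i) B

  -- The mass once `L` has been chosen at the positions below `i`; the product over the remaining
  -- positions is not yet expanded.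
  V : ℕ → ℕ → List Item → ℕ
  V rem i L = ∑[ B ∈ copies ] (𝟙 (sat? L B) * H rem i B)

  flagged : List (Fin r) → ℕ
  flagged []      = 0
  flagged (_ ∷ _) = 1

  P : ℕ → ℕ → ℕ
  P rem i = sumFrom rem i (λ i → flagged (D i))

  hits : ℕ → ℕ → Copy → ℕ
  hits rem i B = sumFrom rem i (λ i → ∑[ d ∈ D i ] 𝟙 (has? B (item i d)))

  H≡ : ∀ rem i B → H rem i B ≡ (1 + ν) ^ hits rem i B
  H≡ zero      i B = refl
  H≡ (suc rem) i B = trans (cong₂ _*_ (h≡ (D i)) (H≡ rem (suc i) B)) (sym (^-distribˡ-+-* (1 + ν) (∑[ d ∈ D i ] 𝟙 (has? B (item i d))) _))
    where
    h≡ : ∀ ds → ∏₁₊ (λ d → ν * 𝟙 (has? B (item i d))) ds ≡ (1 + ν) ^ (∑[ d ∈ ds ] 𝟙 (has? B (item i d)))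
    h≡ [] = cong ((1 + ν) ^_) (sym (∑-[] _))
    h≡ (d ∷ ds) = trans (cong₂ _*_ (factor (has? B (item i d))) (h≡ ds))
      (trans (sym (^-distribˡ-+-* (1 + ν) (𝟙 (has? B (item i d))) _)) (cong ((1 + ν) ^_) (sym (∑-∷ _ _ _))))
      where
      factor : ∀ {Q : Set} (Q? : Dec Q) → 1 + ν * 𝟙 Q? ≡ (1 + ν) ^ 𝟙 Q?
      factor (yes _) = refl
      factor (no _)  = cong suc (*-zeroʳ ν)

  sat-++ : ∀ K L B → 𝟙 (sat? (K ++ L) B) ≡ 𝟙 (sat? K B) * 𝟙 (sat? L B)
  sat-++ K L B = trans (𝟙-cong (sat? (K ++ L) B) (sat? K B ×-dec sat? L B)
      (ListAll.++⁻ K) (λ (k , l) → ListAll.++⁺ k l))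
    (𝟙-× (sat? K B) (sat? L B))

  ∏-items : ∀ i b B → ∏ (λ d → ν * 𝟙 (has? B (item i d))) b ≡ ν ^ length b * 𝟙 (sat? (items i b) B)
  ∏-items i []      B = refl
  ∏-items i (d ∷ b) B = trans (cong (ν * 𝟙 (has? B (item i d)) *_) (∏-items i b B))
    (trans (reorder ν (𝟙 (has? B (item i d))) (ν ^ length b) (𝟙 (sat? (items i b) B)))
      (cong (ν * ν ^ length b *_) (trans (sym (𝟙-× (has? B (item i d)) (sat? (items i b) B)))
        (𝟙-cong (has? B (item i d) ×-dec sat? (items i b) B) (sat? (items i (d ∷ b)) B)
          (λ (p , ps) → p ∷ ps) (λ { (p ∷ ps) → p , ps })))))
    where
    reorder : ∀ a b c d → a * b * (c * d) ≡ a * c * (b * d)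
    reorder = solve-∀

  -- `(1 + ν) ^ hits` is a sum over the subsets of the common edges, expanded here at one position.
  -- A term requires only that the chosen edges lie in `B` and leaves the other edges open, which is
  -- the form that `spread` needs.
  V-step : ∀ rem i L → V (suc rem) i L
         ≡ V rem (suc i) L + (∑[ b ∈ sublists⁺ (D i) ] (ν ^ length b * V rem (suc i) (items i b ++ L)))
  V-step rem i L = begin
    V (suc rem) i L
      ≡⟨ ∑-cong copies (λ B → pointwise B) ⟩
    ∑[ B ∈ copies ] (𝟙 (sat? L B) * H rem (suc i) B +
      (∑[ b ∈ sublists⁺ (D i) ] (ν ^ length b * (𝟙 (sat? (items i b ++ L) B) * H rem (suc i) B))))
      ≡⟨ ∑-+ copies _ _ ⟩
    V rem (suc i) L + (∑[ B ∈ copies ] ∑[ b ∈ sublists⁺ (D i) ]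
      (ν ^ length b * (𝟙 (sat? (items i b ++ L) B) * H rem (suc i) B)))
      ≡⟨ cong (V rem (suc i) L +_) (trans (∑-swap copies (sublists⁺ (D i)) _)
           (∑-cong (sublists⁺ (D i)) λ b → ∑-*ˡ copies (ν ^ length b) _)) ⟩
    V rem (suc i) L + (∑[ b ∈ sublists⁺ (D i) ] (ν ^ length b * V rem (suc i) (items i b ++ L))) ∎
    where
    open ≡-Reasoning
    pointwise : ∀ B → 𝟙 (sat? L B) * (h i B * H rem (suc i) B) ≡ 𝟙 (sat? L B) * H rem (suc i) B +
      (∑[ b ∈ sublists⁺ (D i) ] (ν ^ length b * (𝟙 (sat? (items i b ++ L) B) * H rem (suc i) B)))
    pointwise B = begin
      s * (h i B * g)
        ≡⟨ cong (λ z → s * (z * g)) (sym (∑-sublists⁺ (λ d → ν * 𝟙 (has? B (item i d))) (D i))) ⟩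
      s * ((1 + S) * g)
        ≡⟨ reorder s S g ⟩
      s * g + S * (s * g)
        ≡⟨ cong (s * g +_) (sym (∑-*ʳ (sublists⁺ (D i)) (s * g) _)) ⟩
      s * g + (∑[ b ∈ sublists⁺ (D i) ] (∏ (λ d → ν * 𝟙 (has? B (item i d))) b * (s * g)))
        ≡⟨ cong (s * g +_) (∑-cong (sublists⁺ (D i)) λ b → trans (cong (_* (s * g)) (∏-items i b B))
             (trans (reorder₂ (ν ^ length b) (𝟙 (sat? (items i b) B)) s g)
               (cong (λ z → ν ^ length b * (z * g)) (sym (sat-++ (items i b) L B))))) ⟩
      s * g + (∑[ b ∈ sublists⁺ (D i) ] (ν ^ length b * (𝟙 (sat? (items i b ++ L) B) * g))) ∎
      where
      s g S : ℕ
      s = 𝟙 (sat? L B)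
      g = H rem (suc i) B
      S = ∑ (sublists⁺ (D i)) (∏ (λ d → ν * 𝟙 (has? B (item i d))))
      reorder : ∀ s S g → s * ((1 + S) * g) ≡ s * g + S * (s * g)
      reorder = solve-∀
      reorder₂ : ∀ a b s g → a * b * (s * g) ≡ a * (b * s * g)
      reorder₂ = solve-∀

  -- The state when the positions below i have been treated: the chosen
  -- coloured edges L, and a forest Fs inside them with vertices below u.
  record State (i u : ℕ) (L : List Item) (Fs : List (Fin n × Fin n)) : Set where
    field
      colours-unique : List.Unique (map colour L)
      colours-old    : ∀ {c} → c ∈ map colour L → ∃[ j ] ∃[ d ] j < i × c ≡ κ j d
      forest         : Forest Fs
      linked         : ∀ B → Sat L B → ListAll.All (Linked (proj₁ B)) Fs
      vertices-old   : ∀ {z} → z ∈ vertexList Fs → ∃[ j ] j < u × z ≡ x j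
      u≤i            : u ≤ i

  open State

  initial : ∀ i → State i 0 [] []
  initial i = record
    { colours-unique = [] ; colours-old = λ () ; forest = tt ; linked = λ _ _ → []
    ; vertices-old = λ () ; u≤i = z≤n }

  skip : ∀ {i u L Fs} → State i u L Fs → State (suc i) u L Fs
  skip st = record
    { colours-unique = colours-unique st
    ; colours-old = λ c∈ → let (j , d , j<i , eq) = colours-old st c∈ in j , d , m<n⇒m<1+n j<i , eq
    ; forest = forest st ; linked = linked st ; vertices-old = vertices-old st
    ; u≤i = m≤n⇒m≤1+n (u≤i st) }

  colour-items : ∀ i b → map colour (items i b) ≡ map (κ i) b
  colour-items i []      = refl
  colour-items i (d ∷ b) = cong (κ i d ∷_) (colour-items i b)

  choose : ∀ {i u L Fs b} → i < n → List.Unique b → State i u L Fs → State (suc i) u (items i b ++ L) Fs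
  choose {i} {u} {L} {Fs} {b} i<n b-unique st = record
    { colours-unique = subst List.Unique (sym colours≡)
        (ListUnique.++⁺ (ListUnique.map⁺ (λ e → proj₂ (κ-injective i<n i<n e)) b-unique) (colours-unique st) disjoint)
    ; colours-old = λ {c} c∈ → old c (∈-++⁻ (map (κ i) b) (subst (c ∈_) colours≡ c∈))
    ; forest = forest st
    ; linked = λ B s → linked st B (ListAll.++⁻ʳ (items i b) s)
    ; vertices-old = vertices-old st
    ; u≤i = m≤n⇒m≤1+n (u≤i st) }
    where
    colours≡ : map colour (items i b ++ L) ≡ map (κ i) b ++ map colour L
    colours≡ = trans (map-++ colour (items i b) L) (cong (_++ map colour L) (colour-items i b))
    disjoint : ∀ {c} → ¬ (c ∈ map (κ i) b × c ∈ map colour L)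
    disjoint (c∈b , c∈L) with ∈-map⁻ (κ i) c∈b | colours-old st c∈L
    ... | d , _ , refl | j , d′ , j<i , eq = <⇒≢ j<i (sym (proj₁ (κ-injective i<n (<-trans j<i i<n) eq)))
    old : ∀ c → c ∈ map (κ i) b ⊎ c ∈ map colour L → ∃[ j ] ∃[ d ] j < suc i × c ≡ κ j d
    old c (inj₁ c∈b) with ∈-map⁻ (κ i) c∈b
    ... | d , _ , eq = i , d , ≤-refl , eq
    old c (inj₂ c∈L) = let (j , d , j<i , eq) = colours-old st c∈L in j , d , m<n⇒m<1+n j<i , eq

  has⇒linked : ∀ {B i d} → r ≤ i → i < n → Has B (item i d) →
               Linked (proj₁ B) (x (i ∸ suc (toℕ d)) , x i) × Linked (proj₁ B) (x i , x (i ∸ suc (toℕ d)))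
  has⇒linked {σ , π} {i} {d} r≤i i<n (j , e , joins , _) rewrite y≡ d r≤i i<n with joins
  ... | inj₁ (p , p′) = (j , e , inj₂ (p , p′)) , (j , e , inj₁ (p , p′))
  ... | inj₂ (p , p′) = (j , e , inj₁ (p , p′)) , (j , e , inj₂ (p , p′))

  earlier : ∀ {i} (d : Fin r) → r ≤ i → i ∸ suc (toℕ d) < i
  earlier {i} d r≤i = ∸-monoʳ-< {i} {suc (toℕ d)} {0} (s≤s z≤n) (≤-trans (Fin.toℕ<n d) r≤i)

  attach : ∀ {i u L Fs b d} → r ≤ i → i < n → d ∈ b → State (suc i) u (items i b ++ L) Fs → u ≤ i →
           State (suc i) (suc i) (items i b ++ L) ((x (i ∸ suc (toℕ d)) , x i) ∷ Fs)
  attach {i} {u} {L} {Fs} {b} {d} r≤i i<n d∈b st u≤i′ = record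
    { colours-unique = colours-unique st
    ; colours-old = colours-old st
    ; forest = (λ eq → <⇒≢ (earlier d r≤i) (x-injective (<-trans (earlier d r≤i) i<n) i<n eq)) , new , forest st
    ; linked = λ B s → proj₁ (has⇒linked {B} r≤i i<n
        (ListAll.lookup (ListAll.++⁻ˡ (items i b) s) (∈-map⁺ (item i) d∈b))) ∷ linked st B s
    ; vertices-old = λ
        { (here refl) → i ∸ suc (toℕ d) , m<n⇒m<1+n (earlier d r≤i) , refl
        ; (there (here refl)) → i , ≤-refl , refl
        ; (there (there z∈)) → let (j , j<u , eq) = vertices-old st z∈ in j , m<n⇒m<1+n (<-≤-trans j<u u≤i′) , eq }
    ; u≤i = ≤-refl }
    where
    new : x i ∉ vertexList Fs
    new x∈ with vertices-old st x∈
    ... | j , j<u , eq = <⇒≢ (<-≤-trans j<u u≤i′) (sym (x-injective i<n (<-trans (<-≤-trans j<u u≤i′) i<n) eq))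

  -- As the last run lies at least `r` positions back, the lower end of the second edge is new too.
  -- This edge is entered in reverse, so that its lower end stands in the place of the new endpoint.
  attach₂ : ∀ {i u L Fs b d d′} → r ≤ i → i < n → u + r ≤ i → d ∈ b → d′ ∈ b → d ≢ d′ →
            State (suc i) u (items i b ++ L) Fs →
            State (suc i) (suc i) (items i b ++ L)
              ((x i , x (i ∸ suc (toℕ d′))) ∷ (x (i ∸ suc (toℕ d)) , x i) ∷ Fs)
  attach₂ {i} {u} {L} {Fs} {b} {d} {d′} r≤i i<n fresh d∈b d′∈b d≢d′ st₀ = record
    { colours-unique = colours-unique st
    ; colours-old = colours-old st
    ; forest = (λ eq → x≢ eq) , new , forest st
    ; linked = λ B s → proj₂ (has⇒linked {B} r≤i i<n
        (ListAll.lookup (ListAll.++⁻ˡ (items i b) s) (∈-map⁺ (item i) d′∈b))) ∷ linked st B s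
    ; vertices-old = λ
        { (here refl) → i , ≤-refl , refl
        ; (there (here refl)) → i ∸ suc (toℕ d′) , m<n⇒m<1+n (earlier d′ r≤i) , refl
        ; (there (there z∈)) → vertices-old st z∈ }
    ; u≤i = ≤-refl }
    where
    st = attach r≤i i<n d∈b st₀ (≤-trans (m≤m+n u r) fresh)
    x≢ : x i ≢ x (i ∸ suc (toℕ d′))
    x≢ eq = <⇒≢ (earlier d′ r≤i) (sym (x-injective i<n (<-trans (earlier d′ r≤i) i<n) eq))
    u≤earlier : u ≤ i ∸ suc (toℕ d′)
    u≤earlier = ≤-trans (m+n≤o⇒m≤o∸n u fresh) (∸-monoʳ-≤ i (Fin.toℕ<n d′))
    earlier-inj : i ∸ suc (toℕ d′) ≡ i ∸ suc (toℕ d) → d ≡ d′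
    earlier-inj eq = Fin.toℕ-injective (suc-injective (sym
      (∸-cancelˡ-≡ (≤-trans (Fin.toℕ<n d′) r≤i) (≤-trans (Fin.toℕ<n d) r≤i) eq)))
    new : x (i ∸ suc (toℕ d′)) ∉ vertexList ((x (i ∸ suc (toℕ d)) , x i) ∷ Fs)
    new (here eq) = d≢d′ (earlier-inj
      (x-injective (<-trans (earlier d′ r≤i) i<n) (<-trans (earlier d r≤i) i<n) eq))
    new (there (here eq)) = x≢ (sym eq)
    new (there (there x∈)) with vertices-old st₀ x∈
    ... | j , j<u , eq = <⇒≢ (<-≤-trans j<u u≤earlier) (sym (x-injective (<-trans (earlier d′ r≤i) i<n)
            (<-trans (<-≤-trans j<u u≤earlier) (<-trans (earlier d′ r≤i) i<n)) eq))

  module Bound (1≤M : 1 ≤ M) (n-large : M ^ r * C₁ ≤ n) (n-large′ : 2 * Y * r ≤ n) where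

    open ≤-Reasoning

    scale weight : List Item → List (Fin n × Fin n) → ℕ
    scale  L Fs = q ^ length L * n ^ length Fs
    weight L Fs = I * (C₂ ^ length L * C₁ ^ length Fs)

    -- A potential function. Relative to `n`, the power of `n + 2 * Z` pays for the choices that
    -- start new runs, and the last factor pays, in steps of `2 * Y`, for choices at the at most `r`
    -- positions that can prolong the present run. It shrinks to `n` once `u` lies `r` positions
    -- back.
    Claim : ℕ → ℕ → ℕ → List Item → List (Fin n × Fin n) → Set
    Claim rem i u L Fs = V rem i L * (scale L Fs * n ^ suc (P rem i))
                       ≤ weight L Fs * ((n + 2 * Z) ^ P rem i * (n + 2 * Y * (r ∸ (i ∸ u))))

    ^-mono-M : ∀ {i j} → i ≤ j → M ^ i ≤ M ^ j
    ^-mono-M i≤j = ^-monoʳ-≤ M {{>-nonZero 1≤M}} i≤j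

    term : ∀ rem i k L Fs Fs′ b → length Fs′ ≡ k + length Fs →
           Claim rem (suc i) (suc i) (items i b ++ L) Fs′ →
           ν ^ length b * V rem (suc i) (items i b ++ L) * (scale L Fs * n ^ k * n ^ suc (P rem (suc i)))
           ≤ weight L Fs * (M ^ length b * C₁ ^ k * ((n + 2 * Z) ^ P rem (suc i) * (2 * n)))
    term rem i k L Fs Fs′ b len claim = begin
      ν ^ s * Vb * (q ^ l * n ^ f * n ^ k * N′)
        ≡⟨ cong (λ z → z * Vb * (q ^ l * n ^ f * n ^ k * N′)) (^-distribʳ-* μ q s) ⟩
      μ ^ s * q ^ s * Vb * (q ^ l * n ^ f * n ^ k * N′)
        ≡⟨ reorder (μ ^ s) (q ^ s) Vb (q ^ l) (n ^ f) (n ^ k) N′ ⟩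
      μ ^ s * (Vb * (q ^ s * q ^ l * (n ^ k * n ^ f) * N′))
        ≡⟨ cong (λ z → μ ^ s * (Vb * (z * N′))) scale≡ ⟩
      μ ^ s * (Vb * (scale (items i b ++ L) Fs′ * N′))
        ≤⟨ *-monoʳ-≤ (μ ^ s) claim ⟩
      μ ^ s * (weight (items i b ++ L) Fs′ * (Q * (n + 2 * Y * (r ∸ (suc i ∸ suc i)))))
        ≤⟨ *-monoʳ-≤ (μ ^ s) (*-monoʳ-≤ (weight (items i b ++ L) Fs′) (*-monoʳ-≤ Q ≤2n)) ⟩
      μ ^ s * (weight (items i b ++ L) Fs′ * (Q * (2 * n)))
        ≡⟨ cong (λ z → μ ^ s * (I * z * (Q * (2 * n)))) weight≡ ⟩
      μ ^ s * (I * (C₂ ^ s * C₂ ^ l * (C₁ ^ k * C₁ ^ f)) * (Q * (2 * n)))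
        ≡⟨ reorder₂ (μ ^ s) I (C₂ ^ s) (C₂ ^ l) (C₁ ^ k) (C₁ ^ f) (Q * (2 * n)) ⟩
      weight L Fs * (μ ^ s * C₂ ^ s * C₁ ^ k * (Q * (2 * n)))
        ≡⟨ cong (λ z → weight L Fs * (z * C₁ ^ k * (Q * (2 * n)))) (^-distribʳ-* μ C₂ s) ⟨
      weight L Fs * (M ^ s * C₁ ^ k * (Q * (2 * n))) ∎
      where
      s l f Vb N′ Q : ℕ
      s = length b
      l = length L
      f = length Fs
      Vb = V rem (suc i) (items i b ++ L)
      N′ = n ^ suc (P rem (suc i))
      Q = (n + 2 * Z) ^ P rem (suc i)
      length≡ : length (items i b ++ L) ≡ s + l
      length≡ = trans (length-++ (items i b)) (cong (_+ l) (length-map (item i) b))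
      split : ∀ a s l → a ^ s * a ^ l ≡ a ^ (s + l)
      split a s l = sym (^-distribˡ-+-* a s l)
      scale≡ : q ^ s * q ^ l * (n ^ k * n ^ f) ≡ scale (items i b ++ L) Fs′
      scale≡ = cong₂ _*_ (trans (split q s l) (cong (q ^_) (sym length≡))) (trans (split n k f) (cong (n ^_) (sym len)))
      weight≡ : C₂ ^ length (items i b ++ L) * C₁ ^ length Fs′ ≡ C₂ ^ s * C₂ ^ l * (C₁ ^ k * C₁ ^ f)
      weight≡ = sym (cong₂ _*_ (trans (split C₂ s l) (cong (C₂ ^_) (sym length≡)))
                               (trans (split C₁ k f) (cong (C₁ ^_) (sym len))))
      -- A choice resets the run, and the potential is then at most 2 relative to `n`: the origin of
      -- the factor 2 in `2 * Y` and `2 * Z`.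
      ≤2n : n + 2 * Y * (r ∸ (suc i ∸ suc i)) ≤ 2 * n
      ≤2n = begin
        n + 2 * Y * (r ∸ (suc i ∸ suc i)) ≡⟨ cong (λ z → n + 2 * Y * (r ∸ z)) (n∸n≡0 i) ⟩
        n + 2 * Y * r                     ≤⟨ +-monoʳ-≤ n n-large′ ⟩
        n + n                             ≡⟨ cong (n +_) (+-identityʳ n) ⟨
        2 * n ∎
      reorder : ∀ a b v c d e g → a * b * v * (c * d * e * g) ≡ a * (v * (b * c * (e * d) * g))
      reorder = solve-∀
      reorder₂ : ∀ a i b c d e g → a * (i * (b * c * (d * e)) * g) ≡ i * (c * e) * (a * b * d * g)
      reorder₂ = solve-∀

    terms : ∀ rem i L Fs w → length (D i) ≤ r →
      (∀ b → b ∈ sublists⁺ (D i) → ν ^ length b * V rem (suc i) (items i b ++ L) * (scale L Fs * n ^ suc (suc (P rem (suc i))))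
        ≤ weight L Fs * (w * ((n + 2 * Z) ^ P rem (suc i) * (2 * n)))) →
      (∑[ b ∈ sublists⁺ (D i) ] (ν ^ length b * V rem (suc i) (items i b ++ L))) * (scale L Fs * n ^ suc (suc (P rem (suc i))))
        ≤ weight L Fs * ((n + 2 * Z) ^ P rem (suc i) * (2 * (2 ^ r * w) * n))
    terms rem i L Fs w D≤r each = begin
      (∑[ b ∈ sublists⁺ (D i) ] (ν ^ length b * V rem (suc i) (items i b ++ L))) * S
        ≡⟨ ∑-*ʳ (sublists⁺ (D i)) S _ ⟨
      ∑[ b ∈ sublists⁺ (D i) ] (ν ^ length b * V rem (suc i) (items i b ++ L) * S)
        ≤⟨ ∑-mono-∈ (sublists⁺ (D i)) each ⟩
      ∑[ b ∈ sublists⁺ (D i) ] K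
        ≡⟨ ∑-const (sublists⁺ (D i)) K ⟩
      length (sublists⁺ (D i)) * K
        ≤⟨ *-monoˡ-≤ K (≤-trans (length-sublists⁺ (D i)) (^-monoʳ-≤ 2 D≤r)) ⟩
      2 ^ r * K
        ≡⟨ reorder (2 ^ r) (weight L Fs) w ((n + 2 * Z) ^ P rem (suc i)) n ⟩
      weight L Fs * ((n + 2 * Z) ^ P rem (suc i) * (2 * (2 ^ r * w) * n)) ∎
      where
      S K : ℕ
      S = scale L Fs * n ^ suc (suc (P rem (suc i)))
      K = weight L Fs * (w * ((n + 2 * Z) ^ P rem (suc i) * (2 * n)))
      reorder : ∀ t a w b n → t * (a * (w * (b * (2 * n)))) ≡ a * (b * (2 * (t * w) * n))
      reorder = solve-∀

    combine-≤ : ∀ V₀ T S W N Q g e R → V₀ * (S * N) ≤ W * (Q * (n + 2 * Y * g)) →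
              T * (S * (n * N)) ≤ W * (Q * (e * n)) → (n + 2 * Y * g + e) * n ≤ R →
              (V₀ + T) * (S * (n * N)) ≤ W * (Q * R)
    combine-≤ V₀ T S W N Q g e R h₀ h₁ hR = begin
      (V₀ + T) * (S * (n * N))                          ≡⟨ reorder V₀ T S n N ⟩
      n * (V₀ * (S * N)) + T * (S * (n * N))            ≤⟨ +-mono-≤ (*-monoʳ-≤ n h₀) h₁ ⟩
      n * (W * (Q * (n + 2 * Y * g))) + W * (Q * (e * n)) ≡⟨ reorder₂ n W Q (n + 2 * Y * g) e ⟩
      W * (Q * ((n + 2 * Y * g + e) * n))               ≤⟨ *-monoʳ-≤ W (*-monoʳ-≤ Q hR) ⟩
      W * (Q * R) ∎
      where
      reorder : ∀ v t s n m → (v + t) * (s * (n * m)) ≡ n * (v * (s * m)) + t * (s * (n * m))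
      reorder = solve-∀
      reorder₂ : ∀ n w q a e → n * (w * (q * a)) + w * (q * (e * n)) ≡ w * (q * ((a + e) * n))
      reorder₂ = solve-∀

    forest-phase : ∀ rem i u L Fs → i + rem ≡ n → r ≤ i → State i u L Fs → Claim rem i u L Fs
    forest-phase zero i u L Fs _ r≤i st = begin
      V zero i L * (scale L Fs * (n * 1))
        ≡⟨ cong (_* (scale L Fs * (n * 1))) (∑-cong copies λ B → *-identityʳ _) ⟩
      (∑[ B ∈ copies ] 𝟙 (sat? L B)) * (scale L Fs * (n * 1))
        ≡⟨ reorder (∑[ B ∈ copies ] 𝟙 (sat? L B)) (scale L Fs) n ⟩
      (∑[ B ∈ copies ] 𝟙 (sat? L B)) * scale L Fs * n
        ≤⟨ *-mono-≤ (spread L Fs (colours-unique st) (forest st) (linked st))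
             (m≤m+n n (2 * Y * (r ∸ (i ∸ u)))) ⟩
      weight L Fs * (n + 2 * Y * (r ∸ (i ∸ u)))
        ≡⟨ cong (weight L Fs *_) (*-identityˡ _) ⟨
      weight L Fs * (1 * (n + 2 * Y * (r ∸ (i ∸ u)))) ∎
      where
      reorder : ∀ a b c → a * (b * (c * 1)) ≡ a * b * c
      reorder = solve-∀
    forest-phase (suc rem) i u L Fs i+rem≡n r≤i st = begin
      V (suc rem) i L * (scale L Fs * n ^ suc (P (suc rem) i))
        ≡⟨ cong (_* (scale L Fs * n ^ suc (P (suc rem) i))) (V-step rem i L) ⟩
      (V rem (suc i) L + (∑[ b ∈ sublists⁺ (D i) ] T b)) * (scale L Fs * n ^ suc (flagged (D i) + P′))
        ≤⟨ by-flag (D i) refl ⟩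
      weight L Fs * ((n + 2 * Z) ^ (flagged (D i) + P′) * (n + 2 * Y * (r ∸ (i ∸ u)))) ∎
      where
      T : List (Fin r) → ℕ
      T b = ν ^ length b * V rem (suc i) (items i b ++ L)
      P′ : ℕ
      P′ = P rem (suc i)
      i<n : i < n
      i<n = ≤-trans (≤-trans (m≤m+n (suc i) rem) (≤-reflexive (sym (+-suc i rem)))) (≤-reflexive i+rem≡n)
      IH : ∀ {u′ L′ Fs′} → State (suc i) u′ L′ Fs′ → Claim rem (suc i) u′ L′ Fs′
      IH st′ = forest-phase rem (suc i) _ _ _ (trans (sym (+-suc i rem)) i+rem≡n) (m≤n⇒m≤1+n r≤i) st′
      Goal : List (Fin r) → Set
      Goal ds = (V rem (suc i) L + (∑[ b ∈ sublists⁺ ds ] T b)) * (scale L Fs * n ^ suc (flagged ds + P′))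
                ≤ weight L Fs * ((n + 2 * Z) ^ (flagged ds + P′) * (n + 2 * Y * (r ∸ (i ∸ u))))
      gap-mono : r ∸ (suc i ∸ u) ≤ r ∸ (i ∸ u)
      gap-mono = ∸-monoʳ-≤ r (∸-monoˡ-≤ u (n≤1+n i))

      one-edge : ∀ b d → d ∈ b → b ∈ sublists⁺ (D i) →
        T b * (scale L Fs * n ^ suc (suc P′)) ≤ weight L Fs * (M ^ length b * C₁ * ((n + 2 * Z) ^ P′ * (2 * n)))
      one-edge b d d∈b b∈ = begin
        T b * (scale L Fs * (n * n ^ suc P′))
          ≡⟨ cong (T b *_) (trans (sym (*-assoc (scale L Fs) n _)) (cong (λ z → scale L Fs * z * n ^ suc P′) (sym (*-identityʳ n)))) ⟩
        T b * (scale L Fs * n ^ 1 * n ^ suc P′)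
          ≤⟨ term rem i 1 L Fs ((x (i ∸ suc (toℕ d)) , x i) ∷ Fs) b refl (IH (attach r≤i i<n d∈b
               (choose i<n (sub-unique (sublists⁺-sub (D i) b∈) (D-unique i)) st) (u≤i st))) ⟩
        weight L Fs * (M ^ length b * (C₁ * 1) * ((n + 2 * Z) ^ P′ * (2 * n)))
          ≡⟨ cong (λ z → weight L Fs * (M ^ length b * z * ((n + 2 * Z) ^ P′ * (2 * n)))) (*-identityʳ C₁) ⟩
        weight L Fs * (M ^ length b * C₁ * ((n + 2 * Z) ^ P′ * (2 * n))) ∎

      -- The extra factor C₁ / n of the second forest edge absorbs M ^ length b.
      two-edges : ∀ b d d′ → d ∈ b → d′ ∈ b → d ≢ d′ → b ∈ sublists⁺ (D i) → u + r ≤ i →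
        T b * (scale L Fs * n ^ suc (suc P′)) ≤ weight L Fs * (M * C₁ * ((n + 2 * Z) ^ P′ * (2 * n)))
      two-edges b d d′ d∈b d′∈b d≢d′ b∈ fresh = *-cancelˡ-≤ n (begin
        n * (T b * (scale L Fs * (n * n ^ suc P′)))
          ≡⟨ reorder n (T b) (scale L Fs) (n ^ suc P′) ⟩
        T b * (scale L Fs * n ^ 2 * n ^ suc P′)
          ≤⟨ term rem i 2 L Fs ((x i , x (i ∸ suc (toℕ d′))) ∷ (x (i ∸ suc (toℕ d)) , x i) ∷ Fs) b refl (IH (attach₂ r≤i i<n fresh d∈b d′∈b d≢d′
               (choose i<n (sub-unique (sublists⁺-sub (D i) b∈) (D-unique i)) st))) ⟩
        weight L Fs * (M ^ length b * (C₁ * (C₁ * 1)) * ((n + 2 * Z) ^ P′ * (2 * n)))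
          ≡⟨ cong (λ z → weight L Fs * (z * ((n + 2 * Z) ^ P′ * (2 * n)))) (reorder₂ (M ^ length b) C₁) ⟩
        weight L Fs * (M ^ length b * C₁ * C₁ * ((n + 2 * Z) ^ P′ * (2 * n)))
          ≤⟨ *-monoʳ-≤ (weight L Fs) (*-monoˡ-≤ _ (*-mono-≤
               (≤-trans (*-monoˡ-≤ C₁ (^-mono-M (≤-trans (sub-length (sublists⁺-sub (D i) b∈)) (D-length i)))) n-large)
               (≤-trans (≤-reflexive (sym (*-identityˡ C₁))) (*-monoˡ-≤ C₁ 1≤M)))) ⟩
        weight L Fs * (n * (M * C₁) * ((n + 2 * Z) ^ P′ * (2 * n)))
          ≡⟨ reorder₃ (weight L Fs) n (M * C₁) ((n + 2 * Z) ^ P′ * (2 * n)) ⟩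
        n * (weight L Fs * (M * C₁ * ((n + 2 * Z) ^ P′ * (2 * n)))) ∎)
        where
        reorder : ∀ n t s m → n * (t * (s * (n * m))) ≡ t * (s * (n * (n * 1)) * m)
        reorder = solve-∀
        reorder₂ : ∀ a c → a * (c * (c * 1)) ≡ a * c * c
        reorder₂ = solve-∀
        reorder₃ : ∀ w n a b → w * (n * a * b) ≡ n * (w * (a * b))
        reorder₃ = solve-∀

      stale-term : ∀ b → b ∈ sublists⁺ (D i) →
        T b * (scale L Fs * n ^ suc (suc P′)) ≤ weight L Fs * (M ^ r * C₁ * ((n + 2 * Z) ^ P′ * (2 * n)))
      stale-term [] b∈ = ⊥-elim (sublists⁺-nonempty (D i) b∈)
      stale-term b@(d ∷ _) b∈ = ≤-trans (one-edge b d (here refl) b∈)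
        (*-monoʳ-≤ (weight L Fs) (*-monoˡ-≤ ((n + 2 * Z) ^ P′ * (2 * n)) (*-monoˡ-≤ C₁
          (^-mono-M (≤-trans (sub-length (sublists⁺-sub (D i) b∈)) (D-length i))))))

      fresh-term : u + r ≤ i → ∀ b → b ∈ sublists⁺ (D i) →
        T b * (scale L Fs * n ^ suc (suc P′)) ≤ weight L Fs * (M * C₁ * ((n + 2 * Z) ^ P′ * (2 * n)))
      fresh-term fresh [] b∈ = ⊥-elim (sublists⁺-nonempty (D i) b∈)
      fresh-term fresh b@(d ∷ []) b∈ = ≤-trans (one-edge b d (here refl) b∈)
        (≤-reflexive (cong (λ z → weight L Fs * (z * C₁ * ((n + 2 * Z) ^ P′ * (2 * n)))) (*-identityʳ M)))
      fresh-term fresh b@(d ∷ d′ ∷ _) b∈ with sub-unique (sublists⁺-sub (D i) b∈) (D-unique i)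
      ... | (d≢d′ ∷ _) ∷ _ = two-edges b d d′ (here refl) (there (here refl)) d≢d′ b∈ fresh

      by-flag : ∀ ds → ds ≡ D i → Goal ds
      by-flag [] _ = begin
        (V rem (suc i) L + ∑ [] T) * (scale L Fs * n ^ suc P′)
          ≡⟨ cong (_* (scale L Fs * n ^ suc P′)) (trans (cong (V rem (suc i) L +_) (∑-[] T)) (+-identityʳ _)) ⟩
        V rem (suc i) L * (scale L Fs * n ^ suc P′)
          ≤⟨ IH (skip st) ⟩
        weight L Fs * ((n + 2 * Z) ^ P′ * (n + 2 * Y * (r ∸ (suc i ∸ u))))
          ≤⟨ *-monoʳ-≤ (weight L Fs) (*-monoʳ-≤ ((n + 2 * Z) ^ P′) (+-monoʳ-≤ n (*-monoʳ-≤ (2 * Y) gap-mono))) ⟩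
        weight L Fs * ((n + 2 * Z) ^ P′ * (n + 2 * Y * (r ∸ (i ∸ u)))) ∎
      by-flag ds@(_ ∷ _) eq = begin
        (V rem (suc i) L + (∑[ b ∈ sublists⁺ ds ] T b)) * (scale L Fs * (n * n ^ suc P′))
          ≤⟨ by-age (u + r ≤? i) ⟩
        weight L Fs * ((n + 2 * Z) ^ P′ * ((n + 2 * Z) * (n + 2 * Y * (r ∸ (i ∸ u)))))
          ≡⟨ reorder (weight L Fs) ((n + 2 * Z) ^ P′) (n + 2 * Z) (n + 2 * Y * (r ∸ (i ∸ u))) ⟩
        weight L Fs * ((n + 2 * Z) * (n + 2 * Z) ^ P′ * (n + 2 * Y * (r ∸ (i ∸ u)))) ∎
        where
        reorder : ∀ w a b c → w * (a * (b * c)) ≡ w * (b * a * c)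
        reorder = solve-∀
        Goal′ : ℕ → Set
        Goal′ R = (V rem (suc i) L + (∑[ b ∈ sublists⁺ ds ] T b)) * (scale L Fs * (n * n ^ suc P′))
                  ≤ weight L Fs * ((n + 2 * Z) ^ P′ * R)
        by-age : Dec (u + r ≤ i) → Goal′ ((n + 2 * Z) * (n + 2 * Y * (r ∸ (i ∸ u))))
        -- The potential of the old run is exhausted, so the choice is paid by a new factor
        -- `n + 2 * Z`.
        by-age (yes fresh) = combine-≤ (V rem (suc i) L) (∑[ b ∈ sublists⁺ ds ] T b) (scale L Fs) (weight L Fs) (n ^ suc P′) ((n + 2 * Z) ^ P′)
          (r ∸ (suc i ∸ u)) (2 * Z) _ (IH (skip st))
          (subst (λ ds → (∑[ b ∈ sublists⁺ ds ] T b) * (scale L Fs * (n * n ^ suc P′))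
                       ≤ weight L Fs * ((n + 2 * Z) ^ P′ * (2 * Z * n))) (sym eq)
            (terms rem i L Fs (M * C₁) (D-length i) (fresh-term fresh)))
          (begin
            (n + 2 * Y * (r ∸ (suc i ∸ u)) + 2 * Z) * n
              ≡⟨ cong (λ z → (n + 2 * Y * z + 2 * Z) * n) (m≤n⇒m∸n≡0 (≤-trans
                   (m+n≤o⇒n≤o∸m u fresh) (∸-monoˡ-≤ u (n≤1+n i)))) ⟩
            (n + 2 * Y * 0 + 2 * Z) * n
              ≡⟨ cong (λ z → (z + 2 * Z) * n) (trans (cong (n +_) (*-zeroʳ (2 * Y))) (+-identityʳ n)) ⟩
            (n + 2 * Z) * n
              ≤⟨ *-monoʳ-≤ (n + 2 * Z) (m≤m+n n _) ⟩
            (n + 2 * Z) * (n + 2 * Y * (r ∸ (i ∸ u))) ∎)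
          where
          m+n≤o⇒n≤o∸m : ∀ m {n o} → m + n ≤ o → n ≤ o ∸ m
          m+n≤o⇒n≤o∸m m {n} le = m+n≤o⇒m≤o∸n n (≤-trans (≤-reflexive (+-comm n m)) le)
        -- Moving on from `i` lowers the potential by exactly one unit `2 * Y`, which pays for the
        -- choice; of the factor `n + 2 * Z` only the part `n` is used.
        by-age (no stale) = combine-≤ (V rem (suc i) L) (∑[ b ∈ sublists⁺ ds ] T b) (scale L Fs) (weight L Fs) (n ^ suc P′) ((n + 2 * Z) ^ P′)
          (r ∸ (suc i ∸ u)) (2 * Y) _ (IH (skip st))
          (subst (λ ds → (∑[ b ∈ sublists⁺ ds ] T b) * (scale L Fs * (n * n ^ suc P′))
                       ≤ weight L Fs * ((n + 2 * Z) ^ P′ * (2 * Y * n))) (sym eq)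
            (terms rem i L Fs (M ^ r * C₁) (D-length i) stale-term))
          (begin
            (n + 2 * Y * g′ + 2 * Y) * n
              ≡⟨ expand n (2 * Y) g′ ⟩
            n * (n + 2 * Y * (1 + g′))
              ≡⟨ cong (λ z → n * (n + 2 * Y * z)) g≡ ⟨
            n * (n + 2 * Y * (r ∸ (i ∸ u)))
              ≤⟨ *-monoˡ-≤ _ (m≤m+n n (2 * Z)) ⟩
            (n + 2 * Z) * (n + 2 * Y * (r ∸ (i ∸ u))) ∎)
          where
          g′ : ℕ
          g′ = r ∸ (suc i ∸ u)
          expand : ∀ n a g → (n + a * g + a) * n ≡ n * (n + a * (1 + g))
          expand = solve-∀
          i∸u<r : i ∸ u < r
          i∸u<r = m<n+o⇒m∸n<o i u {{>-nonZero (≤-trans (s≤s z≤n) (r≥1 r (≰⇒> stale)))}} (≰⇒> stale)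
            where
            r≥1 : ∀ r → i < u + r → 1 ≤ r
            r≥1 zero i<u = ⊥-elim (<⇒≱ i<u (≤-trans (≤-reflexive (+-identityʳ u)) (u≤i st)))
            r≥1 (suc r) _ = s≤s z≤n
          g≡ : r ∸ (i ∸ u) ≡ 1 + g′
          g≡ = trans (sym (m+[n∸m]≡n (m<n⇒0<n∸m i∸u<r))) (cong suc (trans (∸-+-assoc r (i ∸ u) 1)
                 (cong (r ∸_) (trans (+-comm (i ∸ u) 1) (sym (+-∸-assoc 1 (u≤i st)))))))

    startSlots : ℕ → ℕ → ℕ
    startSlots k i = sumFrom k i (λ i → length (D i))

    P₀ : ℕ
    P₀ = P (n ∸ r) r

    -- At the first `r` positions an edge may run across the cut to a vertex that comes late in the
    -- order, so these edges are kept out of the forest. Their colours alone leave a factor `M` per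
    -- chosen edge.
    start-phase : ∀ k i L → i + k ≡ r → State i 0 L [] →
      V (k + (n ∸ r)) i L * (q ^ length L * n ^ suc P₀)
      ≤ I * C₂ ^ length L * ((1 + M) ^ startSlots k i * ((n + 2 * Z) ^ P₀ * n))
    start-phase zero i L i+0≡r st with trans (sym (+-identityʳ i)) i+0≡r
    ... | refl = begin
      V (n ∸ i) i L * (q ^ length L * n ^ suc P₀)
        ≡⟨ cong (λ z → V (n ∸ i) i L * (z * n ^ suc P₀)) (*-identityʳ (q ^ length L)) ⟨
      V (n ∸ i) i L * (scale L [] * n ^ suc P₀)
        ≤⟨ forest-phase (n ∸ i) i 0 L [] (m+[n∸m]≡n r≤n) ≤-refl st ⟩
      weight L [] * ((n + 2 * Z) ^ P₀ * (n + 2 * Y * (i ∸ i)))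
        ≡⟨ cong₂ (λ w z → I * w * ((n + 2 * Z) ^ P₀ * z)) (*-identityʳ (C₂ ^ length L))
             (trans (cong (λ z → n + 2 * Y * z) (n∸n≡0 i)) (trans (cong (n +_) (*-zeroʳ (2 * Y))) (+-identityʳ n))) ⟩
      I * C₂ ^ length L * ((n + 2 * Z) ^ P₀ * n)
        ≡⟨ cong (I * C₂ ^ length L *_) (*-identityˡ ((n + 2 * Z) ^ P₀ * n)) ⟨
      I * C₂ ^ length L * (1 * ((n + 2 * Z) ^ P₀ * n)) ∎
    start-phase (suc k) i L i+k≡r st = begin
      V (suc (k + (n ∸ r))) i L * S
        ≡⟨ cong (_* S) (V-step (k + (n ∸ r)) i L) ⟩
      (V′ L + (∑[ b ∈ sublists⁺ (D i) ] (ν ^ length b * V′ (items i b ++ L)))) * S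
        ≡⟨ trans (*-distribʳ-+ S (V′ L) _) (cong (V′ L * S +_) (sym (∑-*ʳ (sublists⁺ (D i)) S _))) ⟩
      V′ L * S + (∑[ b ∈ sublists⁺ (D i) ] (ν ^ length b * V′ (items i b ++ L) * S))
        ≤⟨ +-mono-≤ (IH (skip st)) (∑-mono-∈ (sublists⁺ (D i)) each) ⟩
      K + (∑[ b ∈ sublists⁺ (D i) ] (∏ (λ _ → M) b * K))
        ≡⟨ cong (K +_) (∑-*ʳ (sublists⁺ (D i)) K (∏ (λ _ → M))) ⟩
      (1 + ∑ (sublists⁺ (D i)) (∏ (λ _ → M))) * K
        ≡⟨ cong (_* K) (trans (∑-sublists⁺ (λ _ → M) (D i)) (∏₁₊-const M (D i))) ⟩
      (1 + M) ^ length (D i) * K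
        ≡⟨ reorder ((1 + M) ^ length (D i)) (I * C₂ ^ length L) ((1 + M) ^ startSlots k (suc i)) ((n + 2 * Z) ^ P₀ * n) ⟩
      I * C₂ ^ length L * ((1 + M) ^ length (D i) * (1 + M) ^ startSlots k (suc i) * ((n + 2 * Z) ^ P₀ * n))
        ≡⟨ cong (λ z → I * C₂ ^ length L * (z * ((n + 2 * Z) ^ P₀ * n)))
             (^-distribˡ-+-* (1 + M) (length (D i)) (startSlots k (suc i))) ⟨
      I * C₂ ^ length L * ((1 + M) ^ (length (D i) + startSlots k (suc i)) * ((n + 2 * Z) ^ P₀ * n)) ∎
      where
      V′ : List Item → ℕ
      V′ = V (k + (n ∸ r)) (suc i)
      S R K : ℕ
      S = q ^ length L * n ^ suc P₀
      R = (1 + M) ^ startSlots k (suc i) * ((n + 2 * Z) ^ P₀ * n)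
      K = I * C₂ ^ length L * R
      i<n : i < n
      i<n = ≤-trans (≤-trans (m≤m+n (suc i) k) (≤-reflexive (trans (sym (+-suc i k)) i+k≡r))) r≤n
      IH : ∀ {L′} → State (suc i) 0 L′ [] → V′ L′ * (q ^ length L′ * n ^ suc P₀) ≤ I * C₂ ^ length L′ * R
      IH st′ = start-phase k (suc i) _ (trans (sym (+-suc i k)) i+k≡r) st′
      reorder : ∀ a b c d → a * (b * (c * d)) ≡ b * (a * c * d)
      reorder = solve-∀
      each : ∀ b → b ∈ sublists⁺ (D i) → ν ^ length b * V′ (items i b ++ L) * S ≤ ∏ (λ _ → M) b * K
      each b b∈ = begin
        ν ^ s * V′ (items i b ++ L) * (q ^ length L * n ^ suc P₀)
          ≡⟨ cong (λ z → z * V′ (items i b ++ L) * (q ^ length L * n ^ suc P₀)) (^-distribʳ-* μ q s) ⟩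
        μ ^ s * q ^ s * V′ (items i b ++ L) * (q ^ length L * n ^ suc P₀)
          ≡⟨ reorder₁ (μ ^ s) (q ^ s) (V′ (items i b ++ L)) (q ^ length L) (n ^ suc P₀) ⟩
        μ ^ s * (V′ (items i b ++ L) * (q ^ s * q ^ length L * n ^ suc P₀))
          ≡⟨ cong (λ z → μ ^ s * (V′ (items i b ++ L) * (z * n ^ suc P₀))) (split q) ⟩
        μ ^ s * (V′ (items i b ++ L) * (q ^ length (items i b ++ L) * n ^ suc P₀))
          ≤⟨ *-monoʳ-≤ (μ ^ s) (IH (choose i<n (sub-unique (sublists⁺-sub (D i) b∈) (D-unique i)) st)) ⟩
        μ ^ s * (I * C₂ ^ length (items i b ++ L) * R)
          ≡⟨ cong (λ z → μ ^ s * (I * z * R)) (split C₂) ⟨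
        μ ^ s * (I * (C₂ ^ s * C₂ ^ length L) * R)
          ≡⟨ reorder₂ (μ ^ s) I (C₂ ^ s) (C₂ ^ length L) R ⟩
        μ ^ s * C₂ ^ s * K
          ≡⟨ cong (_* K) (^-distribʳ-* μ C₂ s) ⟨
        M ^ s * K
          ≡⟨ cong (_* K) (∏-const M b) ⟨
        ∏ (λ _ → M) b * K ∎
        where
        s : ℕ
        s = length b
        split : ∀ a → a ^ s * a ^ length L ≡ a ^ length (items i b ++ L)
        split a = trans (sym (^-distribˡ-+-* a s (length L)))
          (cong (a ^_) (sym (trans (length-++ (items i b)) (cong (_+ length L) (length-map (item i) b)))))
        reorder₁ : ∀ a b v c e → a * b * v * (c * e) ≡ a * (v * (b * c * e))
        reorder₁ = solve-∀
        reorder₂ : ∀ a i b c R → a * (i * (b * c) * R) ≡ a * b * (i * c * R)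
        reorder₂ = solve-∀

    core : (∑[ B ∈ copies ] (1 + ν) ^ hits n 0 B) * n ^ P₀ ≤ I * ((1 + M) ^ startSlots r 0 * (n + 2 * Z) ^ P₀)
    core = *-cancelʳ-≤ _ _ n (begin
      (∑[ B ∈ copies ] (1 + ν) ^ hits n 0 B) * n ^ P₀ * n
        ≡⟨ cong (λ z → z * n ^ P₀ * n) (∑-cong copies λ B → sym (trans
             (cong₂ _*_ (𝟙-yes (sat? [] B) []) (trans (H≡ (r + (n ∸ r)) 0 B)
               (cong (λ m → (1 + ν) ^ hits m 0 B) (m+[n∸m]≡n r≤n)))) (*-identityˡ _))) ⟩
      V (r + (n ∸ r)) 0 [] * n ^ P₀ * n
        ≡⟨ reorder (V (r + (n ∸ r)) 0 []) (n ^ P₀) n ⟩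
      V (r + (n ∸ r)) 0 [] * (1 * n ^ suc P₀)
        ≤⟨ start-phase r 0 [] refl (initial 0) ⟩
      I * 1 * ((1 + M) ^ startSlots r 0 * ((n + 2 * Z) ^ P₀ * n))
        ≡⟨ reorder₂ I ((1 + M) ^ startSlots r 0) ((n + 2 * Z) ^ P₀) n ⟩
      I * ((1 + M) ^ startSlots r 0 * (n + 2 * Z) ^ P₀) * n ∎)
      where
      reorder : ∀ a b n → a * b * n ≡ a * (1 * (n * b))
      reorder = solve-∀
      reorder₂ : ∀ i a b n → i * 1 * (a * (b * n)) ≡ i * (a * b) * n
      reorder₂ = solve-∀

-- Intersections of copies

∑-filter : ∀ {A : Set} {Q : A → Set} (Q? : Decidable Q) xs f →
           ∑ (filter Q? xs) f ≡ ∑[ x ∈ xs ] (𝟙 (Q? x) * f x)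
∑-filter Q? [] f = trans (∑-[] f) (sym (∑-[] _))
∑-filter Q? (x ∷ xs) f with Q? x in eq
... | yes _ = trans (∑-∷ x _ f) (sym (trans (∑-∷ x xs _) (cong₂ _+_
        (trans (cong (λ d → 𝟙 d * f x) eq) (*-identityˡ (f x))) (sym (∑-filter Q? xs f)))))
... | no _  = trans (∑-filter Q? xs f) (sym (trans (∑-∷ x xs _) (cong (_+ (∑[ x ∈ xs ] (𝟙 (Q? x) * f x))) (cong (λ d → 𝟙 d * f x) eq))))

∑-allFin-suc : ∀ m f → ∑ (allFin (suc m)) f ≡ f zero + (∑[ k ∈ allFin m ] f (suc k))
∑-allFin-suc m f = trans (∑-∷ zero (tabulate suc) f) (cong (f zero +_)
  (trans (cong (λ xs → ∑ xs f) (sym (map-tabulate {n = m} (λ k → k) suc))) (∑-map suc (allFin m) f)))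

sumFrom-allFin : ∀ m i g → sumFrom m i g ≡ ∑[ k ∈ allFin m ] g (i + toℕ k)
sumFrom-allFin zero    i g = sym (∑-[] _)
sumFrom-allFin (suc m) i g = sym (trans (∑-allFin-suc m _) (cong₂ _+_ (cong g (+-identityʳ i))
  (trans (∑-cong (allFin m) λ k → cong g (+-suc i (toℕ k))) (sym (sumFrom-allFin m (suc i) g)))))

∑-allFin-point : ∀ {m} z (f : Fin m → ℕ) → ∑[ k ∈ allFin m ] (𝟙 (z Fin.≟ k) * f k) ≡ f z
∑-allFin-point {m} z f = trans (∑-cong (allFin m) pointwise)
  (trans (∑-*ʳ (allFin m) (f z) _) (trans (cong (_* f z) (∑-allFin-𝟙 z)) (*-identityˡ (f z))))
  where
  pointwise : ∀ k → 𝟙 (z Fin.≟ k) * f k ≡ 𝟙 (z Fin.≟ k) * f z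
  pointwise k with z Fin.≟ k
  ... | yes refl = refl
  ... | no _     = refl

∑-rows : ∀ {n r} (fl : List (Fin n × Fin r)) → List.Unique fl →
         let open DecMembership (≡-dec (Fin._≟_ {n}) (Fin._≟_ {r})) using (_∈?_) in
         ∀ f → ∑ fl f ≡ ∑[ i ∈ allFin n ] ∑[ d ∈ filter (λ d → (i , d) ∈? fl) (allFin r) ] f (i , d)
∑-rows {n} {r} fl uniq f = trans (expand fl uniq) (∑-cong (allFin n) λ i → sym (∑-filter (λ d → (i , d) ∈? fl) (allFin r) _))
  where
  open DecMembership (≡-dec (Fin._≟_ {n}) (Fin._≟_ {r})) using (_∈?_)
  expand : ∀ fl → List.Unique fl → ∑ fl f ≡ ∑[ i ∈ allFin n ] ∑[ d ∈ allFin r ] (𝟙 ((i , d) ∈? fl) * f (i , d))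
  expand [] _ = trans (∑-[] f) (sym (∑≡0 (allFin n) λ i _ → ∑-0 (allFin r)))
  expand ((j , e) ∷ fl) (∉fl ∷ uniq) = begin
    ∑ ((j , e) ∷ fl) f
      ≡⟨ trans (∑-∷ (j , e) fl f) (cong (f (j , e) +_) (expand fl uniq)) ⟩
    f (j , e) + (∑[ i ∈ allFin n ] ∑[ d ∈ allFin r ] (𝟙 ((i , d) ∈? fl) * f (i , d)))
      ≡⟨ cong (_+ R) (sym (∑-allFin-point j (λ i → f (i , e)))) ⟩
    (∑[ i ∈ allFin n ] (𝟙 (j Fin.≟ i) * f (i , e))) + (∑[ i ∈ allFin n ] ∑[ d ∈ allFin r ] (𝟙 ((i , d) ∈? fl) * f (i , d)))
      ≡⟨ ∑-+ (allFin n) _ _ ⟨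
    ∑[ i ∈ allFin n ] (𝟙 (j Fin.≟ i) * f (i , e) + (∑[ d ∈ allFin r ] (𝟙 ((i , d) ∈? fl) * f (i , d))))
      ≡⟨ ∑-cong (allFin n) (λ i → trans (cong (_+ _) (trans (cong (𝟙 (j Fin.≟ i) *_) (sym (∑-allFin-point e (λ d → f (i , d)))))
           (sym (∑-*ˡ (allFin r) (𝟙 (j Fin.≟ i)) _)))) (sym (∑-+ (allFin r) _ _))) ⟩
    ∑[ i ∈ allFin n ] ∑[ d ∈ allFin r ] (𝟙 (j Fin.≟ i) * (𝟙 (e Fin.≟ d) * f (i , d)) + 𝟙 ((i , d) ∈? fl) * f (i , d))
      ≡⟨ ∑-cong (allFin n) (λ i → ∑-cong (allFin r) λ d → pointwise i d) ⟩
    ∑[ i ∈ allFin n ] ∑[ d ∈ allFin r ] (𝟙 ((i , d) ∈? ((j , e) ∷ fl)) * f (i , d)) ∎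
    where
    open ≡-Reasoning
    R : ℕ
    R = ∑[ i ∈ allFin n ] ∑[ d ∈ allFin r ] (𝟙 ((i , d) ∈? fl) * f (i , d))
    pointwise : ∀ i d → 𝟙 (j Fin.≟ i) * (𝟙 (e Fin.≟ d) * f (i , d)) + 𝟙 ((i , d) ∈? fl) * f (i , d)
              ≡ 𝟙 ((i , d) ∈? ((j , e) ∷ fl)) * f (i , d)
    pointwise i d = by (j Fin.≟ i) (e Fin.≟ d) ((i , d) ∈? fl) ((i , d) ∈? ((j , e) ∷ fl))
      where
      by : (p : Dec (j ≡ i)) (p′ : Dec (e ≡ d)) (m : Dec ((i , d) ∈ fl)) (m′ : Dec ((i , d) ∈ (j , e) ∷ fl)) →
           𝟙 p * (𝟙 p′ * f (i , d)) + 𝟙 m * f (i , d) ≡ 𝟙 m′ * f (i , d)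
      by (yes refl) (yes refl) (yes ∈fl) m′ = ⊥-elim (ListAll.lookup ∉fl ∈fl refl)
      by (yes refl) (yes refl) (no _) m′ = trans (+-identityʳ _) (trans (*-identityˡ _)
        (cong (_* f (i , d)) (sym (𝟙-yes m′ (here refl)))))
      by (yes refl) (no e≢) m m′ = cong (_* f (i , d)) (𝟙-cong m m′ there λ
        { (here refl) → ⊥-elim (e≢ refl) ; (there ∈fl) → ∈fl })
      by (no j≢) p′ m m′ = cong (_* f (i , d)) (𝟙-cong m m′ there λ
        { (here refl) → ⊥-elim (j≢ refl) ; (there ∈fl) → ∈fl })

module Labels (n r q : ℕ) {{_ : NonZero n}} (r≤n : r ≤ n) where

  open Template n r q r≤n public

  Slot : Set
  Slot = Fin n × Fin r

  slot? : ∀ σ u v → Dec (Linked σ (u , v))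
  slot? σ u v = Fin.any? λ i → Fin.any? λ d → joins? σ i d u v

  theSlot : ∀ {σ u v} → Dec (Linked σ (u , v)) → Maybe Slot
  theSlot (yes (i , d , _)) = just (i , d)
  theSlot (no _)            = nothing

  -- If `n ≤ 2 * r`, a pair can be joined by several slots; the search settles on one, so that every
  -- edge of a copy has a single colour.
  slotOf : Arrangement → Fin n × Fin n → Maybe Slot
  slotOf σ (u , v) = theSlot {σ} {u} {v} (slot? σ u v)

  slotOf-joins : ∀ σ u v {i d} → slotOf σ (u , v) ≡ just (i , d) → Joins σ i d u v
  slotOf-joins σ u v = by (slot? σ u v)
    where
    by : ∀ s {i d} → theSlot {σ} {u} {v} s ≡ just (i , d) → Joins σ i d u v
    by (yes (i , d , joins)) refl = joins

  joins-slotOf : ∀ σ u v → Linked σ (u , v) → ∃[ i ] ∃[ d ] slotOf σ (u , v) ≡ just (i , d)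
  joins-slotOf σ u v l with slot? σ u v
  ... | yes (i , d , _) = i , d , refl
  ... | no ¬l = ⊥-elim (¬l l)

  slotLabel : Colouring → Maybe Slot → Maybe (Fin q)
  slotLabel π nothing        = nothing
  slotLabel π (just (i , d)) = just (lookup π (combine i d))

  label : Copy → Fin n × Fin n → Maybe (Fin q)
  label (σ , π) e = slotLabel π (slotOf σ e)

  config : Copy → ∀ (es : List (Fin n × Fin n)) → Config q (length es)
  config B []       = []
  config B (e ∷ es) = label B e ∷ config B es

  label-has : ∀ B u v c → label B (u , v) ≡ just c →
              ∃[ i ] ∃[ d ] slotOf (proj₁ B) (u , v) ≡ just (i , d) × lookup (proj₂ B) (combine i d) ≡ c
  label-has (σ , π) u v c eq with slotOf σ (u , v)
  ... | just (i , d) = i , d , refl , just-injective eq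

  slotItem : Copy → Slot → Item
  slotItem (σ , π) (i , d) = lookup σ i , lookup σ (back i d) , lookup π (combine i d)

  has-slotItem : ∀ A B u v c {i d} → Joins (proj₁ A) i d u v → lookup (proj₂ A) (combine i d) ≡ c →
                 label B (u , v) ≡ just c → Has B (slotItem A (i , d))
  has-slotItem A B u v c joins eq labelB with label-has B u v c labelB
  ... | j , e , slot≡ , eq′ = j , e , oriented joins (slotOf-joins (proj₁ B) u v slot≡) , trans eq′ (sym eq)
    where
    oriented : ∀ {i d} → Joins (proj₁ A) i d u v → Joins (proj₁ B) j e u v →
               Joins (proj₁ B) j e (lookup (proj₁ A) i) (lookup (proj₁ A) (back i d))
    oriented (inj₁ (refl , refl)) k = k
    oriented (inj₂ (refl , refl)) (inj₁ k) = inj₂ k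
    oriented (inj₂ (refl , refl)) (inj₂ k) = inj₁ k

  consMaybe : Maybe Slot → List Slot → List Slot
  consMaybe nothing  fl = fl
  consMaybe (just s) fl = s ∷ fl

  flags : Copy → ∀ (es : List (Fin n × Fin n)) → Config q (length es) → List Slot
  flags A []       []            = []
  flags A (e ∷ es) (nothing ∷ F) = flags A es F
  flags A (e ∷ es) (just _ ∷ F)  = consMaybe (slotOf (proj₁ A) e) (flags A es F)

  flags-length : ∀ A (es : List (Fin n × Fin n)) (F : Config q (length es)) → length (flags A es F) ≤ size F
  flags-length A []       []            = z≤n
  flags-length A (e ∷ es) (nothing ∷ F) = flags-length A es F
  flags-length A (e ∷ es) (just _ ∷ F) with slotOf (proj₁ A) e
  ... | nothing = m≤n⇒m≤1+n (flags-length A es F)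
  ... | just _  = s≤s (flags-length A es F)

  -- Translates a common coloured edge into a slot of `A` whose edge and colour also occur in `B`,
  -- the form in which `Core` counts intersections.
  flags-hits : ∀ A B (es : List (Fin n × Fin n)) (F : Config q (length es)) → F ⊆ᶜ config A es →
               size (F ⊓ᶜ config B es) ≤ ∑[ s ∈ flags A es F ] 𝟙 (has? B (slotItem A s))
  flags-hits A B []       []            _ = z≤n
  flags-hits A B (e ∷ es) (nothing ∷ F) (_ , F⊆) = flags-hits A B es F F⊆
  flags-hits A B ((u , v) ∷ es) (just c ∷ F) (l , F⊆) with label-has A u v c l
  ... | i , d , slot≡ , colour≡ rewrite slot≡ = ≤-trans
          (+-mono-≤ (head (label B (u , v)) refl) (flags-hits A B es F F⊆)) (≤-reflexive (sym (∑-∷ _ _ _)))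
    where
    head : ∀ l′ → l′ ≡ label B (u , v) → size₁ (meet₁ (just c) l′) ≤ 𝟙 (has? B (slotItem A (i , d)))
    head nothing  _ = z≤n
    head (just c′) eq with c Fin.≟ c′
    ... | no _ = z≤n
    ... | yes refl = ≤-reflexive (sym (𝟙-yes (has? B (slotItem A (i , d)))
            (has-slotItem A B u v c (slotOf-joins (proj₁ A) u v slot≡) colour≡ (sym eq))))

  flags-∈ : ∀ A (es : List (Fin n × Fin n)) (F : Config q (length es)) {s} → s ∈ flags A es F → ∃[ e ] e ∈ es × slotOf (proj₁ A) e ≡ just s
  flags-∈ A [] [] ()
  flags-∈ A (e ∷ es) (nothing ∷ F) s∈ with flags-∈ A es F s∈
  ... | e′ , e′∈ , eq = e′ , there e′∈ , eq
  flags-∈ A (e ∷ es) (just _ ∷ F) s∈ with slotOf (proj₁ A) e in slot≡ | s∈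
  ... | just s  | here refl = e , here refl , slot≡
  ... | just s  | there s∈′ with flags-∈ A es F s∈′
  ...   | e′ , e′∈ , eq = e′ , there e′∈ , eq
  flags-∈ A (e ∷ es) (just _ ∷ F) s∈ | nothing | s∈′ with flags-∈ A es F s∈′
  ...   | e′ , e′∈ , eq = e′ , there e′∈ , eq

  Sorted : Fin n × Fin n → Set
  Sorted (u , v) = toℕ u < toℕ v

  slotOf-injective : ∀ σ e e′ {s} → Sorted e → Sorted e′ → slotOf σ e ≡ just s → slotOf σ e′ ≡ just s → e ≡ e′
  slotOf-injective σ (u , v) (u′ , v′) u<v u′<v′ eq eq′
    with slotOf-joins σ u v eq | slotOf-joins σ u′ v′ eq′
  ... | inj₁ (refl , refl) | inj₁ (refl , refl) = refl
  ... | inj₂ (refl , refl) | inj₂ (refl , refl) = refl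
  ... | inj₁ (refl , refl) | inj₂ (refl , refl) = ⊥-elim (<-asym u<v u′<v′)
  ... | inj₂ (refl , refl) | inj₁ (refl , refl) = ⊥-elim (<-asym u<v u′<v′)

  flags-unique : ∀ A (es : List (Fin n × Fin n)) (F : Config q (length es)) → (∀ {e} → e ∈ es → Sorted e) → List.Unique es → List.Unique (flags A es F)
  flags-unique A []       []            sorted _ = []
  flags-unique A (e ∷ es) (nothing ∷ F) sorted (_ ∷ u) = flags-unique A es F (λ e∈ → sorted (there e∈)) u
  flags-unique A (e ∷ es) (just _ ∷ F)  sorted (e∉ ∷ u) with slotOf (proj₁ A) e in slot≡
  ... | nothing = flags-unique A es F (λ e∈ → sorted (there e∈)) u
  ... | just s  = ListAll.tabulate (λ {s′} s′∈ s≡s′ → let (e′ , e′∈ , eq) = flags-∈ A es F s′∈ in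
                    ListAll.lookup e∉ e′∈ (slotOf-injective (proj₁ A) e e′ (sorted (here refl)) (sorted (there e′∈))
                      slot≡ (trans eq (cong just (sym s≡s′)))))
                  ∷ flags-unique A es F (λ e∈ → sorted (there e∈)) u

  copies-∈ : ∀ {B} → B ∈ copies → proj₁ B ∈ injections n n × proj₂ B ∈ injections (n * r) q
  copies-∈ B∈ with find (∈-concatMap⁻ _ {xs = injections n n} B∈)
  ... | σ , σ∈ , B∈σ with ∈-map⁻ (σ ,_) B∈σ
  ...   | π , π∈ , refl = σ∈ , π∈

-- Replaces `(1 + a/n)^n ≤ e^a`.
^-bound : ∀ n a → (n + a) ^ n ≤ 8 ^ a * n ^ n
^-bound n zero    = ≤-reflexive (trans (cong (_^ n) (+-identityʳ n)) (sym (*-identityˡ _)))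
^-bound n (suc a) = begin
  (n + suc a) ^ n           ≡⟨ cong (_^ n) (+-suc n a) ⟩
  (1 + (n + a)) ^ n         ≤⟨ [1+q]^s≤8*q^s n (n + a) (m≤m+n n a) ⟩
  8 * (n + a) ^ n           ≤⟨ *-monoʳ-≤ 8 (^-bound n a) ⟩
  8 * (8 ^ a * n ^ n)       ≡⟨ *-assoc 8 (8 ^ a) (n ^ n) ⟨
  8 ^ suc a * n ^ n ∎
  where open ≤-Reasoning

raise-power : ∀ {V K a b} P t → P ≤ t → a ≤ b → V * a ^ P ≤ K * b ^ P → V * a ^ t ≤ K * b ^ t
raise-power {V} {K} {a} {b} P t P≤t a≤b h with m≤n⇒∃[o]m+o≡n P≤t
... | o , refl = begin
  V * a ^ (P + o)       ≡⟨ cong (V *_) (^-distribˡ-+-* a P o) ⟩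
  V * (a ^ P * a ^ o)   ≡⟨ *-assoc V _ _ ⟨
  V * a ^ P * a ^ o     ≤⟨ *-mono-≤ h (^-monoˡ-≤ o a≤b) ⟩
  K * b ^ P * b ^ o     ≡⟨ *-assoc K _ _ ⟩
  K * (b ^ P * b ^ o)   ≡⟨ cong (K *_) (^-distribˡ-+-* b P o) ⟨
  K * b ^ (P + o) ∎
  where open ≤-Reasoning

module Rotation (n : ℕ) {{_ : NonZero n}} (i0 : ℕ) (i0<n : i0 < n) where

  open Cyclic n

  turn turn⁻¹ : Fin n → Fin n
  turn   k = pos (i0 + toℕ k)
  turn⁻¹ i = pos (toℕ i + (n ∸ i0))

  turn-turn⁻¹ : ∀ i → turn (turn⁻¹ i) ≡ i
  turn-turn⁻¹ i = trans (cong pos (+-comm i0 _)) (trans (pos-+ (toℕ i + (n ∸ i0)) i0)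
    (trans (cong pos (trans (+-assoc (toℕ i) _ _) (cong (toℕ i +_) (m∸n+n≡m (<⇒≤ i0<n)))))
      (trans (pos-+n (toℕ i)) (pos-toℕ i))))

  turn⁻¹-pos : ∀ k → pos (toℕ (pos (i0 + k)) + (n ∸ i0)) ≡ pos k
  turn⁻¹-pos k = trans (pos-+ (i0 + k) (n ∸ i0))
    (trans (cong pos (trans (cong (_+ (n ∸ i0)) (+-comm i0 k)) (trans (+-assoc k i0 _)
      (cong (k +_) (m+[n∸m]≡n (<⇒≤ i0<n)))))) (pos-+n k))

  shifted-injective : ∀ {i j} → i < n → j < n → pos (i0 + i) ≡ pos (i0 + j) → i ≡ j
  shifted-injective {i} {j} i<n j<n eq = pos-injective i<n j<n
    (trans (sym (turn⁻¹-pos i)) (trans (cong (λ z → pos (toℕ z + (n ∸ i0))) eq) (turn⁻¹-pos j)))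

  ∑-turn : ∀ f → ∑[ k ∈ allFin n ] f (turn k) ≡ ∑ (allFin n) f
  ∑-turn f = begin
    ∑[ k ∈ allFin n ] f (turn k)
      ≡⟨ ∑-cong (allFin n) (λ k → sym (∑-allFin-point (turn k) f)) ⟩
    ∑[ k ∈ allFin n ] ∑[ i ∈ allFin n ] (𝟙 (turn k Fin.≟ i) * f i)
      ≡⟨ ∑-swap (allFin n) (allFin n) _ ⟩
    ∑[ i ∈ allFin n ] ∑[ k ∈ allFin n ] (𝟙 (turn k Fin.≟ i) * f i)
      ≡⟨ ∑-cong (allFin n) (λ i → ∑-*ʳ (allFin n) (f i) _) ⟩
    ∑[ i ∈ allFin n ] ((∑[ k ∈ allFin n ] 𝟙 (turn k Fin.≟ i)) * f i)
      ≡⟨ ∑-cong (allFin n) (λ i → trans (cong (_* f i) (trans (∑-cong (allFin n) λ k →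
           𝟙-cong (turn k Fin.≟ i) (turn⁻¹ i Fin.≟ k)
             (λ { refl → trans (turn⁻¹-pos (toℕ k)) (pos-toℕ k) }) (λ { refl → turn-turn⁻¹ i }))
           (∑-allFin-𝟙 (turn⁻¹ i)))) (*-identityˡ (f i))) ⟩
    ∑ (allFin n) f ∎
    where open ≡-Reasoning

module Spread (n r q μ : ℕ) {{_ : NonZero n}} (r≤n : r ≤ n) where

  open Labels n r q r≤n public
  open DecMembership (≡-dec (Fin._≟_ {n}) (Fin._≟_ {r})) using (_∈?_)

  ν M Y Z : ℕ
  ν = μ * q
  M = μ * C₂
  Y = 2 ^ r * (M ^ r * C₁)
  Z = 2 ^ r * (M * C₁)

  module Rotated (σ : Arrangement) (π : Colouring) (σ∈ : σ ∈ injections n n) (π∈ : π ∈ injections (n * r) q)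
    (fl : List Slot) (fl-unique : List.Unique fl) (i0 : ℕ) (i0<n : i0 < n) where

    open Rotation n i0 i0<n

    row : Fin n → List (Fin r)
    row i = filter (λ d → (i , d) ∈? fl) (allFin r)

    x : ℕ → Fin n
    x i = lookup σ (pos (i0 + i))

    y : ℕ → Fin r → Fin n
    y i d = lookup σ (back (pos (i0 + i)) d)

    κ : ℕ → Fin r → Fin q
    κ i d = lookup π (combine (pos (i0 + i)) d)

    D : ℕ → List (Fin r)
    D i = row (pos (i0 + i))

    x-injective : ∀ {i j} → i < n → j < n → x i ≡ x j → i ≡ j
    x-injective i<n j<n eq = shifted-injective i<n j<n (Unique.lookup-injective (injections-unique n n σ∈) _ _ eq)

    κ-injective : ∀ {i j d d′} → i < n → j < n → κ i d ≡ κ j d′ → i ≡ j × d ≡ d′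
    κ-injective {i} {j} {d} {d′} i<n j<n eq =
      shifted-injective i<n j<n (Fin.combine-injectiveˡ _ d _ d′ eq′) , Fin.combine-injectiveʳ (pos (i0 + i)) d (pos (i0 + j)) d′ eq′
      where
      eq′ : combine (pos (i0 + i)) d ≡ combine (pos (i0 + j)) d′
      eq′ = Unique.lookup-injective (injections-unique (n * r) q π∈) _ _ eq

    y≡ : ∀ {i} d → r ≤ i → i < n → y i d ≡ x (i ∸ suc (toℕ d))
    y≡ {i} d r≤i i<n = cong (lookup σ) (trans (pos-+ (i0 + i) (n ∸ suc (toℕ d)))
      (trans (cong pos shift) (pos-+n (i0 + (i ∸ suc (toℕ d))))))
      where
      d<i : suc (toℕ d) ≤ i
      d<i = ≤-trans (Fin.toℕ<n d) r≤i
      shift : i0 + i + (n ∸ suc (toℕ d)) ≡ i0 + (i ∸ suc (toℕ d)) + n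
      shift = begin
        i0 + i + (n ∸ e)           ≡⟨ cong (λ z → i0 + z + (n ∸ e)) (m∸n+n≡m d<i) ⟨
        i0 + (i ∸ e + e) + (n ∸ e) ≡⟨ regroup i0 (i ∸ e) e (n ∸ e) ⟩
        i0 + (i ∸ e) + (e + (n ∸ e)) ≡⟨ cong (i0 + (i ∸ e) +_) (m+[n∸m]≡n (suc-d≤n d)) ⟩
        i0 + (i ∸ e) + n ∎
        where
        open ≡-Reasoning
        e : ℕ
        e = suc (toℕ d)
        regroup : ∀ a b e c → a + (b + e) + c ≡ a + b + (e + c)
        regroup = solve-∀

    row-length : ∀ i → length (row i) ≤ r
    row-length i = ≤-trans (length-filter (λ d → (i , d) ∈? fl) (allFin r)) (≤-reflexive (length-allFin r))

    open Core n r q μ r≤n x y κ D x-injective κ-injective y≡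
      (λ i → ListUnique.filter⁺ _ (ListUnique.allFin⁺ r)) (λ i → row-length (pos (i0 + i)))
      using (hits; P; flagged; item; module Bound) public

    ∑-rotated : ∀ f → sumFrom n 0 (λ i → f (pos (i0 + i))) ≡ ∑ (allFin n) f
    ∑-rotated f = trans (sumFrom-allFin n 0 _) (∑-turn f)

    hits≡ : ∀ B → hits n 0 B ≡ ∑[ s ∈ fl ] 𝟙 (has? B (slotItem (σ , π) s))
    hits≡ B = trans (∑-rotated (λ i → ∑[ d ∈ row i ] 𝟙 (has? B (slotItem (σ , π) (i , d)))))
      (sym (∑-rows fl fl-unique (λ s → 𝟙 (has? B (slotItem (σ , π) s)))))

    flagged≤length : ∀ ds → flagged ds ≤ length ds
    flagged≤length []      = z≤n
    flagged≤length (_ ∷ _) = s≤s z≤n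

    flagged≤1 : ∀ ds → flagged ds ≤ 1
    flagged≤1 []      = z≤n
    flagged≤1 (_ ∷ _) = s≤s z≤n

    total-flagged : sumFrom n 0 (λ i → length (D i)) ≡ length fl
    total-flagged = trans (∑-rotated (λ i → length (row i)))
      (trans (∑-cong (allFin n) λ i → sym (trans (∑-const (row i) 1) (*-identityʳ _)))
        (trans (sym (∑-rows fl fl-unique (λ _ → 1))) (trans (∑-const fl 1) (*-identityʳ _))))

    flagged-rows : P n 0 ≤ length fl
    flagged-rows = ≤-trans (sumFrom-mono n 0 λ i _ _ → flagged≤length (D i)) (≤-reflexive total-flagged)

    later-rows : P (n ∸ r) r ≤ P n 0
    later-rows = ≤-trans (m≤n+m _ (P r 0)) (≤-reflexive (trans
      (cong (λ z → P r 0 + P (n ∸ r) z) (sym (+-identityʳ r)))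
      (trans (sym (sumFrom-+ r (n ∸ r) 0 _)) (cong (λ m → P m 0) (m+[n∸m]≡n r≤n)))))

    later-rows-n : P (n ∸ r) r ≤ n
    later-rows-n = ≤-trans (sumFrom-mono (n ∸ r) r λ i _ _ → flagged≤1 (D i))
      (≤-trans (≤-reflexive (trans (sumFrom-const (n ∸ r) r 1) (*-identityʳ _))) (m∸n≤m n r))

  module Bounds (1≤M : 1 ≤ M) (n-large : M ^ r * C₁ ≤ n) (n-large′ : 2 * Y * r ≤ n)
    (σ : Arrangement) (π : Colouring) (σ∈ : σ ∈ injections n n) (π∈ : π ∈ injections (n * r) q)
    (fl : List Slot) (fl-unique : List.Unique fl) where

    common : Copy → ℕ
    common B = ∑[ s ∈ fl ] 𝟙 (has? B (slotItem (σ , π) s))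

    mass : ℕ
    mass = ∑[ B ∈ copies ] (1 + ν) ^ common B

    open ≤-Reasoning

    -- Any place may be cut here: the at most `r * r` edges at the start cost a factor `1 + M` each,
    -- and at most `n` factors `1 + 2 * Z / n` stay below `8 ^ (2 * Z)`. The result is exp(O(m)),
    -- which `2 ^ t` can beat.
    mass-≤ : mass ≤ I * ((1 + M) ^ (r * r) * 8 ^ (2 * Z))
    mass-≤ = *-cancelʳ-≤ _ _ (n ^ n) {{m^n≢0 n n}} (begin
      mass * n ^ n
        ≤⟨ raise-power {mass} {I * (1 + M) ^ (r * r)} P₀ n later-rows-n (m≤m+n n (2 * Z)) (begin
             mass * n ^ P₀
               ≡⟨ cong (_* n ^ P₀) (∑-cong copies λ B → cong ((1 + ν) ^_) (sym (hits≡ B))) ⟩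
             (∑[ B ∈ copies ] (1 + ν) ^ hits n 0 B) * n ^ P₀
               ≤⟨ core ⟩
             I * ((1 + M) ^ startSlots r 0 * (n + 2 * Z) ^ P₀)
               ≤⟨ *-monoʳ-≤ I (*-monoˡ-≤ ((n + 2 * Z) ^ P₀) (^-monoʳ-≤ (1 + M) start≤)) ⟩
             I * ((1 + M) ^ (r * r) * (n + 2 * Z) ^ P₀)
               ≡⟨ *-assoc I _ _ ⟨
             I * (1 + M) ^ (r * r) * (n + 2 * Z) ^ P₀ ∎) ⟩
      I * (1 + M) ^ (r * r) * (n + 2 * Z) ^ n
        ≤⟨ *-monoʳ-≤ (I * (1 + M) ^ (r * r)) (^-bound n (2 * Z)) ⟩
      I * (1 + M) ^ (r * r) * (8 ^ (2 * Z) * n ^ n)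
        ≡⟨ reorder I ((1 + M) ^ (r * r)) (8 ^ (2 * Z)) (n ^ n) ⟩
      I * ((1 + M) ^ (r * r) * 8 ^ (2 * Z)) * n ^ n ∎)
      where
      open Rotated σ π σ∈ π∈ fl fl-unique 0 (>-nonZero⁻¹ n)
      open Bound 1≤M n-large n-large′
      start≤ : startSlots r 0 ≤ r * r
      start≤ = ≤-trans (sumFrom-mono r 0 λ i _ _ → row-length (pos i)) (≤-reflexive (sumFrom-const r 0 r))
      reorder : ∀ a b c d → a * b * (c * d) ≡ a * (b * c) * d
      reorder = solve-∀

    -- A cyclic interval of r unflagged positions lets us cut the cycle open
    -- there without cutting a flagged edge.
    mass-small : ∀ t → length fl < t → t * r ≤ n → 1 ≤ r → mass * n ^ t ≤ I * (n + 2 * Z) ^ t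
    mass-small t fl<t tr≤n 1≤r with zero-block r t 0 (λ i → flag₀.flagged (flag₀.D i))
        (<-≤-trans (s≤s (≤-trans restrict flag₀.flagged-rows)) fl<t)
      where
      module flag₀ = Rotated σ π σ∈ π∈ fl fl-unique 0 (>-nonZero⁻¹ n)
      restrict : sumFrom (t * r) 0 (λ i → flag₀.flagged (flag₀.D i)) ≤ flag₀.P n 0
      restrict = ≤-trans (m≤m+n _ _) (≤-reflexive (trans (sym (sumFrom-+ (t * r) (n ∸ t * r) 0 _))
        (cong (λ m → flag₀.P m 0) (m+[n∸m]≡n tr≤n))))
    ... | j , j+r≤ , zeros = raise-power {mass} {I} P₀ t
          (≤-trans later-rows (≤-trans flagged-rows (<⇒≤ fl<t))) (m≤m+n n (2 * Z)) (begin
        mass * n ^ P₀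
          ≡⟨ cong (_* n ^ P₀) (∑-cong copies λ B → cong ((1 + ν) ^_) (sym (hits≡ B))) ⟩
        (∑[ B ∈ copies ] (1 + ν) ^ hits n 0 B) * n ^ P₀
          ≤⟨ core ⟩
        I * ((1 + M) ^ startSlots r 0 * (n + 2 * Z) ^ P₀)
          ≡⟨ cong (λ z → I * ((1 + M) ^ z * (n + 2 * Z) ^ P₀)) no-start ⟩
        I * (1 * (n + 2 * Z) ^ P₀)
          ≡⟨ cong (I *_) (*-identityˡ _) ⟩
        I * (n + 2 * Z) ^ P₀ ∎)
      where
      j<n : j < n
      j<n = ≤-trans (≤-trans (≤-reflexive (+-comm 1 j)) (+-monoʳ-≤ j 1≤r))
              (≤-trans j+r≤ (≤-trans (≤-reflexive (+-identityʳ (t * r))) tr≤n))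
      open Rotated σ π σ∈ π∈ fl fl-unique j j<n
      open Bound 1≤M n-large n-large′
      empty : ∀ ds → flagged ds ≡ 0 → length ds ≤ 0
      empty [] _ = z≤n
      no-start : startSlots r 0 ≡ 0
      no-start = n≤0⇒n≡0 (≤-trans (sumFrom-mono r 0 λ i _ i<r → empty (D i) (zeros i i<r))
        (≤-reflexive (trans (sumFrom-const r 0 0) (*-zeroʳ r))))

-- The two spread conditions for the family of copies

-- The `m * q` blanks give every coloured edge the probability `1 / (suc m * q)`; thus `suc m` is
-- the m of the overview.
tokens : ∀ q → ℕ → List (Maybe (Fin q))
tokens q m = map just (allFin q) ++ replicate (m * q) nothing

length-tokens : ∀ q m → length (tokens q m) ≡ suc m * q
length-tokens q m = trans (length-++ (map just (allFin q))) (cong₂ _+_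
  (trans (length-map just (allFin q)) (length-allFin q)) (length-replicate (m * q)))

tokens-1 : ∀ q m c → ∑[ w ∈ tokens q m ] 𝟙 (just c ⊑? w) ≡ 1
tokens-1 q m c = trans (∑-++ (map just (allFin q)) (replicate (m * q) nothing) _) (cong₂ _+_
  (trans (∑-map just (allFin q) _) (trans (∑-cong (allFin q) λ d →
    𝟙-cong (just c ⊑? just d) (c Fin.≟ d) (λ e → sym (just-injective e)) (λ e → cong just (sym e))) (∑-allFin-𝟙 c)))
  (∑≡0 (replicate (m * q) nothing) λ w w∈ → absent (m * q) w∈))
  where
  absent : ∀ k {w} → w ∈ replicate k nothing → 𝟙 (just c ⊑? w) ≡ 0
  absent (suc k) (here refl) = refl
  absent (suc k) (there w∈)  = absent k w∈

module Count (n r q D m t : ℕ) {{_ : NonZero n}} (r≤n : r ≤ n) where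

  open Spread n r q (2 * suc m) r≤n

  N : ℕ
  N = length (tokens q m)

  ν≡ : ν ≡ 2 * N
  ν≡ = trans (*-assoc 2 (suc m) q) (cong (2 *_) (sym (length-tokens q m)))

  -- `ν` is twice `N`, so every common edge carries a spare factor 2; with at least `t` of them this
  -- is a gain of `2 ^ t`.
  large-power : ∀ s → 𝟙 (t ≤? s) * N ^ s * 2 ^ t ≤ (1 + ν) ^ s
  large-power s = begin
    𝟙 (t ≤? s) * N ^ s * 2 ^ t     ≡⟨ *-assoc (𝟙 (t ≤? s)) (N ^ s) (2 ^ t) ⟩
    𝟙 (t ≤? s) * (N ^ s * 2 ^ t)   ≤⟨ 𝟙*≤ (t ≤? s) (λ t≤s → *-monoʳ-≤ (N ^ s) (^-monoʳ-≤ 2 t≤s)) ⟩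
    N ^ s * 2 ^ s                  ≡⟨ ^-distribʳ-* N 2 s ⟨
    (N * 2) ^ s                    ≤⟨ ^-monoˡ-≤ s (≤-trans (≤-reflexive (trans (*-comm N 2) (sym ν≡))) (n≤1+n ν)) ⟩
    (1 + ν) ^ s ∎
    where open ≤-Reasoning

  -- The `1` allows the number `I` of all copies to be subtracted from the mass, which leaves the
  -- nonempty intersections.
  small-power : ∀ s → 𝟙 (1 ≤? s) * N ^ s + 1 ≤ (1 + ν) ^ s
  small-power zero    = ≤-refl
  small-power (suc s) = begin
    1 * N ^ suc s + 1              ≡⟨ cong (_+ 1) (*-identityˡ (N ^ suc s)) ⟩
    N * N ^ s + 1                  ≡⟨ +-comm _ 1 ⟩
    1 + N * N ^ s                  ≤⟨ +-mono-≤ (m^n>0 (1 + ν) s) (*-mono-≤ N≤ν (^-monoˡ-≤ s (≤-trans N≤ν (n≤1+n ν)))) ⟩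
    (1 + ν) ^ s + ν * (1 + ν) ^ s  ∎
    where
    open ≤-Reasoning
    N≤ν : N ≤ ν
    N≤ν = ≤-trans (m≤m+n N (N + 0)) (≤-reflexive (sym ν≡))

  module _ (es : List (Fin n × Fin n)) (sorted : ∀ {e} → e ∈ es → Sorted e) (es-unique : List.Unique es)
    (1≤M : 1 ≤ M) (n-large : M ^ r * C₁ ≤ n) (n-large′ : 2 * Y * r ≤ n)
    (nr≤q : n * r ≤ q) (1≤r : 1 ≤ r) (tr≤n : t * r ≤ n)
    (t-large : D * D * ((1 + M) ^ (r * r) * 8 ^ (2 * Z)) ≤ 2 ^ t)
    (n-large″ : (1 + D) * (2 * Z * t) < n) where

    open ≤-Reasoning

    family : List (Config q (length es))
    family = map (λ B → config B es) copies

    family-∈ : ∀ {A} → A ∈ family → ∃[ B ] B ∈ copies × A ≡ config B es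
    family-∈ A∈ with ∈-map⁻ (λ B → config B es) A∈
    ... | B , B∈ , eq = B , B∈ , eq

    ∑-family : ∀ f → ∑ family f ≡ ∑[ B ∈ copies ] f (config B es)
    ∑-family f = ∑-map (λ B → config B es) copies f

    length-family : length family ≡ I
    length-family = trans (length-map _ copies) (trans (sym (*-identityʳ _)) (trans (sym (∑-const copies 1)) ∑-copies-1))

    module Fragment (A : Copy) (A∈ : A ∈ copies) (F : Config q (length es)) (F⊆A : F ⊆ᶜ config A es) where

      open Bounds 1≤M n-large n-large′ (proj₁ A) (proj₂ A) (proj₁ (copies-∈ A∈)) (proj₂ (copies-∈ A∈))
        (flags A es F) (flags-unique A es F sorted es-unique) using (mass; mass-≤; mass-small) public

      meet : Copy → ℕ
      meet B = size (F ⊓ᶜ config B es)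

      ∑-meet≤mass : ∑[ B ∈ copies ] (1 + ν) ^ meet B ≤ mass
      ∑-meet≤mass = ∑-mono copies λ B → ^-monoʳ-≤ (1 + ν) (flags-hits A B es F F⊆A)

    spread-large : D * D * (∑[ A ∈ family ] ∑[ B ∈ family ] (𝟙 (t ≤? size (A ⊓ᶜ B)) * N ^ size (A ⊓ᶜ B)))
                   ≤ length family * length family
    spread-large = *-cancelʳ-≤ _ _ (2 ^ t) {{m^n≢0 2 t}} (begin
      D * D * (∑[ A ∈ family ] ∑[ B ∈ family ] (𝟙 (t ≤? size (A ⊓ᶜ B)) * N ^ size (A ⊓ᶜ B))) * 2 ^ t
        ≡⟨ cong (λ z → D * D * z * 2 ^ t) (trans (∑-family _) (∑-cong copies λ A → ∑-family _)) ⟩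
      D * D * S * 2 ^ t
        ≡⟨ *-assoc (D * D) S (2 ^ t) ⟩
      D * D * (S * 2 ^ t)
        ≤⟨ *-monoʳ-≤ (D * D) S≤ ⟩
      D * D * (I * (I * ((1 + M) ^ (r * r) * 8 ^ (2 * Z))))
        ≡⟨ reorder (D * D) I ((1 + M) ^ (r * r) * 8 ^ (2 * Z)) ⟩
      I * I * (D * D * ((1 + M) ^ (r * r) * 8 ^ (2 * Z)))
        ≤⟨ *-monoʳ-≤ (I * I) t-large ⟩
      I * I * 2 ^ t
        ≡⟨ cong (λ z → z * z * 2 ^ t) length-family ⟨
      length family * length family * 2 ^ t ∎)
      where
      reorder : ∀ a i b → a * (i * (i * b)) ≡ i * i * (a * b)
      reorder = solve-∀
      meets : Copy → Copy → ℕ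
      meets A B = size (config A es ⊓ᶜ config B es)
      S : ℕ
      S = ∑[ A ∈ copies ] ∑[ B ∈ copies ] (𝟙 (t ≤? meets A B) * N ^ meets A B)
      S≤ : S * 2 ^ t ≤ I * (I * ((1 + M) ^ (r * r) * 8 ^ (2 * Z)))
      S≤ = begin
        S * 2 ^ t
          ≡⟨ ∑-*ʳ copies (2 ^ t) _ ⟨
        ∑[ A ∈ copies ] ((∑[ B ∈ copies ] (𝟙 (t ≤? meets A B) * N ^ meets A B)) * 2 ^ t)
          ≤⟨ ∑-mono-∈ copies (λ A A∈ → let open Fragment A A∈ (config A es) (⊆ᶜ-refl (config A es)) in
               ≤-trans (≤-reflexive (sym (∑-*ʳ copies (2 ^ t) _))) (≤-trans (∑-mono copies λ B → large-power (meets A B))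
                 (≤-trans ∑-meet≤mass mass-≤))) ⟩
        ∑[ A ∈ copies ] (I * ((1 + M) ^ (r * r) * 8 ^ (2 * Z)))
          ≡⟨ trans (∑-cong copies λ _ → sym (*-identityˡ _)) (trans (∑-*ʳ copies _ (λ _ → 1)) (cong (_* (I * ((1 + M) ^ (r * r) * 8 ^ (2 * Z)))) ∑-copies-1)) ⟩
        I * (I * ((1 + M) ^ (r * r) * 8 ^ (2 * Z))) ∎

    -- Since `T + I ≤ mass`, a mass close to `I` leaves little for `T`. `mass-small` bounds the
    -- ratio of the two by `(1 + 2 * Z / n) ^ t`, and `bernoulli-≤` bounds this by `n / (n - a)`
    -- with `a = 2 * Z * t`.
    spread-small : ∀ A → A ∈ family → ∀ F → F ⊆ᶜ A → size F < t →
                   D * (∑[ B ∈ family ] (𝟙 (1 ≤? size (F ⊓ᶜ B)) * N ^ size (F ⊓ᶜ B))) ≤ length family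
    spread-small A A∈ F F⊆A F<t with family-∈ A∈
    ... | A′ , A′∈ , refl = subst₂ _≤_ (cong (D *_) (sym (∑-family _))) (sym length-family) (conclude (2 * Z * t) n-large″ T+I≤)
      where
      open Fragment A′ A′∈ F F⊆A
      T : ℕ
      T = ∑[ B ∈ copies ] (𝟙 (1 ≤? meet B) * N ^ meet B)
      T+I≤ : (T + I) * (n ∸ 2 * Z * t) ≤ I * n
      T+I≤ = *-cancelʳ-≤ _ _ (n ^ t) {{m^n≢0 n t}} (begin
        (T + I) * (n ∸ 2 * Z * t) * n ^ t
          ≤⟨ *-monoˡ-≤ (n ^ t) (*-monoˡ-≤ (n ∸ 2 * Z * t) (begin
               T + I                                    ≡⟨ cong (T +_) (sym ∑-copies-1) ⟩
               T + ∑ copies (λ _ → 1)                   ≡⟨ ∑-+ copies _ _ ⟨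
               ∑[ B ∈ copies ] (𝟙 (1 ≤? meet B) * N ^ meet B + 1) ≤⟨ ∑-mono copies (λ B → small-power (meet B)) ⟩
               ∑[ B ∈ copies ] (1 + ν) ^ meet B         ≤⟨ ∑-meet≤mass ⟩
               mass ∎)) ⟩
        mass * (n ∸ 2 * Z * t) * n ^ t
          ≡⟨ reorder mass (n ∸ 2 * Z * t) (n ^ t) ⟩
        mass * n ^ t * (n ∸ 2 * Z * t)
          ≤⟨ *-monoˡ-≤ (n ∸ 2 * Z * t) (mass-small t (≤-<-trans (flags-length A′ es F) F<t) tr≤n 1≤r) ⟩
        I * (n + 2 * Z) ^ t * (n ∸ 2 * Z * t)
          ≡⟨ *-assoc I _ _ ⟩
        I * ((n + 2 * Z) ^ t * (n ∸ 2 * Z * t))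
          ≤⟨ *-monoʳ-≤ I (bernoulli-≤ n (2 * Z) t) ⟩
        I * (n * n ^ t)
          ≡⟨ *-assoc I n (n ^ t) ⟨
        I * n * n ^ t ∎)
        where
        reorder : ∀ a b c → a * b * c ≡ a * c * b
        reorder = solve-∀
      -- With `w = n - a`, the inequality becomes `T * w ≤ I * a`, and `w` exceeds `D * a`.
      conclude : ∀ a → (1 + D) * a < n → (T + I) * (n ∸ a) ≤ I * n → D * T ≤ I
      conclude a a< h with m≤n⇒∃[o]m+o≡n (≤-trans (m≤m+n a (D * a)) (<⇒≤ a<))
      ... | w , eq = *-cancelʳ-≤ (D * T) I w {{>-nonZero (≤-<-trans z≤n Da<w)}} (begin
        D * T * w     ≡⟨ *-assoc D T w ⟩
        D * (T * w)   ≤⟨ *-monoʳ-≤ D Tw≤ ⟩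
        D * (I * a)   ≡⟨ reorder D I a ⟩
        I * (D * a)   ≤⟨ *-monoʳ-≤ I (<⇒≤ Da<w) ⟩
        I * w ∎)
        where
        reorder : ∀ a b c → a * (b * c) ≡ b * (a * c)
        reorder = solve-∀
        Da<w : D * a < w
        Da<w = +-cancelˡ-< a (D * a) w (<-≤-trans a< (≤-reflexive (sym eq)))
        Tw≤ : T * w ≤ I * a
        Tw≤ = +-cancelʳ-≤ (I * w) (T * w) (I * a) (begin
          T * w + I * w          ≡⟨ *-distribʳ-+ w T I ⟨
          (T + I) * w            ≡⟨ cong ((T + I) *_) (sym (trans (cong (_∸ a) (sym eq)) (m+n∸m≡n a w))) ⟩
          (T + I) * (n ∸ a)      ≤⟨ h ⟩
          I * n                  ≡⟨ cong (I *_) (sym eq) ⟩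
          I * (a + w)            ≡⟨ *-distribˡ-+ I a w ⟩
          I * a + I * w ∎)

    I>0 : 0 < I
    I>0 = *-mono-≤ {1} {fall n n} (fall-pos {n} {n} ≤-refl) (fall-pos nr≤q)

    N>0 : 0 < N
    N>0 = ≤-trans (≤-trans (*-mono-≤ (>-nonZero⁻¹ n) 1≤r) nr≤q)
      (≤-trans (m≤m+n q (m * q)) (≤-reflexive (sym (length-tokens q m))))

    instance
      family-nonZero : NonZero (length family)
      family-nonZero = subst NonZero (sym length-family) (>-nonZero I>0)
      tokens-nonZero : NonZero (length (tokens q m))
      tokens-nonZero = >-nonZero N>0

    open Rounds (tokens q m) (tokens-1 q m) using (Ω; module TwoRounds)

    few-misses : D * (∑[ W ∈ Ω (length es) ] ∑[ W′ ∈ Ω (length es) ] 𝟙 (¬? (hit? family W W′)))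
                 ≤ 3 * (N ^ length es * N ^ length es)
    few-misses = TwoRounds.two-rounds family D t spread-large spread-small

-- Choice of the constants

1+n≤2^n : ∀ n → 1 + n ≤ 2 ^ n
1+n≤2^n zero    = s≤s z≤n
1+n≤2^n (suc n) = +-mono-≤ {1} {2 ^ n} (m^n>0 2 n) (≤-trans (1+n≤2^n n) (≤-reflexive (sym (+-identityʳ (2 ^ n)))))

module Constants (r D : ℕ) where

  -- `c`, `ζ` and `L` are the factors of `suc m` in `M`, `Z` and `t`. The summands of `L` are
  -- exponents of 2 that cover `D * D`, `(1 + M) ^ (r * r)` and `8 ^ (2 * Z)` in `t-large`. The
  -- summands of `K` after the 1 provide, in this order, `r ≤ n`, `n-large`, `n-large′`, `tr≤n` and
  -- `n-large″`.
  C₁ C₂ c ζ L K : ℕ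
  C₁ = 64 * (r + r)
  C₂ = 8 * (r + r)
  c = 2 * C₂
  ζ = 2 ^ r * (c * C₁)
  L = D + D + c * (r * r) + 6 * ζ
  K = 1 + (r + (c ^ r * C₁ + (2 * (2 ^ r * (c ^ r * C₁)) * r + (L * r + (1 + D) * (2 * ζ * L)))))

  r<K : r < K
  r<K = s≤s (m≤m+n r _)

Threshold : ℕ → ℕ → ℕ → Set
Threshold r D K = ∀ n {{_ : NonZero n}} (r≤n : r ≤ n) m q → K * suc m ^ r ≤ n → r * n ≤ q →
  (es : List (Fin n × Fin n)) → (∀ {e} → e ∈ es → toℕ (proj₁ e) < toℕ (proj₂ e)) → List.Unique es →
  (q≢0 : NonZero (length (tokens q m))) →
  let open Rounds (tokens q m) (tokens-1 q m) {{q≢0}}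
      family = map (λ B → Labels.config n r q r≤n B es) (Template.copies n r q r≤n) in
  D * (∑[ W ∈ Ω (length es) ] ∑[ W′ ∈ Ω (length es) ] 𝟙 (¬? (hit? family W W′)))
  ≤ 3 * (N ^ length es * N ^ length es)

threshold : ∀ r D → 2 ≤ r → Threshold r D (Constants.K r D)
threshold r D 2≤r n r≤n m q K≤n rn≤q es sorted unique q≢0 =
  Count.few-misses n r q D m (L * suc m) r≤n es sorted unique 1≤M n-large n-large′
    (≤-trans (≤-reflexive (*-comm n r)) rn≤q) 1≤r tr≤n t-large n-large″
  where
  open Constants r D
  open ≤-Reasoning
  M Y Z : ℕ
  M = 2 * suc m * C₂
  Y = 2 ^ r * (M ^ r * C₁)
  Z = 2 ^ r * (M * C₁)
  1≤r : 1 ≤ r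
  1≤r = ≤-trans (s≤s z≤n) 2≤r
  M≡ : M ≡ c * suc m
  M≡ = lemma (suc m) C₂
    where
    lemma : ∀ m c → 2 * m * c ≡ 2 * c * m
    lemma = solve-∀
  Z≡ : Z ≡ ζ * suc m
  Z≡ = trans (cong (λ z → 2 ^ r * (z * C₁)) M≡) (lemma (2 ^ r) c (suc m) C₁)
    where
    lemma : ∀ a c m d → a * (c * m * d) ≡ a * (c * d) * m
    lemma = solve-∀
  M^r≡ : M ^ r ≡ c ^ r * suc m ^ r
  M^r≡ = trans (cong (_^ r) M≡) (^-distribʳ-* c (suc m) r)
  1≤M : 1 ≤ M
  1≤M = *-mono-≤ {1} {2 * suc m} (s≤s z≤n) (*-mono-≤ {1} {8} (s≤s z≤n) (≤-trans 1≤r (m≤m+n r r)))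
  part₁ part₂ part₃ part₄ part₅ : ℕ
  part₁ = r
  part₂ = c ^ r * C₁
  part₃ = 2 * (2 ^ r * (c ^ r * C₁)) * r
  part₄ = L * r
  part₅ = (1 + D) * (2 * ζ * L)
  bound : ∀ {a b} x → a ≤ x * suc m ^ r → x ≤ b → 1 + b ≤ K → a < n
  bound {a} {b} x a≤ x≤b b< = ≤-trans (s≤s a≤) (≤-trans
    (+-mono-≤ (m^n>0 (suc m) r) (*-monoˡ-≤ (suc m ^ r) x≤b)) (≤-trans (*-monoˡ-≤ (suc m ^ r) b<) K≤n))
  part₂₊ part₃₊ part₄₊ : ℕ
  part₄₊ = part₄ + part₅
  part₃₊ = part₃ + part₄₊
  part₂₊ = part₂ + part₃₊
  m≤m^r : suc m ≤ suc m ^ r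
  m≤m^r = ≤-trans (≤-reflexive (sym (*-identityʳ (suc m)))) (^-monoʳ-≤ (suc m) 1≤r)
  below : ∀ {x} → x ≤ part₁ + part₂₊ → 1 + x ≤ K
  below h = s≤s h
  n-large : M ^ r * C₁ ≤ n
  n-large = <⇒≤ (bound part₂ (≤-reflexive (trans (cong (_* C₁) M^r≡) (lemma (c ^ r) (suc m ^ r) C₁))) ≤-refl
    (below (≤-trans (m≤m+n part₂ part₃₊) (m≤n+m _ part₁))))
    where
    lemma : ∀ a b c → a * b * c ≡ a * c * b
    lemma = solve-∀
  n-large′ : 2 * Y * r ≤ n
  n-large′ = <⇒≤ (bound part₃ (≤-reflexive (trans (cong (λ z → 2 * (2 ^ r * (z * C₁)) * r) M^r≡)
      (lemma (2 ^ r) (c ^ r) (suc m ^ r) C₁ r))) ≤-refl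
    (below (≤-trans (≤-trans (m≤m+n part₃ part₄₊) (m≤n+m _ part₂)) (m≤n+m _ part₁))))
    where
    lemma : ∀ a b x c r → 2 * (a * (b * x * c)) * r ≡ 2 * (a * (b * c)) * r * x
    lemma = solve-∀
  tr≤n : L * suc m * r ≤ n
  tr≤n = <⇒≤ (bound part₄ (≤-trans (≤-reflexive (lemma L (suc m) r)) (*-monoʳ-≤ part₄ m≤m^r)) ≤-refl
    (below (≤-trans (≤-trans (≤-trans (m≤m+n part₄ part₅) (m≤n+m _ part₃)) (m≤n+m _ part₂)) (m≤n+m _ part₁))))
    where
    lemma : ∀ a b c → a * b * c ≡ a * c * b
    lemma = solve-∀
  -- The left side is quadratic in `suc m`, so `suc m ^ r` dominates it only because the exponent is
  -- at least 2.
  n-large″ : (1 + D) * (2 * Z * (L * suc m)) < n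
  n-large″ = bound part₅ (≤-trans (≤-reflexive (trans (cong (λ z → (1 + D) * (2 * z * (L * suc m))) Z≡)
      (lemma (1 + D) ζ L (suc m)))) (*-monoʳ-≤ part₅ (^-monoʳ-≤ (suc m) 2≤r))) ≤-refl
    (below (≤-trans (≤-trans (≤-trans (m≤n+m part₅ part₄) (m≤n+m _ part₃)) (m≤n+m _ part₂)) (m≤n+m _ part₁)))
    where
    lemma : ∀ d z l m → d * (2 * (z * m) * (l * m)) ≡ d * (2 * z * l) * (m * (m * 1))
    lemma = solve-∀
  n≤2^n : ∀ n → n ≤ 2 ^ n
  n≤2^n n = ≤-trans (n≤1+n n) (1+n≤2^n n)
  t-large : D * D * ((1 + M) ^ (r * r) * 8 ^ (2 * Z)) ≤ 2 ^ (L * suc m)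
  t-large = begin
    D * D * ((1 + M) ^ (r * r) * 8 ^ (2 * Z))
      ≤⟨ *-mono-≤ (*-mono-≤ (n≤2^n D) (n≤2^n D)) (*-monoˡ-≤ (8 ^ (2 * Z)) (^-monoˡ-≤ (r * r) (1+n≤2^n M))) ⟩
    2 ^ D * 2 ^ D * ((2 ^ M) ^ (r * r) * (2 ^ 3) ^ (2 * Z))
      ≡⟨ cong₂ _*_ (sym (^-distribˡ-+-* 2 D D)) (trans (cong₂ _*_ (^-*-assoc 2 M (r * r)) (^-*-assoc 2 3 (2 * Z)))
           (sym (^-distribˡ-+-* 2 (M * (r * r)) (3 * (2 * Z))))) ⟩
    2 ^ (D + D) * 2 ^ (M * (r * r) + 3 * (2 * Z))
      ≡⟨ ^-distribˡ-+-* 2 (D + D) _ ⟨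
    2 ^ (D + D + (M * (r * r) + 3 * (2 * Z)))
      ≤⟨ ^-monoʳ-≤ 2 exponent ⟩
    2 ^ (L * suc m) ∎
    where
    exponent : D + D + (M * (r * r) + 3 * (2 * Z)) ≤ L * suc m
    exponent = begin
      D + D + (M * (r * r) + 3 * (2 * Z))
        ≡⟨ cong₂ (λ x y → D + D + (x * (r * r) + 3 * (2 * y))) M≡ Z≡ ⟩
      D + D + (c * suc m * (r * r) + 3 * (2 * (ζ * suc m)))
        ≤⟨ +-monoˡ-≤ (c * suc m * (r * r) + 3 * (2 * (ζ * suc m))) (m≤m*n (D + D) (suc m)) ⟩
      (D + D) * suc m + (c * suc m * (r * r) + 3 * (2 * (ζ * suc m)))
        ≡⟨ lemma (D + D) (suc m) c (r * r) ζ ⟩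
      L * suc m ∎
      where
      lemma : ∀ d m c r z → d * m + (c * m * r + 3 * (2 * (z * m))) ≡ (d + c * r + 6 * z) * m
      lemma = solve-∀

-- Merging the two rounds

module _ {q : ℕ} where

  survivors : ∀ {e} → Maybe (Fin q) → List (Config q (suc e)) → List (Config q e)
  survivors w []            = []
  survivors w ((a ∷ A) ∷ 𝓙) with a ⊑? w
  ... | yes _ = A ∷ survivors w 𝓙
  ... | no _  = survivors w 𝓙

  ⊑nothing⇒⊑ : ∀ (a w : Maybe (Fin q)) → a ⊑ nothing → a ⊑ w
  ⊑nothing⇒⊑ nothing w _ = tt

  survivors-hit : ∀ {e} w (𝓙 : List (Config q (suc e))) W W′ →
                  Hit (survivors w 𝓙) W W′ → Hit 𝓙 (w ∷ W) (nothing ∷ W′)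
  survivors-hit w ((a ∷ A) ∷ 𝓙) W W′ h with a ⊑? w | h
  ... | yes a⊑w | here covered = here (inj₁ a⊑w , covered)
  ... | yes _   | there h′     = there (survivors-hit w 𝓙 W W′ h′)
  ... | no _    | h′           = there (survivors-hit w 𝓙 W W′ h′)

  hit-survivors : ∀ {e} w (𝓙 : List (Config q (suc e))) W W′ →
                  Hit 𝓙 (w ∷ W) (nothing ∷ W′) → Hit (survivors w 𝓙) W W′
  hit-survivors w ((a ∷ A) ∷ 𝓙) W W′ h with a ⊑? w | h
  ... | yes _   | here (_ , covered)      = here covered
  ... | yes _   | there h′                = there (hit-survivors w 𝓙 W W′ h′)
  ... | no a⋢w  | here (inj₁ a⊑w , _)     = ⊥-elim (a⋢w a⊑w)
  ... | no a⋢w  | here (inj₂ a⊑n , _)     = ⊥-elim (a⋢w (⊑nothing⇒⊑ a w a⊑n))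
  ... | no _    | there h′                = hit-survivors w 𝓙 W W′ h′

  -- At this edge the hitting member uses only one of the two tokens, and it does not matter from
  -- which round that token came.
  hit-split : ∀ {e} w w′ (𝓙 : List (Config q (suc e))) W W′ → Hit 𝓙 (w ∷ W) (w′ ∷ W′) →
              Hit 𝓙 (w ∷ W) (nothing ∷ W′) ⊎ Hit 𝓙 (w′ ∷ W) (nothing ∷ W′)
  hit-split w w′ ((a ∷ A) ∷ 𝓙) W W′ (here (inj₁ h , cov)) = inj₁ (here (inj₁ h , cov))
  hit-split w w′ ((a ∷ A) ∷ 𝓙) W W′ (here (inj₂ h , cov)) = inj₂ (here (inj₁ h , cov))
  hit-split w w′ (A ∷ 𝓙) W W′ (there h) with hit-split w w′ 𝓙 W W′ h
  ... | inj₁ k = inj₁ (there k)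
  ... | inj₂ k = inj₂ (there k)

  hit-nothing : ∀ {e} w (𝓙 : List (Config q (suc e))) W W′ →
                Hit 𝓙 (nothing ∷ W) (nothing ∷ W′) → Hit 𝓙 (w ∷ W) (nothing ∷ W′)
  hit-nothing w ((a ∷ A) ∷ 𝓙) W W′ (here (inj₁ h , cov)) = here (inj₁ (⊑nothing⇒⊑ a w h) , cov)
  hit-nothing w ((a ∷ A) ∷ 𝓙) W W′ (here (inj₂ h , cov)) = here (inj₂ h , cov)
  hit-nothing w (A ∷ 𝓙) W W′ (there h) = there (hit-nothing w 𝓙 W W′ h)

module Merge (q m : ℕ) {{_ : NonZero (length (tokens q m))}} where

  open Rounds (tokens q m) (tokens-1 q m)

  misses : ∀ {e} → List (Config q e) → ℕ
  misses {e} 𝓙 = ∑[ W ∈ Ω e ] ∑[ W′ ∈ Ω e ] 𝟙 (¬? (hit? 𝓙 W W′))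

  missesFrom : ∀ {e} → List (Config q (suc e)) → Maybe (Fin q) → Maybe (Fin q) → ℕ
  missesFrom {e} 𝓙 w w′ = ∑[ W ∈ Ω e ] ∑[ W′ ∈ Ω e ] 𝟙 (¬? (hit? 𝓙 (w ∷ W) (w′ ∷ W′)))

  misses-∷ : ∀ {e} (𝓙 : List (Config q (suc e))) →
             misses 𝓙 ≡ ∑[ w ∈ tokens q m ] ∑[ w′ ∈ tokens q m ] missesFrom 𝓙 w w′
  misses-∷ {e} 𝓙 = trans (∑-Ω e _) (∑-cong (tokens q m) λ w →
    trans (∑-cong (Ω e) λ W → ∑-Ω e _) (∑-swap (Ω e) (tokens q m) _))

  misses-survivors : ∀ {e} w (𝓙 : List (Config q (suc e))) → misses (survivors w 𝓙) ≡ missesFrom 𝓙 w nothing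
  misses-survivors {e} w 𝓙 = ∑-cong (Ω e) λ W → ∑-cong (Ω e) λ W′ →
    𝟙-cong (¬? (hit? (survivors w 𝓙) W W′)) (¬? (hit? 𝓙 (w ∷ W) (nothing ∷ W′)))
      (λ ¬h h → ¬h (hit-survivors w 𝓙 W W′ h)) (λ ¬h h → ¬h (survivors-hit w 𝓙 W W′ h))

  -- For one edge, y of whose q colours would help: two rounds fail with
  -- probability (1 - y / N)², and 1 - 2 y / N is at most that.
  merge : ∀ {e} (𝓙 : List (Config q (suc e))) →
    N * N * misses (survivors nothing 𝓙) + 2 * N * (∑[ c ∈ allFin q ] misses (survivors (just c) 𝓙))
    ≤ 2 * N * q * misses (survivors nothing 𝓙) + misses 𝓙
  merge {e} 𝓙 = begin
    N * N * misses (survivors nothing 𝓙) + 2 * N * (∑[ c ∈ allFin q ] misses (survivors (just c) 𝓙))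
      ≡⟨ cong₂ (λ a b → N * N * a + 2 * N * b) (misses-survivors nothing 𝓙)
           (trans (∑-cong (allFin q) λ c → misses-survivors (just c) 𝓙)
             (trans (∑-swap (allFin q) (Ω e) _) (∑-cong (Ω e) λ W → ∑-swap (allFin q) (Ω e) _))) ⟩
    N * N * (∑[ W ∈ Ω e ] ∑[ W′ ∈ Ω e ] x₀ W W′) + 2 * N * (∑[ W ∈ Ω e ] ∑[ W′ ∈ Ω e ] s W W′)
      ≡⟨ pull (N * N) (2 * N) x₀ s ⟩
    ∑[ W ∈ Ω e ] ∑[ W′ ∈ Ω e ] (N * N * x₀ W W′ + 2 * N * s W W′)
      ≤⟨ ∑-mono (Ω e) (λ W → ∑-mono (Ω e) λ W′ → pointwise W W′) ⟩
    ∑[ W ∈ Ω e ] ∑[ W′ ∈ Ω e ] (2 * N * q * x₀ W W′ + 1 * two W W′)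
      ≡⟨ pull (2 * N * q) 1 x₀ two ⟨
    2 * N * q * (∑[ W ∈ Ω e ] ∑[ W′ ∈ Ω e ] x₀ W W′) + 1 * (∑[ W ∈ Ω e ] ∑[ W′ ∈ Ω e ] two W W′)
      ≡⟨ cong₂ (λ a b → 2 * N * q * a + b) (sym (misses-survivors nothing 𝓙)) (trans (*-identityˡ _) (sym misses≡)) ⟩
    2 * N * q * misses (survivors nothing 𝓙) + misses 𝓙 ∎
    where
    open ≤-Reasoning
    x : Maybe (Fin q) → Maybe (Fin q) → Config q e → Config q e → ℕ
    x w w′ W W′ = 𝟙 (¬? (hit? 𝓙 (w ∷ W) (w′ ∷ W′)))
    x₀ s two : Config q e → Config q e → ℕ
    x₀  = x nothing nothing
    s   W W′ = ∑[ c ∈ allFin q ] x (just c) nothing W W′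
    two W W′ = ∑[ w ∈ tokens q m ] ∑[ w′ ∈ tokens q m ] x w w′ W W′
    misses≡ : misses 𝓙 ≡ ∑[ W ∈ Ω e ] ∑[ W′ ∈ Ω e ] two W W′
    misses≡ = trans (misses-∷ 𝓙) (trans (∑-cong (tokens q m) λ w → trans (∑-swap (tokens q m) (Ω e) _)
        (∑-cong (Ω e) λ W → ∑-swap (tokens q m) (Ω e) _))
      (trans (∑-swap (tokens q m) (Ω e) _) (∑-cong (Ω e) λ W → ∑-swap (tokens q m) (Ω e) _)))
    pull : ∀ a b (f g : Config q e → Config q e → ℕ) →
      a * (∑[ W ∈ Ω e ] ∑[ W′ ∈ Ω e ] f W W′) + b * (∑[ W ∈ Ω e ] ∑[ W′ ∈ Ω e ] g W W′)
      ≡ ∑[ W ∈ Ω e ] ∑[ W′ ∈ Ω e ] (a * f W W′ + b * g W W′)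
    pull a b f g = sym (trans (∑-cong (Ω e) λ W → trans (∑-+ (Ω e) _ _)
      (cong₂ _+_ (∑-*ˡ (Ω e) a (f W)) (∑-*ˡ (Ω e) b (g W))))
      (trans (∑-+ (Ω e) _ _) (cong₂ _+_ (∑-*ˡ (Ω e) a _) (∑-*ˡ (Ω e) b _))))

    square : ∀ x₀ s g t → N ≡ g + q → s ≤ q * x₀ → x₀ ≤ 1 → (s + g * x₀) * (s + g * x₀) ≤ t →
             N * N * x₀ + 2 * N * s ≤ 2 * N * q * x₀ + 1 * t
    square zero s g t N≡ s≤ _ h rewrite n≤0⇒n≡0 (≤-trans s≤ (≤-reflexive (*-zeroʳ q))) =
      ≤-trans (≤-reflexive (cong₂ _+_ (*-zeroʳ (N * N)) (*-zeroʳ (2 * N)))) z≤n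
    square (suc (suc _)) s g t N≡ s≤ (s≤s ()) h
    -- `s` counts the colours that do not help and `d` those that do; the discarded `d * d` is the
    -- second-order term of `(1 - d / N)²`.
    square (suc zero) s g t N≡ s≤ _ h with m≤n⇒∃[o]m+o≡n (≤-trans s≤ (≤-reflexive (*-identityʳ q)))
    ... | d , s+d≡q rewrite N≡ | sym s+d≡q = begin
      (g + (s + d)) * (g + (s + d)) * 1 + 2 * (g + (s + d)) * s
        ≤⟨ m≤m+n _ (d * d) ⟩
      (g + (s + d)) * (g + (s + d)) * 1 + 2 * (g + (s + d)) * s + d * d
        ≡⟨ lemma g s d ⟩
      2 * (g + (s + d)) * (s + d) * 1 + 1 * ((s + g * 1) * (s + g * 1))
        ≤⟨ +-monoʳ-≤ (2 * (g + (s + d)) * (s + d) * 1) (*-monoʳ-≤ 1 h) ⟩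
      2 * (g + (s + d)) * (s + d) * 1 + 1 * t ∎
      where
      lemma : ∀ g s d → (g + (s + d)) * (g + (s + d)) * 1 + 2 * (g + (s + d)) * s + d * d
              ≡ 2 * (g + (s + d)) * (s + d) * 1 + 1 * ((s + g * 1) * (s + g * 1))
      lemma = solve-∀

    pointwise : ∀ W W′ → N * N * x₀ W W′ + 2 * N * s W W′ ≤ 2 * N * q * x₀ W W′ + 1 * two W W′
    pointwise W W′ = square (x₀ W W′) (s W W′) (m * q) (two W W′)
      (trans (length-tokens q m) (+-comm q (m * q)))
      (≤-trans (∑-≤-const (allFin q) λ c → 𝟙-mono (¬? (hit? 𝓙 (just c ∷ W) (nothing ∷ W′))) (¬? (hit? 𝓙 (nothing ∷ W) (nothing ∷ W′)))
        λ ¬h h → ¬h (hit-nothing (just c) 𝓙 W W′ h)) (≤-reflexive (cong (_* x₀ W W′) (length-allFin q))))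
      (𝟙≤1 (¬? (hit? 𝓙 (nothing ∷ W) (nothing ∷ W′))))
      (begin
        (s W W′ + m * q * x₀ W W′) * (s W W′ + m * q * x₀ W W′)
          ≡⟨ cong (λ z → z * z) (sym once) ⟩
        (∑[ w ∈ tokens q m ] x w nothing W W′) * (∑[ w ∈ tokens q m ] x w nothing W W′)
          ≡⟨ ∑-*-∑ (tokens q m) (tokens q m) _ _ ⟩
        ∑[ w ∈ tokens q m ] ∑[ w′ ∈ tokens q m ] (x w nothing W W′ * x w′ nothing W W′)
          ≤⟨ ∑-mono (tokens q m) (λ w → ∑-mono (tokens q m) λ w′ → both w w′) ⟩
        two W W′ ∎)
      where
      once : ∑[ w ∈ tokens q m ] x w nothing W W′ ≡ s W W′ + m * q * x₀ W W′
      once = trans (∑-++ (map just (allFin q)) (replicate (m * q) nothing) _) (cong₂ _+_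
        (∑-map just (allFin q) _) (∑-replicate (m * q)))
        where
        ∑-replicate : ∀ k → ∑ (replicate k nothing) (λ w → x w nothing W W′) ≡ k * x₀ W W′
        ∑-replicate zero    = ∑-[] _
        ∑-replicate (suc k) = trans (∑-∷ nothing (replicate k nothing) _) (cong (x₀ W W′ +_) (∑-replicate k))
      both : ∀ w w′ → x w nothing W W′ * x w′ nothing W W′ ≤ x w w′ W W′
      both w w′ = by (hit? 𝓙 (w ∷ W) (nothing ∷ W′)) (hit? 𝓙 (w′ ∷ W) (nothing ∷ W′)) (hit? 𝓙 (w ∷ W) (w′ ∷ W′))
        (hit-split w w′ 𝓙 W W′)
        where
        by : ∀ {P Q R : Set} (P? : Dec P) (Q? : Dec Q) (R? : Dec R) → (R → P ⊎ Q) →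
             𝟙 (¬? P?) * 𝟙 (¬? Q?) ≤ 𝟙 (¬? R?)
        by (yes _) Q? R? f = z≤n
        by (no _) (yes _) R? f = z≤n
        by (no ¬p) (no ¬q) (yes r) f with f r
        ... | inj₁ p  = ⊥-elim (¬p p)
        ... | inj₂ q′ = ⊥-elim (¬q q′)
        by (no _) (no _) (no _) f = ≤-refl

  misses-just≤ : ∀ {e} c (𝓙 : List (Config q (suc e))) → misses (survivors (just c) 𝓙) ≤ misses (survivors nothing 𝓙)
  misses-just≤ {e} c 𝓙 = ≤-trans (≤-reflexive (misses-survivors (just c) 𝓙)) (≤-trans
    (∑-mono (Ω e) λ W → ∑-mono (Ω e) λ W′ →
      𝟙-mono (¬? (hit? 𝓙 (just c ∷ W) (nothing ∷ W′))) (¬? (hit? 𝓙 (nothing ∷ W) (nothing ∷ W′)))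
        λ ¬h h → ¬h (hit-nothing (just c) 𝓙 W W′ h))
    (≤-reflexive (sym (misses-survivors nothing 𝓙))))

-- Rational expectations

ι : ℕ → ℚ
ι zero    = 0ℚ
ι (suc n) = 1ℚ ⊕ ι n

ι-+ : ∀ m n → ι (m + n) ≡ ι m ⊕ ι n
ι-+ zero    n = sym (ℚ.+-identityˡ (ι n))
ι-+ (suc m) n = trans (cong (1ℚ ⊕_) (ι-+ m n)) (sym (ℚ.+-assoc 1ℚ (ι m) (ι n)))

ι-* : ∀ m n → ι (m * n) ≡ ι m ⊗ ι n
ι-* zero    n = sym (ℚ.*-zeroˡ (ι n))
ι-* (suc m) n = trans (ι-+ n (m * n)) (trans (cong (ι n ⊕_) (ι-* m n))
  (trans (cong (_⊕ ι m ⊗ ι n) (sym (ℚ.*-identityˡ (ι n)))) (sym (ℚ.*-distribʳ-+ (ι n) 1ℚ (ι m)))))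

0≼1 : 0ℚ ≼ 1ℚ
0≼1 = ℚ.<⇒≤ (ℚ.positive⁻¹ 1ℚ)

0≼ι : ∀ n → 0ℚ ≼ ι n
0≼ι zero    = ℚ.≤-refl
0≼ι (suc n) = ℚ.+-mono-≤ 0≼1 (0≼ι n)

ι-mono : ∀ {m n} → m ≤ n → ι m ≼ ι n
ι-mono {n = n} z≤n   = 0≼ι n
ι-mono (s≤s m≤n) = ℚ.+-monoʳ-≤ 1ℚ (ι-mono m≤n)

ι-pos : ∀ {n} → 0 < n → 0ℚ ≺ ι n
ι-pos {suc n} _ = ℚ.+-mono-<-≤ (ℚ.positive⁻¹ 1ℚ) (0≼ι n)

⊗-monoˡ : ∀ {c a b} → 0ℚ ≼ c → a ≼ b → c ⊗ a ≼ c ⊗ b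
⊗-monoˡ {c} 0≼c = ℚ.*-monoˡ-≤-nonNeg c {{ℚ.nonNegative 0≼c}}

⊗-nonNeg : ∀ {a b} → 0ℚ ≼ a → 0ℚ ≼ b → 0ℚ ≼ a ⊗ b
⊗-nonNeg {a} {b} 0≼a 0≼b = ℚ.nonNegative⁻¹ (a ⊗ b) {{ℚ.nonNeg*nonNeg⇒nonNeg a {{ℚ.nonNegative 0≼a}} b {{ℚ.nonNegative 0≼b}}}}

⊗-cancelˡ : ∀ {c a b} → 0ℚ ≺ c → c ⊗ a ≼ c ⊗ b → a ≼ b
⊗-cancelˡ {c} 0≺c = ℚ.*-cancelˡ-≤-pos c {{ℚ.positive 0≺c}}

a≼b⇒0≼b⊖a : ∀ {a b} → a ≼ b → 0ℚ ≼ b ⊖ a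
a≼b⇒0≼b⊖a {a} {b} a≼b = subst (_≼ b ⊖ a) (ℚ.+-inverseʳ a) (ℚ.+-monoˡ-≤ (⊝ a) a≼b)

0≼b⊖a⇒a≼b : ∀ {a b} → 0ℚ ≼ b ⊖ a → a ≼ b
0≼b⊖a⇒a≼b {a} {b} h = subst₂ _≼_ (ℚ.+-identityˡ a) (solve 2 (λ a b → b :- a :+ a := b) refl a b) (ℚ.+-monoˡ-≤ a h)
  where open +-*-Solver

fraction-suc : ∀ a b → ℤ.+ suc a // suc b ≡ ℤ.+ a // suc b ⊕ ℤ.+ 1 // suc b
fraction-suc a b = ℚ.toℚᵘ-injective
  (ℚᵘ.≃-trans (ℚ.toℚᵘ-fromℚᵘ (ℚᵘ.mkℚᵘ (ℤ.+ suc a) b))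
  (ℚᵘ.≃-trans (ℚᵘ.*≡* eq)
  (ℚᵘ.≃-trans (ℚᵘ.+-cong (ℚᵘ.≃-sym (ℚ.toℚᵘ-fromℚᵘ (ℚᵘ.mkℚᵘ (ℤ.+ a) b)))
                         (ℚᵘ.≃-sym (ℚ.toℚᵘ-fromℚᵘ (ℚᵘ.mkℚᵘ (ℤ.+ 1) b))))
              (ℚᵘ.≃-sym (ℚ.toℚᵘ-homo-+ (ℤ.+ a // suc b) (ℤ.+ 1 // suc b))))))
  where
  open IntSolver.+-*-Solver
  eq : (ℤ.+ suc a) ℤ.* (ℤ.+ suc b ℤ.* ℤ.+ suc b) ≡ (ℤ.+ a ℤ.* ℤ.+ suc b ℤ.+ ℤ.+ 1 ℤ.* ℤ.+ suc b) ℤ.* ℤ.+ suc b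
  eq = trans (cong (ℤ._* (ℤ.+ suc b ℤ.* ℤ.+ suc b)) (ℤ.pos-+ 1 a))
    (solve 2 (λ x y → (con (ℤ.+ 1) :+ x) :* (y :* y) := (x :* y :+ con (ℤ.+ 1) :* y) :* y) refl (ℤ.+ a) (ℤ.+ suc b))

fraction-ι : ∀ a b → ℤ.+ a // suc b ≡ ι a ⊗ (ℤ.+ 1 // suc b)
fraction-ι zero    b = trans (ℚ.0/n≡0 (suc b)) (sym (ℚ.*-zeroˡ (ℤ.+ 1 // suc b)))
fraction-ι (suc a) b = trans (fraction-suc a b) (trans (cong (_⊕ u) (fraction-ι a b))
  (solve 2 (λ a u → a :* u :+ u := (con 1ℚ :+ a) :* u) refl (ι a) u))
  where
  open +-*-Solver
  u : ℚ
  u = ℤ.+ 1 // suc b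

ι-fraction : ∀ a b → ι (suc b) ⊗ (ℤ.+ a // suc b) ≡ ι a
ι-fraction a b = trans (cong (ι (suc b) ⊗_) (fraction-ι a b))
  (trans (solve 3 (λ b a u → b :* (a :* u) := a :* (b :* u)) refl (ι (suc b)) (ι a) (ℤ.+ 1 // suc b))
    (trans (cong (ι a ⊗_) unit) (ℚ.*-identityʳ (ι a))))
  where
  open +-*-Solver
  unit : ι (suc b) ⊗ (ℤ.+ 1 // suc b) ≡ 1ℚ
  unit = trans (sym (fraction-ι (suc b) b)) (ℚ.toℚᵘ-injective
    (ℚᵘ.≃-trans (ℚ.toℚᵘ-fromℚᵘ (ℚᵘ.mkℚᵘ (ℤ.+ suc b) b)) (ℚᵘ.*≡* (ℤ.*-comm (ℤ.+ suc b) (ℤ.+ 1)))))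

∑ℚ : {A : Set} → List A → (A → ℚ) → ℚ
∑ℚ []       f = 0ℚ
∑ℚ (x ∷ xs) f = f x ⊕ ∑ℚ xs f

∑ℚ-mono : ∀ {A : Set} (xs : List A) {f g : A → ℚ} → (∀ x → f x ≼ g x) → ∑ℚ xs f ≼ ∑ℚ xs g
∑ℚ-mono []       h = ℚ.≤-refl
∑ℚ-mono (x ∷ xs) h = ℚ.+-mono-≤ (h x) (∑ℚ-mono xs h)

∑ℚ-*ˡ : ∀ {A : Set} (xs : List A) c f → ∑ℚ xs (λ x → c ⊗ f x) ≡ c ⊗ ∑ℚ xs f
∑ℚ-*ˡ []       c f = sym (ℚ.*-zeroʳ c)
∑ℚ-*ˡ (x ∷ xs) c f = trans (cong (c ⊗ f x ⊕_) (∑ℚ-*ˡ xs c f)) (sym (ℚ.*-distribˡ-+ c (f x) (∑ℚ xs f)))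

∑ℚ-ι : ∀ {A : Set} (xs : List A) (f : A → ℕ) → ∑ℚ xs (λ x → ι (f x)) ≡ ι (∑ xs f)
∑ℚ-ι []       f = cong ι (sym (∑-[] f))
∑ℚ-ι (x ∷ xs) f = trans (cong (ι (f x) ⊕_) (∑ℚ-ι xs f))
  (trans (sym (ι-+ (f x) (∑ xs f))) (cong ι (sym (∑-∷ x xs f))))

-- The expectation computed from the k-th rational approximations of the
-- weights.
module Expectation (k : ℕ) where

  𝔼 : ∀ {A : Set} → Dist A → (A → ℚ) → ℚ
  𝔼 d f = ∑ℚ d (λ (w , a) → seq w k ⊗ f a)

  𝔼-cong : ∀ {A : Set} (d : Dist A) {f g : A → ℚ} → (∀ a → f a ≡ g a) → 𝔼 d f ≡ 𝔼 d g
  𝔼-cong []            h = refl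
  𝔼-cong ((w , a) ∷ d) h = cong₂ _⊕_ (cong (seq w k ⊗_) (h a)) (𝔼-cong d h)

  𝔼-return : ∀ {A : Set} (a : A) f → 𝔼 (return a) f ≡ f a
  𝔼-return a f = trans (ℚ.+-identityʳ _) (ℚ.*-identityˡ (f a))

  𝔼->>= : ∀ {A B : Set} (d : Dist A) (g : A → Dist B) f → 𝔼 (d >>= g) f ≡ 𝔼 d (λ a → 𝔼 (g a) f)
  𝔼->>= []            g f = refl
  𝔼->>= ((w , a) ∷ d) g f = trans (∑ℚ-++ (map (λ (w′ , b) → w *ᴿ w′ , b) (g a)) (d >>= g))
    (cong₂ _⊕_ (scaled (g a)) (𝔼->>= d g f))
    where
    ∑ℚ-++ : ∀ xs ys → ∑ℚ (xs ++ ys) (λ (w , a) → seq w k ⊗ f a) ≡ 𝔼 xs f ⊕ 𝔼 ys f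
    ∑ℚ-++ []       ys = sym (ℚ.+-identityˡ _)
    ∑ℚ-++ ((w , a) ∷ xs) ys = trans (cong (seq w k ⊗ f a ⊕_) (∑ℚ-++ xs ys)) (sym (ℚ.+-assoc (seq w k ⊗ f a) _ _))
    scaled : ∀ xs → 𝔼 (map (λ (w′ , b) → w *ᴿ w′ , b) xs) f ≡ seq w k ⊗ 𝔼 xs f
    scaled [] = sym (ℚ.*-zeroʳ (seq w k))
    scaled ((w′ , b) ∷ xs) = trans (cong₂ _⊕_ (ℚ.*-assoc (seq w k) (seq w′ k) (f b)) (scaled xs))
      (sym (ℚ.*-distribˡ-+ (seq w k) (seq w′ k ⊗ f b) _))

  𝔼-+ : ∀ {A : Set} (d : Dist A) f g → 𝔼 d (λ a → f a ⊕ g a) ≡ 𝔼 d f ⊕ 𝔼 d g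
  𝔼-+ []            f g = refl
  𝔼-+ ((w , a) ∷ d) f g = trans (cong (seq w k ⊗ (f a ⊕ g a) ⊕_) (𝔼-+ d f g))
    (solve 5 (λ w x y s t → w :* (x :+ y) :+ (s :+ t) := (w :* x :+ s) :+ (w :* y :+ t)) refl (seq w k) (f a) (g a) (𝔼 d f) (𝔼 d g))
    where open +-*-Solver

  𝔼-*ˡ : ∀ {A : Set} (d : Dist A) c f → 𝔼 d (λ a → c ⊗ f a) ≡ c ⊗ 𝔼 d f
  𝔼-*ˡ []            c f = sym (ℚ.*-zeroʳ c)
  𝔼-*ˡ ((w , a) ∷ d) c f = trans (cong (seq w k ⊗ (c ⊗ f a) ⊕_) (𝔼-*ˡ d c f))
    (solve 4 (λ w c x s → w :* (c :* x) :+ c :* s := c :* (w :* x :+ s)) refl (seq w k) c (f a) (𝔼 d f))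
    where open +-*-Solver

  𝔼-swap : ∀ {A B : Set} (d : Dist A) (d′ : Dist B) (f : A → B → ℚ) →
           𝔼 d (λ a → 𝔼 d′ (f a)) ≡ 𝔼 d′ (λ b → 𝔼 d (λ a → f a b))
  𝔼-swap d []             f = trans (𝔼-cong d λ a → sym (ℚ.*-zeroˡ 0ℚ)) (trans (𝔼-*ˡ d 0ℚ (λ _ → 0ℚ)) (ℚ.*-zeroˡ (𝔼 d (λ _ → 0ℚ))))
  𝔼-swap d ((w , b) ∷ d′) f = trans (𝔼-+ d (λ a → seq w k ⊗ f a b) (λ a → 𝔼 d′ (f a)))
    (cong₂ _⊕_ (𝔼-*ˡ d (seq w k) (λ a → f a b)) (𝔼-swap d d′ f))

  indicator : {P : Set} → Dec P → ℚ
  indicator P? = if does P? then 1ℚ else 0ℚ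

  1⊖indicator≼1 : ∀ {P : Set} (P? : Dec P) → 1ℚ ⊖ indicator P? ≼ 1ℚ
  1⊖indicator≼1 (yes _) = 0≼1
  1⊖indicator≼1 (no _)  = ℚ.≤-refl

  1⊖indicator-yes : ∀ {P : Set} (P? : Dec P) → P → 1ℚ ⊖ indicator P? ≼ 0ℚ
  1⊖indicator-yes (yes _) _ = ℚ.≤-refl
  1⊖indicator-yes (no ¬p) p = ⊥-elim (¬p p)

  seq-Pr : ∀ {A : Set} {P : A → Set} (d : Dist A) (P? : Decidable P) → seq (Pr d P?) k ≡ 𝔼 d (λ a → indicator (P? a))
  seq-Pr []            P? = refl
  seq-Pr ((w , a) ∷ d) P? with does (P? a)
  ... | true  = cong₂ _⊕_ (sym (ℚ.*-identityʳ (seq w k))) (seq-Pr d P?)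
  ... | false = trans (seq-Pr d P?) (trans (sym (ℚ.+-identityˡ _)) (cong (_⊕ _) (sym (ℚ.*-zeroʳ (seq w k)))))

  module Block {E : Set} (q : ℕ) (p : ℝ) where

    Coloured : Set
    Coloured = List (E × Fin q)

    -- The same model explored edge by edge, each colour being drawn together with its edge.
    block : List E → (Coloured → ℚ) → ℚ
    block []       f = f []
    block (e ∷ es) f = seq p k ⊗ 𝔼 (uniform q) (λ c → block es (λ G → f ((e , c) ∷ G))) ⊕ (1ℚ ⊖ seq p k) ⊗ block es f

    randomColoured : List E → Dist Coloured
    randomColoured es = randomSubset p es >>= randomColouring q

    -- The model draws colours only after the whole edge set; `𝔼-swap` brings the colour of the
    -- first edge forward.
    𝔼-block : ∀ es f → 𝔼 (randomColoured es) f ≡ block es f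
    𝔼-block [] f = trans (𝔼->>= (return []) (randomColouring q) f) (trans (𝔼-return [] colours) (𝔼-return [] f))
      where
      colours : List E → ℚ
      colours S = 𝔼 (randomColouring q S) f
    𝔼-block (e ∷ es) f = begin
      𝔼 (randomColoured (e ∷ es)) f
        ≡⟨ 𝔼->>= (randomSubset p (e ∷ es)) (randomColouring q) f ⟩
      𝔼 (randomSubset p (e ∷ es)) (λ S → 𝔼 (randomColouring q S) f)
        ≡⟨ 𝔼->>= (bernoulli p) pick colours ⟩
      𝔼 (bernoulli p) (λ b → 𝔼 (randomSubset p es >>= λ S → return (if b then e ∷ S else S)) (λ S → 𝔼 (randomColouring q S) f))
        ≡⟨ 𝔼-cong (bernoulli p) (λ b → trans (𝔼->>= (randomSubset p es) (λ S → return (if b then e ∷ S else S)) colours)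
             (𝔼-cong (randomSubset p es) λ S → 𝔼-return (if b then e ∷ S else S) colours)) ⟩
      seq p k ⊗ 𝔼 (randomSubset p es) (λ S → 𝔼 (randomColouring q (e ∷ S)) f)
        ⊕ ((1ℚ ⊖ seq p k) ⊗ 𝔼 (randomSubset p es) (λ S → 𝔼 (randomColouring q S) f) ⊕ 0ℚ)
        ≡⟨ cong₂ (λ x y → seq p k ⊗ x ⊕ y) present
             (trans (ℚ.+-identityʳ _) (cong ((1ℚ ⊖ seq p k) ⊗_) (trans (sym (𝔼->>= (randomSubset p es) (randomColouring q) f)) (𝔼-block es f)))) ⟩
      block (e ∷ es) f ∎
      where
      open ≡-Reasoning
      colours : List E → ℚ
      colours S = 𝔼 (randomColouring q S) f
      pick : Bool → Dist (List E)
      pick b = randomSubset p es >>= λ S → return (if b then e ∷ S else S)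
      present : 𝔼 (randomSubset p es) (λ S → 𝔼 (randomColouring q (e ∷ S)) f)
              ≡ 𝔼 (uniform q) (λ c → block es (λ G → f ((e , c) ∷ G)))
      present = begin
        𝔼 (randomSubset p es) (λ S → 𝔼 (randomColouring q (e ∷ S)) f)
          ≡⟨ 𝔼-cong (randomSubset p es) (λ S → trans (𝔼->>= (uniform q) (λ c → randomColouring q S >>= λ cs → return ((e , c) ∷ cs)) f) (𝔼-cong (uniform q) λ c →
               trans (𝔼->>= (randomColouring q S) (λ cs → return ((e , c) ∷ cs)) f)
                 (𝔼-cong (randomColouring q S) λ cs → 𝔼-return ((e , c) ∷ cs) f))) ⟩
        𝔼 (randomSubset p es) (λ S → 𝔼 (uniform q) (λ c → 𝔼 (randomColouring q S) (λ G → f ((e , c) ∷ G))))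
          ≡⟨ 𝔼-swap (randomSubset p es) (uniform q) (λ S c → 𝔼 (randomColouring q S) (λ G → f ((e , c) ∷ G))) ⟩
        𝔼 (uniform q) (λ c → 𝔼 (randomSubset p es) (λ S → 𝔼 (randomColouring q S) (λ G → f ((e , c) ∷ G))))
          ≡⟨ 𝔼-cong (uniform q) (λ c → trans (sym (𝔼->>= (randomSubset p es) (randomColouring q) (λ G → f ((e , c) ∷ G)))) (𝔼-block es (λ G → f ((e , c) ∷ G)))) ⟩
        𝔼 (uniform q) (λ c → block es (λ G → f ((e , c) ∷ G))) ∎

-- Comparison of the random coloured graph with the two rounds

module _ {E : Set} where

  data Sub {q : ℕ} : List (E × Fin q) → List E → Set where
    []   : Sub [] []
    keep : ∀ {e c G es} → Sub G es → Sub ((e , c) ∷ G) (e ∷ es)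
    skip : ∀ {e G es} → Sub G es → Sub G (e ∷ es)

  Within : ∀ {q} (es : List E) → Config q (length es) → List (E × Fin q) → Set
  Within []       []            G = ⊤
  Within (e ∷ es) (nothing ∷ A) G = Within es A G
  Within (e ∷ es) (just c ∷ A)  G = (e , c) ∈ G × Within es A G

  Realised : ∀ {q} (es : List E) → List (Config q (length es)) → List (E × Fin q) → Set
  Realised es 𝓙 G = Any (λ A → Within es A G) 𝓙

  within-∷ : ∀ {q} es (A : Config q (length es)) {G x} → Within es A G → Within es A (x ∷ G)
  within-∷ []       []            _        = tt
  within-∷ (e ∷ es) (nothing ∷ A) w        = within-∷ es A w
  within-∷ (e ∷ es) (just c ∷ A)  (c∈ , w) = there c∈ , within-∷ es A w

  realised-nothing : ∀ {q} e es (𝓙 : List (Config q (suc (length es)))) {G} →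
                     Realised es (survivors nothing 𝓙) G → Realised (e ∷ es) 𝓙 G
  realised-nothing e es ((nothing ∷ A) ∷ 𝓙) (here w)  = here w
  realised-nothing e es ((nothing ∷ A) ∷ 𝓙) (there w) = there (realised-nothing e es 𝓙 w)
  realised-nothing e es ((just c ∷ A) ∷ 𝓙)  w         = there (realised-nothing e es 𝓙 w)

  realised-just : ∀ {q} e es c (𝓙 : List (Config q (suc (length es)))) {G} →
                  Realised es (survivors (just c) 𝓙) G → Realised (e ∷ es) 𝓙 ((e , c) ∷ G)
  realised-just e es c ((a ∷ A) ∷ 𝓙) w with a ⊑? just c | w
  ... | no _      | w′       = there (realised-just e es c 𝓙 w′)
  ... | yes _     | there w′ = there (realised-just e es c 𝓙 w′)
  realised-just e es c ((nothing ∷ A) ∷ 𝓙) _ | yes _    | here w = here (within-∷ es A w)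
  realised-just e es c ((just _ ∷ A) ∷ 𝓙)  _ | yes refl | here w = here (here refl , within-∷ es A w)

module BlockMiss {E : Set} (k q′ m : ℕ) (p : ℝ)
  (p≼1 : seq p k ≼ 1ℚ) (2≼mp : ι 2 ≼ ι (suc m) ⊗ seq p k) where

  q : ℕ
  q = suc q′

  open Expectation k
  open Block {E} q p

  instance
    tokens≢0 : NonZero (length (tokens q m))
    tokens≢0 = >-nonZero (≤-trans (s≤s z≤n) (≤-reflexive (sym (length-tokens q m))))

  open Rounds (tokens q m) (tokens-1 q m) using (N; Ω)
  open Merge q m

  u P : ℚ
  u = ℤ.+ 1 // suc q′
  P = seq p k

  𝔼-uniform : ∀ g → 𝔼 (uniform q) g ≡ u ⊗ ∑ℚ (allFin q) g
  𝔼-uniform g = go (allFin q)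
    where
    go : ∀ xs → 𝔼 (map (λ c → fromℚ ((ℤ.+ 1 // q) {{Fin.nonZeroIndex c}}) , c) xs) g ≡ u ⊗ ∑ℚ xs g
    go []       = sym (ℚ.*-zeroʳ u)
    go (c ∷ xs) = trans (cong (u ⊗ g c ⊕_) (go xs)) (sym (ℚ.*-distribˡ-+ u (g c) (∑ℚ xs g)))

  0≼P : 0ℚ ≼ P
  0≼P = ⊗-cancelˡ (ι-pos {suc m} (s≤s z≤n)) (subst (_≼ ι (suc m) ⊗ P) (sym (ℚ.*-zeroʳ (ι (suc m)))) (ℚ.≤-trans (0≼ι 2) 2≼mp))

  0≼u : 0ℚ ≼ u
  0≼u = ⊗-cancelˡ (ι-pos {q} (s≤s z≤n)) (subst₂ _≼_ (sym (ℚ.*-zeroʳ (ι q))) (sym (ι-fraction 1 q′)) (0≼ι 1))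

  Qu≡1 : ι q ⊗ u ≡ 1ℚ
  Qu≡1 = ι-fraction 1 q′

  -- `gain` is the effect of an edge probability above `2 / suc m`: it helps, since on average a
  -- coloured edge misses no more often than an absent one (`s≼x`). `slack` is the merging
  -- inequality, and the two add up to the claim.
  step-≼ : ∀ (X S T : ℕ) → N * N * X + 2 * N * S ≤ 2 * N * q * X + T → S ≤ q * X →
           ι N ⊗ ι N ⊗ (P ⊗ (u ⊗ ι S) ⊕ (1ℚ ⊖ P) ⊗ ι X) ≼ ι T
  step-≼ X S T merged S≤ = 0≼b⊖a⇒a≼b (subst (0ℚ ≼_) rearranged (ℚ.+-mono-≤ gain slack))
    where
    open +-*-Solver
    Nq Q x s : ℚ
    Nq = ι N
    Q  = ι q
    x  = ι X
    s  = u ⊗ ι S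
    Qs≡ : Q ⊗ s ≡ ι S
    Qs≡ = trans (sym (ℚ.*-assoc Q u (ι S))) (trans (cong (_⊗ ι S) Qu≡1) (ℚ.*-identityˡ (ι S)))
    Nq≡ : Nq ≡ ι (suc m) ⊗ Q
    Nq≡ = trans (cong ι (length-tokens q m)) (ι-* (suc m) q)
    s≼x : s ≼ x
    s≼x = ⊗-cancelˡ (ι-pos {q} (s≤s z≤n)) (subst₂ _≼_ (sym Qs≡) (ι-* q X) (ι-mono S≤))
    gain : 0ℚ ≼ Nq ⊗ (Nq ⊗ P ⊖ ι 2 ⊗ Q) ⊗ (x ⊖ s)
    gain = ⊗-nonNeg (⊗-nonNeg (0≼ι N) (a≼b⇒0≼b⊖a (subst₂ _≼_ (ℚ.*-comm Q (ι 2))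
        (trans (solve 3 (λ Q m P → Q :* (m :* P) := m :* Q :* P) refl Q (ι (suc m)) P) (cong (_⊗ P) (sym Nq≡)))
        (⊗-monoˡ (0≼ι q) 2≼mp))))
      (a≼b⇒0≼b⊖a s≼x)
    slack : 0ℚ ≼ (ι 2 ⊗ Nq ⊗ Q ⊗ x ⊕ ι T) ⊖ (Nq ⊗ Nq ⊗ x ⊕ ι 2 ⊗ Nq ⊗ (Q ⊗ s))
    slack = a≼b⇒0≼b⊖a (subst₂ _≼_
      (trans (ι-+ (N * N * X) (2 * N * S)) (cong₂ _⊕_ (trans (ι-* (N * N) X) (cong (_⊗ x) (ι-* N N)))
        (trans (ι-* (2 * N) S) (cong₂ _⊗_ (ι-* 2 N) (sym Qs≡)))))
      (trans (ι-+ (2 * N * q * X) T) (cong (_⊕ ι T) (trans (ι-* (2 * N * q) X)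
        (cong (_⊗ x) (trans (ι-* (2 * N) q) (cong (_⊗ Q) (ι-* 2 N)))))))
      (ι-mono merged))
    rearranged : Nq ⊗ (Nq ⊗ P ⊖ ι 2 ⊗ Q) ⊗ (x ⊖ s)
                   ⊕ ((ι 2 ⊗ Nq ⊗ Q ⊗ x ⊕ ι T) ⊖ (Nq ⊗ Nq ⊗ x ⊕ ι 2 ⊗ Nq ⊗ (Q ⊗ s)))
               ≡ ι T ⊖ Nq ⊗ Nq ⊗ (P ⊗ s ⊕ (1ℚ ⊖ P) ⊗ x)
    rearranged = solve 7 (λ N P two Q x s T →
        N :* (N :* P :- two :* Q) :* (x :- s) :+ ((two :* N :* Q :* x :+ T) :- (N :* N :* x :+ two :* N :* (Q :* s)))
        := T :- N :* N :* (P :* s :+ (con 1ℚ :- P) :* x)) refl Nq P (ι 2) Q x s (ι T)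

  -- A comparison in inductive form: at each edge the single exposure is set against two tokens by
  -- `step-≼`, and the family shrinks to its `survivors`.
  block-≼ : ∀ es (𝓙 : List (Config q (length es))) f → (∀ G → f G ≼ 1ℚ) →
            (∀ G → Sub G es → Realised es 𝓙 G → f G ≼ 0ℚ) →
            ι (N ^ length es * N ^ length es) ⊗ block es f ≼ ι (misses 𝓙)
  block-≼ [] [] f f≼1 _ = ℚ.≤-trans (ℚ.≤-reflexive (trans (cong (_⊗ f []) (ℚ.+-identityʳ 1ℚ)) (ℚ.*-identityˡ (f []))))
    (ℚ.≤-trans (f≼1 []) (subst (1ℚ ≼_) (cong ι (sym one)) (ℚ.≤-reflexive (sym (ℚ.+-identityʳ 1ℚ)))))
    where
    one : misses {0} [] ≡ 1
    one = trans (∑-∷ [] [] _) (cong₂ _+_ (trans (∑-∷ [] [] _) (cong suc (∑-[] _))) (∑-[] _))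
  block-≼ [] ([] ∷ 𝓙) f f≼1 f≼0 = ℚ.≤-trans (ℚ.≤-reflexive (trans (cong (_⊗ f []) (ℚ.+-identityʳ 1ℚ)) (ℚ.*-identityˡ (f []))))
    (ℚ.≤-trans (f≼0 [] [] (here tt)) (0≼ι (misses ([] ∷ 𝓙))))
  block-≼ (e ∷ es) 𝓙 f f≼1 f≼0 = ℚ.≤-trans (ℚ.≤-reflexive scaled) (ℚ.≤-trans
      (⊗-monoˡ (⊗-nonNeg (0≼ι N) (0≼ι N)) (ℚ.+-mono-≤
        (⊗-monoˡ 0≼P (⊗-monoˡ 0≼u (ℚ.≤-trans
          (∑ℚ-mono (allFin q) λ c → block-≼ es (survivors (just c) 𝓙) (λ G → f ((e , c) ∷ G))
            (λ G → f≼1 ((e , c) ∷ G)) λ G sub real → f≼0 ((e , c) ∷ G) (keep sub) (realised-just e es c 𝓙 real))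
          (ℚ.≤-reflexive (∑ℚ-ι (allFin q) _)))))
        (⊗-monoˡ (a≼b⇒0≼b⊖a p≼1) (block-≼ es (survivors nothing 𝓙) f f≼1
          λ G sub real → f≼0 G (skip sub) (realised-nothing e es 𝓙 real)))))
      (step-≼ (misses (survivors nothing 𝓙)) (∑[ c ∈ allFin q ] misses (survivors (just c) 𝓙)) (misses 𝓙) (merge 𝓙)
        (≤-trans (∑-≤-const (allFin q) λ c → misses-just≤ c 𝓙)
          (≤-reflexive (cong (_* misses (survivors nothing 𝓙)) (length-allFin q))))))
    where
    open +-*-Solver
    n₂ B : ℚ
    n₂ = ι (N ^ length es * N ^ length es)
    B = block es f
    blocks : Fin q → ℚ
    blocks c = block es (λ G → f ((e , c) ∷ G))
    scaled : ι (N ^ length (e ∷ es) * N ^ length (e ∷ es)) ⊗ block (e ∷ es) f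
           ≡ ι N ⊗ ι N ⊗ (P ⊗ (u ⊗ ∑ℚ (allFin q) (λ c → n₂ ⊗ blocks c)) ⊕ (1ℚ ⊖ P) ⊗ (n₂ ⊗ B))
    scaled = trans (cong₂ _⊗_
        (trans (cong ι ([m*n]*[o*p]≡[m*o]*[n*p] N (N ^ length es) N (N ^ length es)))
          (trans (ι-* (N * N) (N ^ length es * N ^ length es)) (cong (_⊗ n₂) (ι-* N N))))
        (cong (λ z → P ⊗ z ⊕ (1ℚ ⊖ P) ⊗ B) (𝔼-uniform blocks)))
      (trans (solve 6 (λ N n P u S B → N :* N :* n :* (P :* (u :* S) :+ (con 1ℚ :- P) :* B)
                 := N :* N :* (P :* (u :* (n :* S)) :+ (con 1ℚ :- P) :* (n :* B)))
               refl (ι N) n₂ P u (∑ℚ (allFin q) blocks) B)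
        (cong (λ z → ι N ⊗ ι N ⊗ (P ⊗ (u ⊗ z) ⊕ (1ℚ ⊖ P) ⊗ (n₂ ⊗ B))) (sym (∑ℚ-*ˡ (allFin q) n₂ blocks))))

  block-1 : ∀ es → block es (λ _ → 1ℚ) ≡ 1ℚ
  block-1 []       = refl
  block-1 (e ∷ es) = trans (cong₂ (λ x y → P ⊗ x ⊕ (1ℚ ⊖ P) ⊗ y) uniform-1 (block-1 es))
    (solve 1 (λ P → P :* con 1ℚ :+ (con 1ℚ :- P) :* con 1ℚ := con 1ℚ) refl P)
    where
    open +-*-Solver
    uniform-1 : 𝔼 (uniform q) (λ c → block es (λ _ → 1ℚ)) ≡ 1ℚ
    uniform-1 = begin
      𝔼 (uniform q) (λ c → block es (λ _ → 1ℚ))   ≡⟨ 𝔼-cong (uniform q) (λ _ → block-1 es) ⟩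
      𝔼 (uniform q) (λ _ → 1ℚ)                     ≡⟨ 𝔼-uniform (λ _ → 1ℚ) ⟩
      u ⊗ ∑ℚ (allFin q) (λ _ → 1ℚ)                 ≡⟨ cong (u ⊗_) (∑ℚ-ι (allFin q) (λ _ → 1)) ⟩
      u ⊗ ι (∑ (allFin q) (λ _ → 1))               ≡⟨ cong (λ z → u ⊗ ι z) (trans (∑-const (allFin q) 1)
                                                        (trans (*-identityʳ _) (length-allFin q))) ⟩
      u ⊗ ι q                                      ≡⟨ trans (ℚ.*-comm u (ι q)) Qu≡1 ⟩
      1ℚ ∎
      where open ≡-Reasoning

  module _ (es : List E) {Q : List (E × Fin q) → Set} (Q? : Decidable Q) where

    failure : ℚ
    failure = block es (λ G → 1ℚ ⊖ indicator (Q? G))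

    success+failure : seq (Pr (randomColoured es) Q?) k ⊕ failure ≡ 1ℚ
    success+failure = begin
      seq (Pr (randomColoured es) Q?) k ⊕ failure
        ≡⟨ cong₂ _⊕_ (seq-Pr (randomColoured es) Q?) (sym (𝔼-block es λ G → 1ℚ ⊖ indicator (Q? G))) ⟩
      𝔼 (randomColoured es) (λ G → indicator (Q? G)) ⊕ 𝔼 (randomColoured es) (λ G → 1ℚ ⊖ indicator (Q? G))
        ≡⟨ 𝔼-+ (randomColoured es) (λ G → indicator (Q? G)) (λ G → 1ℚ ⊖ indicator (Q? G)) ⟨
      𝔼 (randomColoured es) (λ G → indicator (Q? G) ⊕ (1ℚ ⊖ indicator (Q? G)))
        ≡⟨ 𝔼-cong (randomColoured es) (λ G →
             solve 1 (λ x → x :+ (con 1ℚ :- x) := con 1ℚ) refl (indicator (Q? G))) ⟩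
      𝔼 (randomColoured es) (λ _ → 1ℚ)
        ≡⟨ trans (𝔼-block es λ _ → 1ℚ) (block-1 es) ⟩
      1ℚ ∎
      where
      open ≡-Reasoning
      open +-*-Solver

    success-≽ : ∀ (𝓙 : List (Config q (length es))) D {δ} → (∀ G → Sub G es → Realised es 𝓙 G → Q G) →
      D * misses 𝓙 ≤ 3 * (N ^ length es * N ^ length es) → 1 ≤ D → ι 3 ≼ ι D ⊗ δ →
      1ℚ ≼ seq (Pr (randomColoured es) Q?) k ⊕ δ
    success-≽ 𝓙 D {δ} realised⇒Q few 1≤D 3≼Dδ = subst (_≼ success ⊕ δ) success+failure
      (ℚ.+-monoʳ-≤ success (⊗-cancelˡ (ι-pos {D} 1≤D) (ℚ.≤-trans failure≼ 3≼Dδ)))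
      where
      open ℚ.≤-Reasoning
      open +-*-Solver
      success : ℚ
      success = seq (Pr (randomColoured es) Q?) k
      n₂ : ℕ
      n₂ = N ^ length es * N ^ length es
      n₂>0 : 0 < n₂
      n₂>0 = *-mono-≤ (m^n>0 N (length es)) (m^n>0 N (length es))
      failure≼ : ι D ⊗ failure ≼ ι 3
      failure≼ = ⊗-cancelˡ (ι-pos {n₂} n₂>0) (begin
        ι n₂ ⊗ (ι D ⊗ failure)     ≡⟨ solve 3 (λ a b c → a :* (b :* c) := b :* (a :* c)) refl (ι n₂) (ι D) failure ⟩
        ι D ⊗ (ι n₂ ⊗ failure)     ≤⟨ ⊗-monoˡ (0≼ι D) (block-≼ es 𝓙 (λ G → 1ℚ ⊖ indicator (Q? G))
                                        (λ G → 1⊖indicator≼1 (Q? G))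
                                        (λ G sub real → 1⊖indicator-yes (Q? G) (realised⇒Q G sub real))) ⟩
        ι D ⊗ ι (misses 𝓙)         ≡⟨ ι-* D (misses 𝓙) ⟨
        ι (D * misses 𝓙)           ≤⟨ ι-mono few ⟩
        ι (3 * n₂)                 ≡⟨ trans (ι-* 3 n₂) (ℚ.*-comm (ι 3) (ι n₂)) ⟩
        ι n₂ ⊗ ι 3 ∎)

-- From a realised copy to a rainbow power of a Hamilton cycle

pairs-sorted : ∀ {n} {e : Edge n} → e ∈ pairs n → toℕ (proj₁ e) < toℕ (proj₂ e)
pairs-sorted {n} e∈ = proj₂ (∈-filter⁻ (λ (u , v) → u Fin.<? v) {xs = cartesianProduct (allFin n) (allFin n)} e∈)

∈-pairs : ∀ {n} {u v : Fin n} → toℕ u < toℕ v → (u , v) ∈ pairs n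
∈-pairs {n} {u} {v} u<v = ∈-filter⁺ (λ (u , v) → u Fin.<? v) (∈-cartesianProduct⁺ (∈-allFin u) (∈-allFin v)) u<v

pairs-unique : ∀ n → List.Unique (pairs n)
pairs-unique n = ListUnique.filter⁺ _ (ListUnique.cartesianProduct⁺ (ListUnique.allFin⁺ n) (ListUnique.allFin⁺ n))

sub-∈ᴱ : ∀ {E : Set} {q} {G : List (E × Fin q)} {es e c} → Sub G es → (e , c) ∈ G → e ∈ es
sub-∈ᴱ (keep sub) (here refl) = here refl
sub-∈ᴱ (keep sub) (there x∈)  = there (sub-∈ᴱ sub x∈)
sub-∈ᴱ (skip sub) x∈          = there (sub-∈ᴱ sub x∈)

sub-colour : ∀ {E : Set} {q} {G : List (E × Fin q)} {es e c c′} → Sub G es → List.Unique es →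
             (e , c) ∈ G → (e , c′) ∈ G → c ≡ c′
sub-colour (keep sub) (e∉ ∷ u) (here refl) (here refl) = refl
sub-colour (keep sub) (e∉ ∷ u) (here refl) (there x∈)  = ⊥-elim (ListAll.lookup e∉ (sub-∈ᴱ sub x∈) refl)
sub-colour (keep sub) (e∉ ∷ u) (there x∈)  (here refl) = ⊥-elim (ListAll.lookup e∉ (sub-∈ᴱ sub x∈) refl)
sub-colour (keep sub) (e∉ ∷ u) (there x∈)  (there y∈)  = sub-colour sub u x∈ y∈
sub-colour (skip sub) (_ ∷ u)  x∈ y∈                   = sub-colour sub u x∈ y∈

module Extraction (n r q : ℕ) {{_ : NonZero n}} (r≤n : r ≤ n) (3≤n : 3 ≤ n) where

  open Labels n r q r≤n

  module _ (σ : Arrangement) (π : Colouring) (σ∈ : σ ∈ injections n n) (π∈ : π ∈ injections (n * r) q) where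

    hamilton : HamiltonCycle n
    hamilton = record { 3≤n = 3≤n ; vertices = σ ; distinct = injections-unique n n σ∈ }

    σ-injective : ∀ {i j} → lookup σ i ≡ lookup σ j → i ≡ j
    σ-injective = Unique.lookup-injective (injections-unique n n σ∈) _ _

    Close : ℕ → Fin n → Fin n → Set
    Close d i j = j ≡ pos (toℕ i + d) ⊎ i ≡ pos (toℕ j + d)

    next-pos : ∀ {i j : Fin n} → Next i j → j ≡ pos (toℕ i + 1)
    next-pos {i} {j} (inj₁ eq) = trans (sym (pos-toℕ j)) (cong pos (trans (sym eq) (+-comm 1 (toℕ i))))
    next-pos {i} {j} (inj₂ (eq , j≡0)) = trans (sym (pos-toℕ j)) (trans (cong pos j≡0)
      (trans (sym (pos-+n 0)) (cong pos (trans (sym eq) (+-comm 1 (toℕ i))))))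

    pos-cancel : ∀ a b → pos (a + 1) ≡ pos (b + 1) → pos a ≡ pos b
    pos-cancel a b eq = trans (sym (drop a)) (trans (cong (λ z → pos (toℕ z + (n ∸ 1))) eq) (drop b))
      where
      drop : ∀ a → pos (toℕ (pos (a + 1)) + (n ∸ 1)) ≡ pos a
      drop a = trans (pos-+ (a + 1) (n ∸ 1)) (trans (cong pos (trans (+-assoc a 1 (n ∸ 1))
        (cong (a +_) (m+[n∸m]≡n (≤-trans (s≤s z≤n) 3≤n))))) (pos-+n a))

    close-0 : ∀ {i j} → i ≡ pos (toℕ j + 0) → i ≡ j
    close-0 {i} {j} eq = trans eq (trans (cong pos (+-identityʳ (toℕ j))) (pos-toℕ j))

    -- A step forward from `i` adds one to a forward distance and takes one off a backward distance,
    -- which at 0 turns into a forward one.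
    step-ahead : ∀ {i j k d} → j ≡ pos (toℕ i + 1) → Close d j k → ∃[ d′ ] d′ ≤ suc d × Close d′ i k
    step-ahead {i} {j} {k} {d} refl (inj₁ eq) = suc d , ≤-refl , inj₁ (trans eq (trans (pos-+ (toℕ i + 1) d)
      (cong pos (+-assoc (toℕ i) 1 d))))
    step-ahead {d = zero} refl (inj₂ eq) = 1 , ≤-refl , inj₁ (sym (close-0 eq))
    step-ahead {i} {k = k} {d = suc d} refl (inj₂ eq) = d , m≤n⇒m≤1+n (n≤1+n d) , inj₂ (trans (sym (pos-toℕ i))
      (pos-cancel (toℕ i) (toℕ k + d) (trans eq (cong pos (trans (cong (toℕ k +_) (+-comm 1 d)) (sym (+-assoc (toℕ k) d 1)))))))

    step-back : ∀ {i j k d} → i ≡ pos (toℕ j + 1) → Close d j k → ∃[ d′ ] d′ ≤ suc d × Close d′ i k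
    step-back {i} {j} {k} {d} eq (inj₂ refl) = suc d , ≤-refl , inj₂ (trans eq (trans (pos-+ (toℕ k + d) 1)
      (cong pos (trans (+-assoc (toℕ k) d 1) (cong (toℕ k +_) (+-comm d 1))))))
    step-back {j = j} {d = zero} eq (inj₁ eq′) = 1 , ≤-refl , inj₂ (trans eq (cong (λ z → pos (toℕ z + 1)) (sym (close-0 eq′))))
    step-back {i} {j} {k} {suc d} refl (inj₁ eq) = d , m≤n⇒m≤1+n (n≤1+n d) ,
      inj₁ (trans eq (trans (cong pos (sym (+-assoc (toℕ j) 1 d))) (sym (pos-+ (toℕ j + 1) d))))

    -- Walks in the cycle may turn round, so the induction keeps only that the end lies at most `s`
    -- positions away in one of the two directions.
    walk : ∀ s {i v} → DistAtMost (Adj (cycle hamilton)) s (lookup σ i) v →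
           ∃[ j ] ∃[ d ] lookup σ j ≡ v × d ≤ s × Close d i j
    here-close : ∀ i → Close 0 i i
    here-close i = inj₁ (sym (trans (cong pos (+-identityʳ (toℕ i))) (pos-toℕ i)))
    walk zero {i} refl = i , 0 , refl , z≤n , here-close i
    walk (suc s) {i} (inj₁ refl) = i , 0 , refl , z≤n , here-close i
    walk (suc s) {i} (inj₂ (w , inj₁ (i′ , j , next , eq , refl) , dist)) with σ-injective eq | walk s dist
    ... | refl | k , d , eq′ , d≤s , close with step-ahead (next-pos next) close
    ...   | d′ , d′≤ , close′ = k , d′ , eq′ , ≤-trans d′≤ (s≤s d≤s) , close′
    walk (suc s) {i} (inj₂ (w , inj₂ (j , i′ , next , refl , eq) , dist)) with σ-injective eq | walk s dist
    ... | refl | k , d , eq′ , d≤s , close with step-back (next-pos next) close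
    ...   | d′ , d′≤ , close′ = k , d′ , eq′ , ≤-trans d′≤ (s≤s d≤s) , close′

    ahead-linked : ∀ i d → d < r → Linked σ (lookup σ i , lookup σ (pos (toℕ i + suc d)))
    ahead-linked i d d<r = pos (toℕ i + suc d) , fromℕ< d<r , inj₂ (refl , cong (lookup σ) eq)
      where
      eq : back (pos (toℕ i + suc d)) (fromℕ< d<r) ≡ i
      eq = trans (cong (λ z → back (pos (toℕ i + suc z)) (fromℕ< d<r)) (sym (Fin.toℕ-fromℕ< d<r))) (back-ahead i (fromℕ< d<r))

    linked-sym : ∀ {u v} → Linked σ (u , v) → Linked σ (v , u)
    linked-sym (i , d , inj₁ j) = i , d , inj₂ j
    linked-sym (i , d , inj₂ j) = i , d , inj₁ j

    close-linked : ∀ {i j d} → lookup σ i ≢ lookup σ j → d ≤ r → Close d i j → Linked σ (lookup σ i , lookup σ j)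
    close-linked {d = zero}  ≢ d≤r (inj₁ eq)   = ⊥-elim (≢ (cong (lookup σ) (sym (close-0 eq))))
    close-linked {d = zero}  ≢ d≤r (inj₂ eq)   = ⊥-elim (≢ (cong (lookup σ) (close-0 eq)))
    close-linked {i} {d = suc d} ≢ d≤r (inj₁ refl) = ahead-linked i d d≤r
    close-linked {j = j} {d = suc d} ≢ d≤r (inj₂ refl) = linked-sym (ahead-linked j d d≤r)

    power-linked : ∀ {u v} → Adj (power r (cycle hamilton)) u v → Linked σ (u , v)
    power-linked {u} {v} (u≢v , dist) with occurs dist
      where
      occurs : ∀ {s} → DistAtMost (Adj (cycle hamilton)) s u v → u ≢ v → ∃[ i ] lookup σ i ≡ u
      occurs {zero}  eq        ≢ = ⊥-elim (≢ eq)
      occurs {suc s} (inj₁ eq) ≢ = ⊥-elim (≢ eq)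
      occurs {suc s} (inj₂ (_ , inj₁ (i , _ , _ , eq , _) , _)) _ = i , eq
      occurs {suc s} (inj₂ (_ , inj₂ (_ , i , _ , _ , eq) , _)) _ = i , eq
    ... | occ with occ u≢v
    ...   | i , refl with walk r dist
    ...     | j , d , refl , d≤r , close = close-linked u≢v d≤r close

    module _ {G : ColouredGraph n q} (sub : Sub G (pairs n)) (within : Within (pairs n) (config (σ , π) (pairs n)) G) where

      within-∈ : ∀ es → Within es (config (σ , π) es) G → ∀ {e c} → e ∈ es → label (σ , π) e ≡ just c → (e , c) ∈ G
      within-∈ (e ∷ es) w (here refl) eq with label (σ , π) e | eq | w
      ... | just c | refl | c∈ , _ = c∈
      within-∈ (e ∷ es) w (there e∈) eq with label (σ , π) e | w
      ... | just _  | _ , w′ = within-∈ es w′ e∈ eq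
      ... | nothing | w′     = within-∈ es w′ e∈ eq

      edge-slot : ∀ u v → toℕ u < toℕ v → Linked σ (u , v) →
        ∃[ s ] slotOf σ (u , v) ≡ just s × ((u , v) , lookup π (combine (proj₁ s) (proj₂ s))) ∈ G
      edge-slot u v u<v linked with joins-slotOf σ u v linked
      ... | i , d , eq = (i , d) , eq , within-∈ (pairs n) within (∈-pairs u<v) (cong (slotLabel π) eq)

      Oriented : Fin n → Fin n → Fin n × Fin n → Set
      Oriented u v e = e ≡ (u , v) ⊎ e ≡ (v , u)

      orient : ∀ u v → u ≢ v → Linked σ (u , v) →
        ∃[ e ] ∃[ s ] Oriented u v e × Sorted e × slotOf σ e ≡ just s × (e , lookup π (combine (proj₁ s) (proj₂ s))) ∈ G
      orient u v u≢v linked with <-cmp (toℕ u) (toℕ v)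
      ... | tri< u<v _ _ = let (s , eq , ∈G) = edge-slot u v u<v linked in (u , v) , s , inj₁ refl , u<v , eq , ∈G
      ... | tri≈ _ eq _  = ⊥-elim (u≢v (Fin.toℕ-injective eq))
      ... | tri> _ _ v<u = let (s , eq , ∈G) = edge-slot v u v<u (linked-sym linked) in (v , u) , s , inj₂ refl , v<u , eq , ∈G

      contained : power r (cycle hamilton) ⊆ᴳ G
      contained u v adj with orient u v (proj₁ adj) (power-linked adj)
      ... | .(u , v) , s , inj₁ refl , _ , _ , ∈G = _ , inj₁ ∈G
      ... | .(v , u) , s , inj₂ refl , _ , _ , ∈G = _ , inj₂ ∈G

      -- All pairs in `G` are sorted, so the wrong orientation cannot occur.
      has-edge-∈ : ∀ {u v e c} → Oriented u v e → Sorted e → HasEdge G u v c → (e , c) ∈ G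
      has-edge-∈ (inj₁ refl) _ (inj₁ ∈G) = ∈G
      has-edge-∈ (inj₂ refl) _ (inj₂ ∈G) = ∈G
      has-edge-∈ (inj₁ refl) sorted (inj₂ ∈G) = ⊥-elim (<-asym sorted (pairs-sorted (sub-∈ᴱ sub ∈G)))
      has-edge-∈ (inj₂ refl) sorted (inj₁ ∈G) = ⊥-elim (<-asym sorted (pairs-sorted (sub-∈ᴱ sub ∈G)))

      -- An edge of the power has only one colour in `G`, namely that of its slot in `π`.
      -- Injectivity of `π` turns equal colours into equal slots, and a slot determines its sorted
      -- pair.
      rainbow : Rainbow (power r (cycle hamilton)) G
      rainbow u v x y adj adj′ c has has′
        with orient u v (proj₁ adj) (power-linked adj) | orient x y (proj₁ adj′) (power-linked adj′)
      ... | e , (i , d) , o , sorted , slot , ∈G | e′ , (i′ , d′) , o′ , sorted′ , slot′ , ∈G′ = same o o′ e≡e′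
        where
        colour≡ : lookup π (combine i d) ≡ lookup π (combine i′ d′)
        colour≡ = trans (sub-colour sub (pairs-unique n) ∈G (has-edge-∈ o sorted has))
          (sub-colour sub (pairs-unique n) (has-edge-∈ o′ sorted′ has′) ∈G′)
        combine≡ : combine i d ≡ combine i′ d′
        combine≡ = Unique.lookup-injective (injections-unique (n * r) q π∈) _ _ colour≡
        slot≡ : (i , d) ≡ (i′ , d′)
        slot≡ = cong₂ _,_ (Fin.combine-injectiveˡ i d i′ d′ combine≡) (Fin.combine-injectiveʳ i d i′ d′ combine≡)
        e≡e′ : e ≡ e′
        e≡e′ = slotOf-injective σ e e′ sorted sorted′ slot (trans slot′ (cong just (sym slot≡)))
        same : ∀ {e e′} → Oriented u v e → Oriented x y e′ → e ≡ e′ → (u ≡ x × v ≡ y) ⊎ (u ≡ y × v ≡ x)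
        same (inj₁ refl) (inj₁ refl) refl = inj₁ (refl , refl)
        same (inj₁ refl) (inj₂ refl) refl = inj₂ (refl , refl)
        same (inj₂ refl) (inj₁ refl) refl = inj₂ (refl , refl)
        same (inj₂ refl) (inj₂ refl) refl = inj₁ (refl , refl)

  realised-rainbow : ∀ {G : ColouredGraph n q} → Sub G (pairs n) →
    Realised (pairs n) (map (λ B → config B (pairs n)) copies) G → ContainsRainbowPower r G
  realised-rainbow sub real with find real
  ... | A , A∈ , within with ∈-map⁻ (λ B → config B (pairs n)) A∈
  ...   | (σ , π) , B∈ , refl = let (σ∈ , π∈) = copies-∈ B∈ in
          hamilton σ π σ∈ π∈ , contained σ π σ∈ π∈ sub within , rainbow σ π σ∈ π∈ sub within

-- Passing to the real numbers

ι-cancel-≤ : ∀ {m n} → ι m ≼ ι n → m ≤ n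
ι-cancel-≤ {zero}          _ = z≤n
ι-cancel-≤ {suc m} {zero}  h = ⊥-elim (ℚ.<-irrefl refl (ℚ.<-≤-trans (ι-pos {suc m} (s≤s z≤n)) h))
ι-cancel-≤ {suc m} {suc n} h = s≤s (ι-cancel-≤ (subst₂ _≼_ (drop (ι m)) (drop (ι n)) (ℚ.+-monoʳ-≤ (⊝ 1ℚ) h)))
  where
  open +-*-Solver
  drop : ∀ x → ⊝ 1ℚ ⊕ (1ℚ ⊕ x) ≡ x
  drop = solve 1 (λ x → :- con 1ℚ :+ (con 1ℚ :+ x) := x) refl

greatest-holds : {P : ℕ → Set} (P? : Decidable P) → ∀ b → greatest P? b ≡ 0 ⊎ P (greatest P? b)
greatest-holds P? zero = inj₁ refl
greatest-holds P? (suc b) with P? (suc b)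
... | yes p = inj₂ p
... | no  _ = greatest-holds P? b

greatest-max : {P : ℕ → Set} (P? : Decidable P) → ∀ b {j} → j ≤ b → greatest P? b < j → ¬ P j
greatest-max P? zero    z≤n ()
greatest-max P? (suc b) {j} j≤ <j with P? (suc b) | j ≟ suc b
... | yes _ | _        = ⊥-elim (<⇒≱ <j j≤)
... | no ¬p | yes refl = ¬p
... | no _  | no j≢    = greatest-max P? b (s≤s⁻¹ (≤∧≢⇒< j≤ j≢)) <j

root-small : ∀ n r s → 1 ≤ r → rootNum n r s ^ r * n ≤ s ^ r
root-small n (suc r) s _ with greatest-holds (λ j → j ^ suc r * n ≤? s ^ suc r) s
... | inj₁ eq = subst (λ a → a ^ suc r * n ≤ s ^ suc r) (sym eq) z≤n
... | inj₂ h  = h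

root-large : ∀ n r s → 1 ≤ n → s ^ r ≤ suc (rootNum n r s) ^ r * n
root-large n r s 1≤n with suc (rootNum n r s) ≤? s
... | yes h = <⇒≤ (≰⇒> (greatest-max (λ j → j ^ r * n ≤? s ^ r) s h ≤-refl))
... | no ¬h = ≤-trans (^-monoˡ-≤ r (<⇒≤ (≰⇒> ¬h))) (m≤m*n _ n {{>-nonZero 1≤n}})

scaled-root : ∀ κ j s → ι (suc s) ⊗ (ι κ ⊗ (ℤ.+ j // suc s)) ≡ ι (κ * j)
scaled-root κ j s = trans (solve 3 (λ a b c → a :* (b :* c) := b :* (a :* c)) refl (ι (suc s)) (ι κ) (ℤ.+ j // suc s))
  (trans (cong (ι κ ⊗_) (ι-fraction j s)) (sym (ι-* κ j)))
  where open +-*-Solver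

-- The hypothesis bounds the approximations of `p` only up to an arbitrary error, but `κ ^ r` and
-- `n` are integers: a violation would be by a factor of at least `1 + 1 / n`.
κ^r≤n : ∀ κ n r p → (∀ k → seq p k ≡ ι κ ⊗ rootSeq n r k) → 1 ≤ n → 1 ≤ r → p ≤ᴿ 1ᴿ → κ ^ r ≤ n
κ^r≤n κ n r p p≡ 1≤n 1≤r p≤1 = ≮⇒≥ λ n<κ^r → absurd n<κ^r (p≤1 (ℤ.+ 1 // suc T′) 0<1/T)
  where
  -- (1 + 2 / T)^r < 1 + 1 / n for this T; the approximations of p exceed
  -- 1 + 1 / T in the limit if κ^r ≥ n + 1.
  T′ T : ℕ
  T′ = 2 * r * suc n
  T = suc T′
  0<1/T : 0ℚ ≺ ℤ.+ 1 // suc T′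
  0<1/T = ℚ.*-cancelˡ-<-nonNeg (ι T) {{ℚ.nonNegative (0≼ι T)}}
    (subst₂ _≺_ (sym (ℚ.*-zeroʳ (ι T))) (sym (ι-fraction 1 T′)) (ι-pos {1} (s≤s z≤n)))
  absurd : n < κ ^ r →
    ¬ (∃[ N ] ∀ k → N ≤ k → seq p k ≼ 1ℚ ⊕ (ℤ.+ 1 // suc T′))
  absurd n<κ^r (N₁ , bounded) = 1+n≰n (+-cancelˡ-≤ (n * T) 1 0 (begin
      n * T + 1                        ≡⟨ expand r n ⟩
      suc n * (2 * r * n + 1)          ≡⟨ cong (suc n *_) (sym T∸2r) ⟩
      suc n * (T ∸ 2 * r)              ≤⟨ *-monoˡ-≤ (T ∸ 2 * r) n<κ^r ⟩
      κ ^ r * (T ∸ 2 * r)              ≤⟨ *-cancelˡ-≤ (T ^ r) {{m^n≢0 T r}} chain ⟩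
      n * T                            ≡⟨ +-identityʳ (n * T) ⟨
      n * T + 0 ∎))
    where
    open ≤-Reasoning
    expand : ∀ r n → n * (1 + 2 * r * (1 + n)) + 1 ≡ (1 + n) * (2 * r * n + 1)
    expand = solve-∀
    split : ∀ r n → 1 + 2 * r * (1 + n) ≡ 2 * r + (2 * r * n + 1)
    split = solve-∀
    T∸2r : T ∸ 2 * r ≡ 2 * r * n + 1
    T∸2r = trans (cong (_∸ 2 * r) (split r n)) (m+n∸m≡n (2 * r) (2 * r * n + 1))
    k S j : ℕ
    -- From `T * κ` on, rounding the root down changes `p` by less than `1 / T`.
    k = N₁ ⊔ T * κ
    S = suc k
    j = rootNum n r S
    Tκj≤ : T * (κ * j) ≤ S * (T + 1)
    Tκj≤ = ι-cancel-≤ (subst₂ _≼_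
      (trans (ℚ.*-assoc (ι T) (ι S) (seq p k)) (trans (cong (ι T ⊗_) (trans (cong (ι S ⊗_) (p≡ k)) (scaled-root κ j k)))
        (sym (ι-* T (κ * j)))))
      right
      (⊗-monoˡ (⊗-nonNeg (0≼ι T) (0≼ι S)) (bounded k (m≤m⊔n N₁ (T * κ)))))
      where
      open +-*-Solver
      right : ι T ⊗ ι S ⊗ (1ℚ ⊕ (ℤ.+ 1 // suc T′)) ≡ ι (S * (T + 1))
      right = trans (solve 3 (λ T S u → T :* S :* (con 1ℚ :+ u) := S :* (T :+ T :* u)) refl (ι T) (ι S) (ℤ.+ 1 // suc T′))
        (trans (cong (λ z → ι S ⊗ (ι T ⊕ z)) (ι-fraction 1 T′))
          (trans (cong (ι S ⊗_) (sym (ι-+ T 1))) (sym (ι-* S (T + 1)))))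
    Tκ[1+j]≤ : T * κ * suc j ≤ (T + 2) * S
    Tκ[1+j]≤ = begin
      T * κ * suc j               ≡⟨ lemma₁ T κ j ⟩
      T * (κ * j) + T * κ         ≤⟨ +-mono-≤ Tκj≤ (≤-trans (m≤n⊔m N₁ (T * κ)) (n≤1+n k)) ⟩
      S * (T + 1) + S             ≡⟨ lemma₂ S T ⟩
      (T + 2) * S ∎
      where
      lemma₁ : ∀ t κ j → t * κ * (1 + j) ≡ t * (κ * j) + t * κ
      lemma₁ = solve-∀
      lemma₂ : ∀ s t → s * (t + 1) + s ≡ (t + 2) * s
      lemma₂ = solve-∀
    powers : T ^ r * κ ^ r ≤ (T + 2) ^ r * n
    powers = *-cancelʳ-≤ _ _ (suc j ^ r) {{m^n≢0 (suc j) r}} (begin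
      T ^ r * κ ^ r * suc j ^ r         ≡⟨ cong (_* suc j ^ r) (^-distribʳ-* T κ r) ⟨
      (T * κ) ^ r * suc j ^ r           ≡⟨ ^-distribʳ-* (T * κ) (suc j) r ⟨
      (T * κ * suc j) ^ r               ≤⟨ ^-monoˡ-≤ r Tκ[1+j]≤ ⟩
      ((T + 2) * S) ^ r                 ≡⟨ ^-distribʳ-* (T + 2) S r ⟩
      (T + 2) ^ r * S ^ r               ≤⟨ *-monoʳ-≤ ((T + 2) ^ r) (root-large n r S 1≤n) ⟩
      (T + 2) ^ r * (suc j ^ r * n)     ≡⟨ reorder ((T + 2) ^ r) (suc j ^ r) n ⟩
      (T + 2) ^ r * n * suc j ^ r ∎)
      where
      reorder : ∀ a b c → a * (b * c) ≡ a * c * b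
      reorder = solve-∀
    chain : T ^ r * (κ ^ r * (T ∸ 2 * r)) ≤ T ^ r * (n * T)
    chain = begin
      T ^ r * (κ ^ r * (T ∸ 2 * r))     ≡⟨ *-assoc (T ^ r) (κ ^ r) (T ∸ 2 * r) ⟨
      T ^ r * κ ^ r * (T ∸ 2 * r)       ≤⟨ *-monoˡ-≤ (T ∸ 2 * r) powers ⟩
      (T + 2) ^ r * n * (T ∸ 2 * r)     ≡⟨ reorder ((T + 2) ^ r) n (T ∸ 2 * r) ⟩
      n * ((T + 2) ^ r * (T ∸ 2 * r))   ≤⟨ *-monoʳ-≤ n (bernoulli-≤ T 2 r) ⟩
      n * (T * T ^ r)                   ≡⟨ reorder₂ n T (T ^ r) ⟩
      T ^ r * (n * T) ∎
      where
      reorder : ∀ a b c → a * b * c ≡ b * (a * c)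
      reorder = solve-∀
      reorder₂ : ∀ a b c → a * (b * c) ≡ c * (a * b)
      reorder₂ = solve-∀

module Approximation (r D K n : ℕ) (2≤r : 2 ≤ r) (1≤D : 1 ≤ D) (r<K : r < K) (threshold : Threshold r D K)
  (1≤n : 1 ≤ n) (κ^r≤ : (8 * K) ^ r ≤ n) (p : ℝ) (p≡ : ∀ k → seq p k ≡ ι (8 * K) ⊗ rootSeq n r k) where

  -- The bounds suc m ≤ 4 / p and 1 + j ≤ 2 j together lose the factor 8.
  κ : ℕ
  κ = 8 * K

  1≤r : 1 ≤ r
  1≤r = ≤-trans (s≤s z≤n) 2≤r

  1≤K : 1 ≤ K
  1≤K = ≤-trans (s≤s z≤n) r<K

  1≤κ : 1 ≤ κ
  1≤κ = *-mono-≤ {1} {8} (s≤s z≤n) 1≤K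

  self≤^ : ∀ {a} → 1 ≤ a → a ≤ a ^ r
  self≤^ {a} 1≤a = ≤-trans (≤-reflexive (sym (*-identityʳ a))) (^-monoʳ-≤ a {{>-nonZero 1≤a}} 1≤r)

  κ≤n : κ ≤ n
  κ≤n = ≤-trans (self≤^ 1≤κ) κ^r≤

  r≤n : r ≤ n
  r≤n = ≤-trans (<⇒≤ r<K) (≤-trans (m≤m+n K (7 * K)) κ≤n)

  3≤n : 3 ≤ n
  3≤n = ≤-trans (≤-trans (s≤s (s≤s (s≤s z≤n))) (*-mono-≤ {8} ≤-refl 1≤K)) κ≤n

  instance
    n≢0 : NonZero n
    n≢0 = >-nonZero 1≤n

  module _ (k : ℕ) (n≤k : n ≤ k) where

    -- The approximation of `p` at index `k` is the fraction `a / S`, and `m` is chosen so that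
    -- `2 / suc m ≤ a / S ≤ 4 / suc m`.
    S j a m : ℕ
    S = suc k
    j = rootNum n r S

    1≤j : 1 ≤ j
    -- The index is at least `n`, so the grid of width `1 / S` is fine enough for a positive
    -- approximation of the root.
    1≤j = n≢0⇒n>0 λ j≡0 → <⇒≱ (s≤s n≤k) (begin
      S                      ≤⟨ self≤^ (s≤s z≤n) ⟩
      S ^ r                  ≤⟨ root-large n r S 1≤n ⟩
      suc j ^ r * n          ≡⟨ cong (λ z → suc z ^ r * n) j≡0 ⟩
      1 ^ r * n              ≡⟨ trans (cong (_* n) (^-zeroˡ r)) (*-identityˡ n) ⟩
      n ∎)
      where open ≤-Reasoning

    a = κ * j

    instance
      a≢0 : NonZero a
      a≢0 = >-nonZero (*-mono-≤ 1≤κ 1≤j)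

    m = (2 * S) / a

    a≤S : a ≤ S
    a≤S = ≮⇒≥ λ S<a → <⇒≱ (^-monoˡ-< r {{>-nonZero 1≤r}} S<a) (begin
      a ^ r             ≡⟨ ^-distribʳ-* κ j r ⟩
      κ ^ r * j ^ r     ≤⟨ *-monoˡ-≤ (j ^ r) κ^r≤ ⟩
      n * j ^ r         ≡⟨ *-comm n (j ^ r) ⟩
      j ^ r * n         ≤⟨ root-small n r S 1≤r ⟩
      S ^ r ∎)
      where open ≤-Reasoning

    2S≤ : 2 * S ≤ suc m * a
    2S≤ = begin
      2 * S                      ≡⟨ m≡m%n+[m/n]*n (2 * S) a ⟩
      (2 * S) % a + m * a        ≤⟨ +-monoˡ-≤ (m * a) (<⇒≤ (m%n<n (2 * S) a)) ⟩
      a + m * a ∎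
      where open ≤-Reasoning

    Km^r≤n : K * suc m ^ r ≤ n
    Km^r≤n = *-cancelʳ-≤ _ _ (8 ^ r * j ^ r) {{m*n≢0 _ _ {{m^n≢0 8 r}} {{m^n≢0 j r {{>-nonZero 1≤j}}}}}} (begin
      K * suc m ^ r * (8 ^ r * j ^ r)
        ≤⟨ *-monoˡ-≤ (8 ^ r * j ^ r) (*-monoˡ-≤ (suc m ^ r) (self≤^ 1≤K)) ⟩
      K ^ r * suc m ^ r * (8 ^ r * j ^ r)
        ≡⟨ reorder (K ^ r) (suc m ^ r) (8 ^ r) (j ^ r) ⟩
      suc m ^ r * (8 ^ r * K ^ r * j ^ r)
        ≡⟨ cong (λ z → suc m ^ r * (z * j ^ r)) (^-distribʳ-* 8 K r) ⟨
      suc m ^ r * (κ ^ r * j ^ r)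
        ≡⟨ trans (cong (suc m ^ r *_) (sym (^-distribʳ-* κ j r))) (sym (^-distribʳ-* (suc m) a r)) ⟩
      (suc m * a) ^ r
        ≤⟨ ^-monoˡ-≤ r ma≤ ⟩
      (4 * S) ^ r
        ≡⟨ ^-distribʳ-* 4 S r ⟩
      4 ^ r * S ^ r
        ≤⟨ *-monoʳ-≤ (4 ^ r) (≤-trans (root-large n r S 1≤n) (*-monoˡ-≤ n (^-monoˡ-≤ r 1+j≤2j))) ⟩
      4 ^ r * ((2 * j) ^ r * n)
        ≡⟨ cong (λ z → 4 ^ r * (z * n)) (^-distribʳ-* 2 j r) ⟩
      4 ^ r * (2 ^ r * j ^ r * n)
        ≡⟨ reorder₂ (4 ^ r) (2 ^ r) (j ^ r) n ⟩
      n * (4 ^ r * 2 ^ r * j ^ r)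
        ≡⟨ cong (λ z → n * (z * j ^ r)) (^-distribʳ-* 4 2 r) ⟨
      n * (8 ^ r * j ^ r) ∎)
      where
      open ≤-Reasoning
      reorder : ∀ a b c d → a * b * (c * d) ≡ b * (c * a * d)
      reorder = solve-∀
      reorder₂ : ∀ a b c d → a * (b * c * d) ≡ d * (a * b * c)
      reorder₂ = solve-∀
      1+j≤2j : suc j ≤ 2 * j
      1+j≤2j = ≤-trans (+-monoˡ-≤ j 1≤j) (≤-reflexive (cong (j +_) (sym (+-identityʳ j))))
      ma≤ : suc m * a ≤ 4 * S
      ma≤ = ≤-trans (+-mono-≤ a≤S (m/n*n≤m (2 * S) a)) (≤-trans (m≤n+m _ S) (≤-reflexive (four S)))
        where
        four : ∀ s → s + (s + 2 * s) ≡ 4 * s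
        four = solve-∀

    scaled-p : ι S ⊗ seq p k ≡ ι a
    scaled-p = trans (cong (ι S ⊗_) (p≡ k)) (scaled-root κ j k)

    p≼1 : seq p k ≼ 1ℚ
    p≼1 = ⊗-cancelˡ (ι-pos {S} (s≤s z≤n)) (subst₂ _≼_ (sym scaled-p) (sym (ℚ.*-identityʳ (ι S))) (ι-mono a≤S))

    2≼mp : ι 2 ≼ ι (suc m) ⊗ seq p k
    2≼mp = ⊗-cancelˡ (ι-pos {S} (s≤s z≤n)) (subst₂ _≼_ (trans (ι-* 2 S) (ℚ.*-comm (ι 2) (ι S)))
      (trans (ι-* (suc m) a) (trans (cong (ι (suc m) ⊗_) (sym scaled-p))
        (solve 3 (λ m S p → m :* (S :* p) := S :* (m :* p)) refl (ι (suc m)) (ι S) (seq p k))))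
      (ι-mono 2S≤))
      where open +-*-Solver

    Pr-large : ∀ q′ → r * n ≤ suc q′ → ∀ {δ} → ι 3 ≼ ι D ⊗ δ →
      1ℚ ≼ seq (Pr (randomColouredGraph n p (suc q′)) (containsRainbowPower? r)) k ⊕ δ
    Pr-large q′ rn≤q = success-≽ (pairs n) (containsRainbowPower? r) family D
      (λ G → Extraction.realised-rainbow n r q r≤n 3≤n)
      (threshold n r≤n m q Km^r≤n rn≤q (pairs n) pairs-sorted (pairs-unique n) tokens≢0) 1≤D
      where
      open BlockMiss {Edge n} k q′ m p p≼1 2≼mp
      open Labels n r q r≤n using (config; copies)
      family : List (Config q (length (pairs n)))
      family = map (λ B → config B (pairs n)) copies

-- The 3 is the one in `two-rounds`.
archimedes : ∀ δ → 0ℚ ≺ δ → ∃[ D ] 1 ≤ D × ι 3 ≼ ι D ⊗ δ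
archimedes δ 0≺δ = go δ {{ℚ.positive 0≺δ}}
  where
  go : ∀ δ → .{{ℚ.Positive δ}} → ∃[ D ] 1 ≤ D × ι 3 ≼ ι D ⊗ δ
  go δ@(mkℚ (ℤ.+ suc a) d _) = 3 * suc d , s≤s z≤n , subst (ι 3 ≼_) (sym eq) (ι-mono {3} {3 * suc a} (*-monoʳ-≤ 3 (s≤s z≤n)))
    where
    eq : ι (3 * suc d) ⊗ δ ≡ ι (3 * suc a)
    eq = trans (cong (_⊗ δ) (ι-* 3 (suc d))) (trans (ℚ.*-assoc (ι 3) (ι (suc d)) δ)
      (trans (cong (ι 3 ⊗_) (trans (cong (ι (suc d) ⊗_) (sym (ℚ.↥p/↧p≡p δ))) (ι-fraction (suc a) d))) (sym (ι-* 3 (suc a)))))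

module Conclusion (ε : ℝ) (δ₀ : ℚ) (N₀ : ℕ) (δ₀≼ε : ∀ k → N₀ ≤ k → 0ℚ ⊕ δ₀ ≼ seq ε k)
  (r D K : ℕ) (2≤r : 2 ≤ r) (1≤D : 1 ≤ D) (3≼Dδ₀ : ι 3 ≼ ι D ⊗ δ₀) (r<K : r < K)
  (threshold : Threshold r D K) where

  K′ : ℝ
  K′ = fromℚ (ι (8 * K))

  1≤r : 1 ≤ r
  1≤r = ≤-trans (s≤s z≤n) 2≤r

  K′-positive : 0ᴿ <ᴿ K′
  K′-positive = ι (8 * K) , ι-pos (*-mono-≤ {1} {8} (s≤s z≤n) (≤-trans (s≤s z≤n) r<K)) , 0 ,
    λ _ _ → ℚ.≤-reflexive (ℚ.+-identityˡ (ι (8 * K)))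

  p : ℕ → ℝ
  p n = K′ *ᴿ (n ^-1/ r)

  success : ℕ → ℕ → ℝ
  success n q = Pr (randomColouredGraph n (p n) q) (containsRainbowPower? r)

  module _ (n : ℕ) (1≤n : 1 ≤ n) (p≤1 : p n ≤ᴿ 1ᴿ) where

    success-≽ᵏ : ∀ q′ → r * n ≤ suc q′ → ∀ k → n ≤ k → 1ℚ ≼ seq (success n (suc q′)) k ⊕ δ₀
    success-≽ᵏ q′ rn≤q k n≤k = Approximation.Pr-large r D K n 2≤r 1≤D r<K threshold 1≤n
      (κ^r≤n (8 * K) n r (p n) (λ _ → refl) 1≤n 1≤r p≤1) (p n) (λ _ → refl) k n≤k q′ rn≤q 3≼Dδ₀

    bound : ∀ q → r * n ≤ q → 1ᴿ -ᴿ ε ≤ᴿ success n q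
    bound zero     rn≤q = ⊥-elim (<⇒≱ (*-mono-≤ 1≤r 1≤n) rn≤q)
    -- From `N₀` on, the approximations of `ε` are at least `δ₀`; from `n` on, those of `p` are fine
    -- enough for `Pr-large`.
    bound (suc q′) rn≤q δ 0≺δ = N₀ ⊔ n , λ k N≤k →
      estimate (seq ε k) (seq (success n (suc q′)) k) (δ₀≼ε k (m⊔n≤o⇒m≤o N₀ n N≤k))
        (success-≽ᵏ q′ rn≤q k (m⊔n≤o⇒n≤o N₀ n N≤k))
      where
      open ℚ.≤-Reasoning
      open +-*-Solver
      estimate : ∀ e s → 0ℚ ⊕ δ₀ ≼ e → 1ℚ ≼ s ⊕ δ₀ → 1ℚ ⊖ e ≼ s ⊕ δ
      estimate e s δ₀≼e 1≼ = begin
        1ℚ ⊖ e          ≤⟨ ℚ.+-monoʳ-≤ 1ℚ (ℚ.neg-antimono-≤ δ₀≼e) ⟩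
        1ℚ ⊖ (0ℚ ⊕ δ₀)  ≤⟨ ℚ.+-monoˡ-≤ (⊝ (0ℚ ⊕ δ₀)) 1≼ ⟩
        s ⊕ δ₀ ⊖ (0ℚ ⊕ δ₀) ≡⟨ solve 2 (λ s d → s :+ d :- (con 0ℚ :+ d) := s :+ con 0ℚ) refl s δ₀ ⟩
        s ⊕ 0ℚ          ≤⟨ ℚ.+-monoʳ-≤ s (ℚ.<⇒≤ 0≺δ) ⟩
        s ⊕ δ ∎

theorem7 : ∀ (ε : ℝ) → 0ᴿ <ᴿ ε → ∀ (r : ℕ) → 2 ≤ r →
    Σ ℝ λ K′ → 0ᴿ <ᴿ K′ ×
    (∀ (n : ℕ) → 1 ≤ n → let p = K′ *ᴿ (n ^-1/ r) in p ≤ᴿ 1ᴿ →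
    ∀ (q : ℕ) → r * n ≤ q →
    1ᴿ -ᴿ ε ≤ᴿ Pr (randomColouredGraph n p q) (containsRainbowPower? r))
theorem7 ε (δ₀ , 0≺δ₀ , N₀ , δ₀≼ε) r 2≤r =
  let (D , 1≤D , 3≼Dδ₀) = archimedes δ₀ 0≺δ₀
      open Conclusion ε δ₀ N₀ δ₀≼ε r D (Constants.K r D) 2≤r 1≤D 3≼Dδ₀ (Constants.r<K r D) (threshold r D 2≤r)
  in K′ , K′-positive , bound
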